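{- We have $$\frac{1-t}{1-t\,\mathrm{Exp}_{q}(yx)\exp_{q}(x)}=1+\sum_{n=1}^{\infty}\frac{(1+yt)^{n+1}}{(1+y)(1-t)^{n}}P_{n}^{(\mathrm{inv},\mathrm{pk},\mathrm{des})}\left(q,\frac{(1+y)^{2}t}{(y+t)(1+yt)},\frac{y+t}{1+yt}\right)\frac{x^{n}}{[n]_{q}!}.$$ Equivalently, $$\sum_{n=1}^{\infty}P_{n}^{(\mathrm{inv},\mathrm{pk},\mathrm{des})}(q,y,t)\frac{x^{n}}{[n]_{q}!}=\frac{v(1+u)}{1+uv}\cdot\frac{\mathrm{Exp}_{q}\left(\frac{u(1-v)}{1+uv}x\right)\exp_{q}\left(\frac{1-v}{1+uv}x\right)-1}{1-v\,\mathrm{Exp}_{q}\left(\frac{u(1-v)}{1+uv}x\right)\exp_{q}\left(\frac{1-v}{1+uv}x\right)},$$ where $$u=\frac{1+t^{2}-2yt-(1-t)\sqrt{(1+t)^{2}-4yt}}{2(1-y)t},\qquad v=\frac{(1+t)^{2}-2yt-(1+t)\sqrt{(1+t)^{2}-4yt}}{2yt}.$$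
   Context: $\mathfrak{S}_n$ is the set of permutations $\pi=\pi_1\cdots\pi_n$ of $[n]=\{1,\dots,n\}$. For $\pi\in\mathfrak{S}_n$: $\mathrm{des}(\pi)$ is the number of $i\in[n-1]$ with $\pi_i>\pi_{i+1}$; $\mathrm{pk}(\pi)$ is the number of $i$ with $2\le i\le n-1$ and $\pi_{i-1}<\pi_i>\pi_{i+1}$; $\mathrm{inv}(\pi)$ is the number of pairs $(i,j)$ with $1\le i<j\le n$ and $\pi_i>\pi_j$. For $n\ge 1$, $P_n^{(\mathrm{inv},\mathrm{pk},\mathrm{des})}(q,y,t)=\sum_{\pi\in\mathfrak{S}_n}q^{\mathrm{inv}(\pi)}y^{\mathrm{pk}(\pi)+1}t^{\mathrm{des}(\pi)+1}$. Also $[n]_q!=(1+q)(1+q+q^2)\cdots(1+q+\cdots+q^{n-1})$ (with $[0]_q!=[1]_q!=1$), $\exp_q(x)=\sum_{n\ge0}\frac{x^n}{[n]_q!}$ and $\mathrm{Exp}_q(x)=\sum_{n\ge0}q^{\binom n2}\frac{x^n}{[n]_q!}$. Here $q,y,t,x$ are indeterminates and the identities are identities of formal power series in $x$: in the first, coefficients are rational functions of $q,y,t$; in the second, coefficients are formal power series in $t$ over $\mathbb{Q}(q)[y]$, where $\sqrt{(1+t)^2-4yt}$ is the power series in $t$ over $\mathbb{Q}[y]$ with constant term $1$, so that $u,v$ are formal power series in $t$ over $\mathbb{Q}[y]$. -}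

module Defs where

open import Level using (Level; 0ℓ; _⊔_) renaming (suc to lsuc)
open import Algebra.Bundles using (CommutativeRing)
import Algebra.Properties.Group as GroupProperties
import Algebra.Properties.Ring as RingProperties
import Algebra.Properties.Semiring.Exp as Exp
import Algebra.Properties.Semiring.Sum as Sum
import Algebra.Solver.Ring.NaturalCoefficients.Default as SemiringSolver
open import Data.Fin.Base using (Fin; zero; suc; toℕ; punchIn)
import Data.Fin.Properties as Fin
open import Data.Fin.Permutation as Perm using (Permutation′; _⟨$⟩ʳ_)
open import Data.List.Base
  using (List; []; _∷_; map; foldr; tabulate; concatMap; allFin)
open import Data.List.Relation.Unary.All as All using ([]; _∷_)
import Data.List.Relation.Unary.All.Properties as All
open import Data.List.Relation.Unary.AllPairs as AllPairs using (AllPairs; []; _∷_)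
import Data.List.Relation.Unary.AllPairs.Properties as AllPairs
open import Data.List.Relation.Unary.Any as Any using (Any; here)
import Data.List.Relation.Unary.Any.Properties as Any
open import Data.Nat.Base as ℕ using (ℕ; zero; suc; _∸_; z≤n; s≤s)
open import Data.Nat.Combinatorics using (_C_)
import Data.Nat.ListAction as ListAction
import Data.Nat.Properties as ℕ
open import Data.Product.Base using (∃-syntax; _×_; _,_)
import Data.Rational.Base as ℚ
import Data.Rational.Properties as ℚ
open import Data.Sum.Base using (_⊎_; inj₁; inj₂)
open import Function.Base using (_∘_)
open import Relation.Binary.PropositionalEquality as ≡ using (_≡_; _≢_)
open import Relation.Nullary using (Dec; yes; no; ¬_; contradiction; _×-dec_)

private
  variable
    c ℓ c′ ℓ′ : Level

------------------------------------------------------------------------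
-- Formal power series

-- Carriers and equalities are wrapped in records, and operations are defined by
-- copatterns, so that conversion checking never compares coefficients.
module PowerSeries (R : CommutativeRing c ℓ) where

  open CommutativeRing R
  open Sum semiring
  open Exp semiring using (_^_)
  open SemiringSolver commutativeSemiring using (solve; _:+_; _:*_; _:=_)
  open import Relation.Binary.Reasoning.Setoid setoid

  -- Σₙ aₙ Xⁿ
  record Series : Set c where
    no-eta-equality
    constructor series
    field
      coeff : ℕ → Carrier
  open Series public

  infix 4 _≋_
  record _≋_ (f g : Series) : Set ℓ where
    constructor pointwise
    field
      at : ∀ n → coeff f n ≈ coeff g n
  open _≋_ public

  const : Carrier → Series
  coeff (const a) zero    = a
  coeff (const a) (suc n) = 0#

  X : Series
  coeff X zero          = 0#
  coeff X (suc zero)    = 1#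
  coeff X (suc (suc n)) = 0#

  infixl 6 _⊕_
  infixl 7 _⊛_

  𝟘 : Series
  coeff 𝟘 n = 0#

  _⊕_ : Series → Series → Series
  coeff (f ⊕ g) n = coeff f n + coeff g n

  ⊖_ : Series → Series
  coeff (⊖ f) n = - coeff f n

  convolution : (f g : ℕ → Carrier) → ℕ → Carrier
  convolution f g n = ∑[ k ≤ n ] (f (toℕ k) * g (n ∸ toℕ k))

  _⊛_ : Series → Series → Series
  coeff (f ⊛ g) = convolution (coeff f) (coeff g)

  private
    _⋆_ : (f g : ℕ → Carrier) → ℕ → Carrier
    _⋆_ = convolution

    tail : (ℕ → Carrier) → ℕ → Carrier
    tail f n = f (suc n)

    ⋆-cong : ∀ {f f′ g g′} → (∀ n → f n ≈ f′ n) → (∀ n → g n ≈ g′ n) →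
             ∀ n → (f ⋆ g) n ≈ (f′ ⋆ g′) n
    ⋆-cong p r n = sum-cong-≋ {suc n} λ k → *-cong (p (toℕ k)) (r (n ∸ toℕ k))

    ⋆-zeroˡ : ∀ f g → (∀ n → f n ≈ 0#) → ∀ n → (f ⋆ g) n ≈ 0#
    ⋆-zeroˡ f g f≈0 zero = trans (+-identityʳ _) (trans (*-congʳ (f≈0 0)) (zeroˡ _))
    ⋆-zeroˡ f g f≈0 (suc n) =
      trans (+-cong (trans (*-congʳ (f≈0 0)) (zeroˡ _)) (⋆-zeroˡ (tail f) g (f≈0 ∘ suc) n))
            (+-identityʳ _)

    const-⋆ : ∀ a g n → (coeff (const a) ⋆ g) n ≈ a * g n
    const-⋆ a g zero    = +-identityʳ _
    const-⋆ a g (suc n) =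
      trans (+-congˡ (⋆-zeroˡ (tail (coeff (const a))) g (λ _ → refl) n)) (+-identityʳ _)

    ⋆-distribʳ : ∀ h f g n → ((λ k → f k + g k) ⋆ h) n ≈ (f ⋆ h) n + (g ⋆ h) n
    ⋆-distribʳ h f g n =
      trans (sum-cong-≋ {suc n} λ k → distribʳ (h (n ∸ toℕ k)) (f (toℕ k)) (g (toℕ k)))
            (∑-distrib-+ {suc n} (λ k → f (toℕ k) * h (n ∸ toℕ k)) (λ k → g (toℕ k) * h (n ∸ toℕ k)))

    ⋆-scaleˡ : ∀ a f g n → ((λ k → a * f k) ⋆ g) n ≈ a * (f ⋆ g) n
    ⋆-scaleˡ a f g n =
      trans (sum-cong-≋ {suc n} λ k → *-assoc a (f (toℕ k)) (g (n ∸ toℕ k)))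
            (sym (*-distribˡ-sum {suc n} a (λ k → f (toℕ k) * g (n ∸ toℕ k))))

    ⋆-sucʳ : ∀ f g n → (f ⋆ g) (suc n) ≈ (f ⋆ tail g) n + f (suc n) * g 0
    ⋆-sucʳ f g zero =
      solve 5 (λ a b c d z → a :* b :+ (c :* d :+ z) := a :* b :+ z :+ c :* d)
        refl (f 0) (g 1) (f 1) (g 0) 0#
    ⋆-sucʳ f g (suc n) = begin
      f 0 * g (suc (suc n)) + (tail f ⋆ g) (suc n)
        ≈⟨ +-congˡ (⋆-sucʳ (tail f) g n) ⟩
      f 0 * g (suc (suc n)) + ((tail f ⋆ tail g) n + f (suc (suc n)) * g 0)
        ≈⟨ +-assoc _ _ _ ⟨
      (f ⋆ tail g) (suc n) + f (suc (suc n)) * g 0 ∎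

    ⋆-comm : ∀ f g n → (f ⋆ g) n ≈ (g ⋆ f) n
    ⋆-comm f g zero    = +-congʳ (*-comm _ _)
    ⋆-comm f g (suc n) = begin
      f 0 * g (suc n) + (tail f ⋆ g) n   ≈⟨ +-cong (*-comm _ _) (⋆-comm (tail f) g n) ⟩
      g (suc n) * f 0 + (g ⋆ tail f) n   ≈⟨ +-comm _ _ ⟩
      (g ⋆ tail f) n + g (suc n) * f 0   ≈⟨ ⋆-sucʳ g f n ⟨
      (g ⋆ f) (suc n)                    ∎

    ⋆-assoc : ∀ f g h n → ((f ⋆ g) ⋆ h) n ≈ (f ⋆ (g ⋆ h)) n
    ⋆-assoc f g h zero =
      trans (+-congʳ (trans (*-congʳ (+-identityʳ _)) (*-assoc _ _ _)))
            (+-congʳ (*-congˡ (sym (+-identityʳ _))))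
    ⋆-assoc f g h (suc n) = begin
      (f ⋆ g) 0 * h (suc n) + (tail (f ⋆ g) ⋆ h) n
        ≈⟨ +-cong (*-congʳ (+-identityʳ _)) (⋆-distribʳ h (λ k → f 0 * tail g k) (tail f ⋆ g) n) ⟩
      f 0 * g 0 * h (suc n) + (((λ k → f 0 * tail g k) ⋆ h) n + ((tail f ⋆ g) ⋆ h) n)
        ≈⟨ +-congˡ (+-cong (⋆-scaleˡ (f 0) (tail g) h n) (⋆-assoc (tail f) g h n)) ⟩
      f 0 * g 0 * h (suc n) + (f 0 * (tail g ⋆ h) n + (tail f ⋆ (g ⋆ h)) n)
        ≈⟨ solve 5 (λ a b c d e → a :* b :* c :+ (a :* d :+ e) := a :* (b :* c :+ d) :+ e)
             refl (f 0) (g 0) (h (suc n)) ((tail g ⋆ h) n) ((tail f ⋆ (g ⋆ h)) n) ⟩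
      (f ⋆ (g ⋆ h)) (suc n) ∎

    ⋆-identityˡ : ∀ f n → (coeff (const 1#) ⋆ f) n ≈ f n
    ⋆-identityˡ f n = trans (const-⋆ 1# f n) (*-identityˡ _)

    ⋆-distribˡ : ∀ f g h n → (f ⋆ (λ k → g k + h k)) n ≈ (f ⋆ g) n + (f ⋆ h) n
    ⋆-distribˡ f g h n = begin
      (f ⋆ (λ k → g k + h k)) n  ≈⟨ ⋆-comm f (λ k → g k + h k) n ⟩
      ((λ k → g k + h k) ⋆ f) n  ≈⟨ ⋆-distribʳ f g h n ⟩
      (g ⋆ f) n + (h ⋆ f) n      ≈⟨ +-cong (⋆-comm g f n) (⋆-comm h f n) ⟩
      (f ⋆ g) n + (f ⋆ h) n      ∎

  commutativeRing : CommutativeRing c ℓ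
  commutativeRing = record
    { Carrier = Series
    ; _≈_     = _≋_
    ; _+_     = _⊕_
    ; _*_     = _⊛_
    ; -_      = ⊖_
    ; 0#      = 𝟘
    ; 1#      = const 1#
    ; isCommutativeRing = record
      { isRing = record
        { +-isAbelianGroup = record
          { isGroup = record
            { isMonoid = record
              { isSemigroup = record
                { isMagma = record
                  { isEquivalence = record
                    { refl  = pointwise λ _ → refl
                    ; sym   = λ p → pointwise λ n → sym (at p n)
                    ; trans = λ p r → pointwise λ n → trans (at p n) (at r n)
                    }
                  ; ∙-cong = λ p r → pointwise λ n → +-cong (at p n) (at r n)
                  }
                ; assoc = λ f g h → pointwise λ n → +-assoc _ _ _
                }
              ; identity = (λ f → pointwise λ n → +-identityˡ _)
                         , (λ f → pointwise λ n → +-identityʳ _)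
              }
            ; inverse = (λ f → pointwise λ n → -‿inverseˡ _)
                      , (λ f → pointwise λ n → -‿inverseʳ _)
            ; ⁻¹-cong = λ p → pointwise λ n → -‿cong (at p n)
            }
          ; comm = λ f g → pointwise λ n → +-comm _ _
          }
        ; *-cong     = λ p r → pointwise (⋆-cong (at p) (at r))
        ; *-assoc    = λ f g h → pointwise (⋆-assoc (coeff f) (coeff g) (coeff h))
        ; *-identity = (λ f → pointwise (⋆-identityˡ (coeff f)))
                     , (λ f → pointwise λ n →
                         trans (⋆-comm (coeff f) (coeff (const 1#)) n) (⋆-identityˡ (coeff f) n))
        ; distrib    = (λ f g h → pointwise (⋆-distribˡ (coeff f) (coeff g) (coeff h)))
                     , (λ f g h → pointwise (⋆-distribʳ (coeff f) (coeff g) (coeff h)))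
        }
      ; *-comm = λ f g → pointwise (⋆-comm (coeff f) (coeff g))
      }
    }

  -- Σ_{n ≥ 1} aₙ Xⁿ
  ∑≥1 : (ℕ → Carrier) → Series
  coeff (∑≥1 a) zero    = 0#
  coeff (∑≥1 a) (suc n) = a (suc n)

  private
    module S where
      private module A = CommutativeRing commutativeRing
      open A public
      open Sum A.semiring using (sum) public
      open Exp A.semiring using (_^_) public

  -- If c is an inverse of the constant term of f, then the constant term of
  -- h = 1 - c f vanishes and 1 / f = c (1 + h + h² + ⋯); the terms hᵏ with
  -- k > n do not contribute to the coefficient of Xⁿ.
  recip : Carrier → Series → Series
  coeff (recip c f) n = c * (∑[ k ≤ n ] coeff (h S.^ toℕ k) n)
    where
    h : Series
    h = S.1# S.- const c S.* f

  private
    module Recip (c : Carrier) (f : Series) (c*f₀≈1 : c * coeff f 0 ≈ 1#) where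
      h : Series
      h = S.1# S.- const c S.* f

      h₀*a≈0 : ∀ {a} → coeff h 0 * a ≈ 0#
      h₀*a≈0 = trans
        (*-congʳ (trans (+-congˡ (-‿cong (trans (+-identityʳ _) c*f₀≈1))) (-‿inverseʳ 1#)))
        (zeroˡ _)

      geom : ℕ → Series
      geom zero    = S.1#
      geom (suc N) = S.1# S.+ h S.* geom N

      h*-cong : ∀ g g′ n → (∀ m → m ℕ.< n → g m ≈ g′ m) → (coeff h ⋆ g) n ≈ (coeff h ⋆ g′) n
      h*-cong g g′ zero    eq = +-congʳ (trans h₀*a≈0 (sym h₀*a≈0))
      h*-cong g g′ (suc n) eq =
        +-cong (trans h₀*a≈0 (sym h₀*a≈0))
               (sum-cong-≋ {suc n} λ k → *-congˡ {coeff h (suc (toℕ k))} (eq (n ∸ toℕ k) (s≤s (ℕ.m∸n≤m n (toℕ k)))))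

      1+h*g : ∀ g → coeff (S.1# S.+ h S.* g) 0 ≈ 1#
      1+h*g g = trans (+-congˡ (trans (+-identityʳ _) h₀*a≈0)) (+-identityʳ _)

      geom-stable : ∀ N M n → n ℕ.≤ N → n ℕ.≤ M → coeff (geom N) n ≈ coeff (geom M) n
      geom-stable zero    zero    n    p r = refl
      geom-stable zero    (suc M) zero p r = sym (1+h*g (geom M))
      geom-stable (suc N) zero    zero p r = 1+h*g (geom N)
      geom-stable (suc N) (suc M) n    p r =
        +-congˡ (h*-cong (coeff (geom N)) (coeff (geom M)) n λ m m<n →
          geom-stable N M m (ℕ.≤-pred (ℕ.≤-trans m<n p)) (ℕ.≤-pred (ℕ.≤-trans m<n r)))

      sum-S : ∀ {N} (F : Fin N → Series) n → coeff (S.sum F) n ≈ sum (λ k → coeff (F k) n)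
      sum-S {zero}  F n = refl
      sum-S {suc N} F n = +-congˡ (sum-S (F ∘ suc) n)

      sum-geom : ∀ N → S.sum {suc N} (λ k → h S.^ toℕ k) S.≈ geom N
      sum-geom zero    = S.+-identityʳ S.1#
      sum-geom (suc N) = S.+-congˡ (S.trans
        (S.sym (Sum.*-distribˡ-sum S.semiring {suc N} h (λ k → h S.^ toℕ k)))
        (S.*-congˡ (sum-geom N)))

      g : Series
      coeff g n = coeff (geom n) n

      recip-geom : recip c f S.≈ const c S.* g
      at recip-geom n = trans
        (*-congˡ (trans (sym (sum-S {suc n} (λ k → h S.^ toℕ k) n)) (at (sum-geom n) n)))
        (sym (const-⋆ c (coeff g) n))

      geom-fix : g S.≈ S.1# S.+ h S.* g
      at geom-fix zero    = sym (1+h*g g)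
      at geom-fix (suc n) = +-congˡ (h*-cong (coeff (geom n)) (coeff g) (suc n) λ m m<n →
        geom-stable n m m (ℕ.≤-pred m<n) ℕ.≤-refl)

      cf : Series
      cf = const c S.* f

      cf*g : cf S.* g S.≈ S.1#
      cf*g = GroupProperties.∙-cancelʳ S.+-group (h S.* g) _ _
        (S.trans (S.sym (S.distribʳ g cf h))
        (S.trans (S.*-congʳ cf+h) (S.trans (S.*-identityˡ g) geom-fix)))
        where
        cf+h : cf S.+ h S.≈ S.1#
        cf+h = S.trans (S.+-comm cf h) (S.trans (S.+-assoc S.1# (S.- cf) cf)
          (S.trans (S.+-congˡ (S.-‿inverseˡ cf)) (S.+-identityʳ S.1#)))

  recip-inverse : ∀ c f → c * coeff f 0 ≈ 1# → f ⊛ recip c f ≋ const 1#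
  recip-inverse c f p = S.trans (S.*-congˡ recip-geom)
    (S.trans (S.sym (S.*-assoc f (const c) g)) (S.trans (S.*-congʳ (S.*-comm f (const c))) cf*g))
    where open Recip c f p

  convolution-vanishes : ∀ {f} N M g → (∀ n → N ℕ.≤ n → f n ≈ 0#) → (∀ n → M ℕ.≤ n → g n ≈ 0#) →
                         ∀ n → N ℕ.+ M ℕ.≤ n → convolution f g n ≈ 0#
  convolution-vanishes {f} zero    M g p r n       _           = ⋆-zeroˡ f g (λ k → p k z≤n) n
  convolution-vanishes {f} (suc N) M g p r (suc n) (s≤s N+M≤n) =
    trans (+-cong (trans (*-congˡ (r (suc n) (ℕ.≤-trans (ℕ.m≤n+m M N) (ℕ.m≤n⇒m≤1+n N+M≤n)))) (zeroʳ _))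
                  (convolution-vanishes {tail f} N M g (λ k N≤k → p (suc k) (s≤s N≤k)) r n N+M≤n))
          (+-identityʳ _)

  convolution-leading : ∀ {f} d e g → (∀ n → d ℕ.< n → f n ≈ 0#) → (∀ n → e ℕ.< n → g n ≈ 0#) →
                        convolution f g (d ℕ.+ e) ≈ f d * g e
  convolution-leading     zero    zero    g p r = +-identityʳ _
  convolution-leading {f} zero    (suc e) g p r =
    trans (+-congˡ (⋆-zeroˡ (tail f) g (λ k → p (suc k) (s≤s z≤n)) e)) (+-identityʳ _)
  convolution-leading {f} (suc d) e g p r =
    trans (+-cong (trans (*-congˡ (r (suc (d ℕ.+ e)) (s≤s (ℕ.m≤n+m e d)))) (zeroʳ _))
                  (convolution-leading {tail f} d e g (λ k d<k → p (suc k) (s≤s d<k)) r))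
          (+-identityˡ _)

------------------------------------------------------------------------
-- Polynomials

-- A polynomial is a power series with only finitely many nonzero coefficients.
-- The bound is not part of the identity of a polynomial: equality compares
-- coefficients only.
module Polynomials (R : CommutativeRing c ℓ) where

  open CommutativeRing R
  open RingProperties ring using (-0#≈0#)
  private
    module S where
      open PowerSeries R public
      open CommutativeRing (PowerSeries.commutativeRing R) public

  record Polynomial : Set (c ⊔ ℓ) where
    no-eta-equality
    constructor polynomial
    field
      toSeries : S.Series
      bound    : ℕ
      vanishes : ∀ n → bound ℕ.≤ n → S.coeff toSeries n ≈ 0#
  open Polynomial public

  coeff : Polynomial → ℕ → Carrier
  coeff f = S.coeff (toSeries f)

  infix 4 _≋_
  record _≋_ (f g : Polynomial) : Set ℓ where
    constructor pointwise
    field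
      toSeries-≈ : toSeries f S.≈ toSeries g
  open _≋_ public

  const : Carrier → Polynomial
  toSeries (const a) = S.const a
  bound    (const a) = 1
  vanishes (const a) (suc n) _ = refl

  X : Polynomial
  toSeries X = S.X
  bound    X = 2
  vanishes X (suc (suc n)) _ = refl
  vanishes X (suc zero) (s≤s ())

  infixl 6 _⊕_
  infixl 7 _⊛_

  𝟘 : Polynomial
  toSeries 𝟘 = S.0#
  bound    𝟘 = 0
  vanishes 𝟘 _ _ = refl

  _⊕_ : Polynomial → Polynomial → Polynomial
  toSeries (f ⊕ g) = toSeries f S.+ toSeries g
  bound    (f ⊕ g) = bound f ℕ.+ bound g
  vanishes (f ⊕ g) n b+b≤n =
    trans (+-cong (vanishes f n (ℕ.m+n≤o⇒m≤o (bound f) b+b≤n))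
                  (vanishes g n (ℕ.m+n≤o⇒n≤o (bound f) b+b≤n)))
          (+-identityʳ _)

  _⊛_ : Polynomial → Polynomial → Polynomial
  toSeries (f ⊛ g) = toSeries f S.* toSeries g
  bound    (f ⊛ g) = bound f ℕ.+ bound g
  vanishes (f ⊛ g) =
    S.convolution-vanishes (bound f) (bound g) (coeff g) (vanishes f) (vanishes g)

  ⊖_ : Polynomial → Polynomial
  toSeries (⊖ f) = S.- toSeries f
  bound    (⊖ f) = bound f
  vanishes (⊖ f) n b≤n = trans (-‿cong (vanishes f n b≤n)) -0#≈0#

  commutativeRing : CommutativeRing (c ⊔ ℓ) ℓ
  commutativeRing = record
    { Carrier = Polynomial
    ; _≈_     = _≋_
    ; _+_     = _⊕_
    ; _*_     = _⊛_
    ; -_      = ⊖_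
    ; 0#      = 𝟘
    ; 1#      = const 1#
    ; isCommutativeRing = record
      { isRing = record
        { +-isAbelianGroup = record
          { isGroup = record
            { isMonoid = record
              { isSemigroup = record
                { isMagma = record
                  { isEquivalence = record
                    { refl  = pointwise S.refl
                    ; sym   = λ p → pointwise (S.sym (toSeries-≈ p))
                    ; trans = λ p r → pointwise (S.trans (toSeries-≈ p) (toSeries-≈ r))
                    }
                  ; ∙-cong = λ p r → pointwise (S.+-cong (toSeries-≈ p) (toSeries-≈ r))
                  }
                ; assoc = λ f g h → pointwise (S.+-assoc _ _ _)
                }
              ; identity = (λ f → pointwise (S.+-identityˡ _)) , (λ f → pointwise (S.+-identityʳ _))
              }
            ; inverse = (λ f → pointwise (S.-‿inverseˡ _)) , (λ f → pointwise (S.-‿inverseʳ _))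
            ; ⁻¹-cong = λ p → pointwise (S.-‿cong (toSeries-≈ p))
            }
          ; comm = λ f g → pointwise (S.+-comm _ _)
          }
        ; *-cong     = λ p r → pointwise (S.*-cong (toSeries-≈ p) (toSeries-≈ r))
        ; *-assoc    = λ f g h → pointwise (S.*-assoc _ _ _)
        ; *-identity = (λ f → pointwise (S.*-identityˡ _)) , (λ f → pointwise (S.*-identityʳ _))
        ; distrib    = (λ f g h → pointwise (S.distribˡ _ _ _)) , (λ f g h → pointwise (S.distribʳ _ _ _))
        }
      ; *-comm = λ f g → pointwise (S.*-comm _ _)
      }
    }

-- Coefficientwise application of a map h.
module MapCoefficients (R : CommutativeRing c ℓ) (S : CommutativeRing c′ ℓ′)
  (h : CommutativeRing.Carrier R → CommutativeRing.Carrier S) where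

  private
    module R = CommutativeRing R
    module S = CommutativeRing S
  open PowerSeries using (coeff)
  open Polynomials using (toSeries; bound; vanishes)

  mapSeries : PowerSeries.Series R → PowerSeries.Series S
  coeff (mapSeries f) n = h (coeff f n)

  mapPolynomial : (∀ {a} → a R.≈ R.0# → h a S.≈ S.0#) →
                  Polynomials.Polynomial R → Polynomials.Polynomial S
  toSeries (mapPolynomial h-0 f)       = mapSeries (toSeries f)
  bound    (mapPolynomial h-0 f)       = bound f
  vanishes (mapPolynomial h-0 f) n b≤n = h-0 (vanishes f n b≤n)

------------------------------------------------------------------------
-- Integral domains with decidable equality

record DiscreteDomain c ℓ : Set (lsuc (c ⊔ ℓ)) where
  field
    commutativeRing : CommutativeRing c ℓ
  open CommutativeRing commutativeRing public
  field
    _≟0      : ∀ x → Dec (x ≈ 0#)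
    1≉0      : ¬ 1# ≈ 0#
    integral : ∀ {x y} → ¬ x ≈ 0# → ¬ y ≈ 0# → ¬ x * y ≈ 0#

polynomialDomain : DiscreteDomain c ℓ → DiscreteDomain (c ⊔ ℓ) ℓ
polynomialDomain D = record
  { commutativeRing = Polynomials.commutativeRing commutativeRing
  ; _≟0      = λ f → decide (search (bound f) (coeff f) (vanishes f))
  ; 1≉0      = λ p → 1≉0 (at (toSeries-≈ p) 0)
  ; integral = int
  }
  where
  open DiscreteDomain D
  open PowerSeries commutativeRing using (convolution; convolution-leading; pointwise; at)
  open Polynomials commutativeRing
    using (Polynomial; coeff; bound; vanishes; toSeries-≈; pointwise; _≋_; 𝟘; _⊛_)

  Leading : (ℕ → Carrier) → Set _
  Leading f = ∃[ d ] ¬ f d ≈ 0# × (∀ n → d ℕ.< n → f n ≈ 0#)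

  search : ∀ b f → (∀ n → b ℕ.≤ n → f n ≈ 0#) → (∀ n → f n ≈ 0#) ⊎ Leading f
  search zero    f v = inj₁ λ n → v n z≤n
  search (suc b) f v with f b ≟0
  ... | no fb≉0  = inj₂ (b , fb≉0 , v)
  ... | yes fb≈0 = search b f v′
    where
    v′ : ∀ n → b ℕ.≤ n → f n ≈ 0#
    v′ n b≤n with ℕ.m≤n⇒m<n∨m≡n b≤n
    ... | inj₁ b<n    = v n b<n
    ... | inj₂ ≡.refl = fb≈0

  decide : ∀ {f} → (∀ n → coeff f n ≈ 0#) ⊎ Leading (coeff f) → Dec (f ≋ 𝟘)
  decide (inj₁ f≈0)            = yes (pointwise (pointwise f≈0))
  decide (inj₂ (d , fd≉0 , _)) = no λ f≈0 → fd≉0 (at (toSeries-≈ f≈0) d)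

  int : ∀ {f g} → ¬ f ≋ 𝟘 → ¬ g ≋ 𝟘 → ¬ f ⊛ g ≋ 𝟘
  int {f} {g} f≉0 g≉0 fg≈0
    with search (bound f) (coeff f) (vanishes f) | search (bound g) (coeff g) (vanishes g)
  ... | inj₁ f≈0 | _        = f≉0 (pointwise (pointwise f≈0))
  ... | inj₂ _   | inj₁ g≈0 = g≉0 (pointwise (pointwise g≈0))
  ... | inj₂ (d , fd≉0 , hd) | inj₂ (e , ge≉0 , he) =
    integral fd≉0 ge≉0
      (trans (sym (convolution-leading {coeff f} d e (coeff g) hd he))
             (at (toSeries-≈ fg≈0) (d ℕ.+ e)))

------------------------------------------------------------------------
-- Fields of fractions

module Fractions (D : DiscreteDomain c ℓ) where

  open DiscreteDomain D
  open RingProperties ring using (-‿distribˡ-*; x≈y⇒x∙y⁻¹≈ε; x∙y⁻¹≈ε⇒x≈y)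
  open SemiringSolver commutativeSemiring using (solve; _:+_; _:*_; _:=_)
  open import Relation.Binary.Reasoning.Setoid setoid

  record Fraction : Set (c ⊔ ℓ) where
    no-eta-equality
    constructor fraction
    field
      num   : Carrier
      den   : Carrier
      den≉0 : ¬ den ≈ 0#
  open Fraction public

  infix 4 _≃_
  record _≃_ (x y : Fraction) : Set ℓ where
    constructor cross
    field
      uncross : num x * den y ≈ num y * den x
  open _≃_ public

  embed : Carrier → Fraction
  num   (embed a) = a
  den   (embed a) = 1#
  den≉0 (embed a) = 1≉0

  infixl 6 _⊹_
  infixl 7 _⊠_

  _⊹_ : Fraction → Fraction → Fraction
  num   (x ⊹ y) = num x * den y + num y * den x
  den   (x ⊹ y) = den x * den y
  den≉0 (x ⊹ y) = integral (den≉0 x) (den≉0 y)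

  _⊠_ : Fraction → Fraction → Fraction
  num   (x ⊠ y) = num x * num y
  den   (x ⊠ y) = den x * den y
  den≉0 (x ⊠ y) = integral (den≉0 x) (den≉0 y)

  ⊟_ : Fraction → Fraction
  num   (⊟ x) = - num x
  den   (⊟ x) = den x
  den≉0 (⊟ x) = den≉0 x

  private
    cancel : ∀ {x y} z → ¬ z ≈ 0# → x * z ≈ y * z → x ≈ y
    cancel {x} {y} z z≉0 xz≈yz with (x - y) ≟0
    ... | yes p = x∙y⁻¹≈ε⇒x≈y x y p
    ... | no  p = contradiction
      (trans (distribʳ z x (- y))
        (trans (+-congˡ (sym (-‿distribˡ-* y z))) (x≈y⇒x∙y⁻¹≈ε xz≈yz)))
      (integral p z≉0)

    ≃-trans : ∀ {x y z} → x ≃ y → y ≃ z → x ≃ z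
    ≃-trans {x} {y} {z} (cross p) (cross r) = cross (cancel (den y) (den≉0 y) (begin
      num x * den z * den y   ≈⟨ swap (num x) (den z) (den y) ⟩
      num x * den y * den z   ≈⟨ *-congʳ p ⟩
      num y * den x * den z   ≈⟨ swap (num y) (den x) (den z) ⟩
      num y * den z * den x   ≈⟨ *-congʳ r ⟩
      num z * den y * den x   ≈⟨ swap (num z) (den y) (den x) ⟩
      num z * den x * den y   ∎))
      where
      swap : ∀ a b c → a * b * c ≈ a * c * b
      swap = solve 3 (λ a b c → a :* b :* c := a :* c :* b) refl

    ⊹-cong : ∀ {x y u v} → x ≃ y → u ≃ v → x ⊹ u ≃ y ⊹ v
    ⊹-cong {x} {y} {u} {v} (cross p) (cross r) = cross (begin
      (num x * den u + num u * den x) * (den y * den v)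
        ≈⟨ solve 6 (λ a b c d e f → (a :* d :+ c :* b) :* (e :* f) :=
             a :* e :* (d :* f) :+ c :* f :* (b :* e))
             refl (num x) (den x) (num u) (den u) (den y) (den v) ⟩
      num x * den y * (den u * den v) + num u * den v * (den x * den y)
        ≈⟨ +-cong (*-congʳ p) (*-congʳ r) ⟩
      num y * den x * (den u * den v) + num v * den u * (den x * den y)
        ≈⟨ solve 6 (λ a b c d e f → a :* b :* (d :* f) :+ c :* d :* (b :* e) :=
             (a :* f :+ c :* e) :* (b :* d))
             refl (num y) (den x) (num v) (den u) (den y) (den v) ⟩
      (num y * den v + num v * den y) * (den x * den u) ∎)

    ⊠-cong : ∀ {x y u v} → x ≃ y → u ≃ v → x ⊠ u ≃ y ⊠ v
    ⊠-cong (cross p) (cross r) =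
      cross (trans (interchange _ _ _ _) (trans (*-cong p r) (interchange _ _ _ _)))
      where
      interchange : ∀ a b c d → a * b * (c * d) ≈ a * c * (b * d)
      interchange = solve 4 (λ a b c d → a :* b :* (c :* d) := a :* c :* (b :* d)) refl

    ⊹-comm : ∀ x y → x ⊹ y ≃ y ⊹ x
    ⊹-comm x y = cross (*-cong (+-comm _ _) (*-comm _ _))

    ⊠-comm : ∀ x y → x ⊠ y ≃ y ⊠ x
    ⊠-comm x y = cross (*-cong (*-comm _ _) (*-comm _ _))

    ⊹-identityˡ : ∀ x → embed 0# ⊹ x ≃ x
    ⊹-identityˡ x = cross (trans
      (*-congʳ (trans (+-cong (zeroˡ _) (*-identityʳ _)) (+-identityˡ _)))
      (*-congˡ (sym (*-identityˡ _))))

    ⊠-identityˡ : ∀ x → embed 1# ⊠ x ≃ x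
    ⊠-identityˡ x = cross (trans (*-congʳ (*-identityˡ _)) (*-congˡ (sym (*-identityˡ _))))

    ⊟-inverseˡ : ∀ x → (⊟ x) ⊹ x ≃ embed 0#
    ⊟-inverseˡ x = cross (trans (*-identityʳ _) (trans (sym (distribʳ _ _ _))
      (trans (*-congʳ (-‿inverseˡ _)) (trans (zeroˡ _) (sym (zeroˡ _))))))

    distˡ : ∀ x y z → x ⊠ (y ⊹ z) ≃ (x ⊠ y) ⊹ (x ⊠ z)
    distˡ x y z = cross (solve 6 (λ a b c d e f →
      (a :* (c :* f :+ e :* d)) :* ((b :* d) :* (b :* f)) :=
      (a :* c :* (b :* f) :+ a :* e :* (b :* d)) :* (b :* (d :* f)))
      refl (num x) (den x) (num y) (den y) (num z) (den z))

  fractionRing : CommutativeRing (c ⊔ ℓ) ℓ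
  fractionRing = record
    { Carrier = Fraction
    ; _≈_     = _≃_
    ; _+_     = _⊹_
    ; _*_     = _⊠_
    ; -_      = ⊟_
    ; 0#      = embed 0#
    ; 1#      = embed 1#
    ; isCommutativeRing = record
      { isRing = record
        { +-isAbelianGroup = record
          { isGroup = record
            { isMonoid = record
              { isSemigroup = record
                { isMagma = record
                  { isEquivalence = record
                    { refl  = cross refl
                    ; sym   = λ p → cross (sym (uncross p))
                    ; trans = ≃-trans
                    }
                  ; ∙-cong = ⊹-cong
                  }
                ; assoc = λ x y z → cross (solve 6 (λ a b c d e f →
                    ((a :* d :+ c :* b) :* f :+ e :* (b :* d)) :* (b :* (d :* f)) :=
                    (a :* (d :* f) :+ (c :* f :+ e :* d) :* b) :* (b :* d :* f))
                    refl (num x) (den x) (num y) (den y) (num z) (den z))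
                }
              ; identity = ⊹-identityˡ , λ x → ≃-trans (⊹-comm x (embed 0#)) (⊹-identityˡ x)
              }
            ; inverse = ⊟-inverseˡ , λ x → ≃-trans (⊹-comm x (⊟ x)) (⊟-inverseˡ x)
            ; ⁻¹-cong = λ p → cross (trans (sym (-‿distribˡ-* _ _))
                                    (trans (-‿cong (uncross p)) (-‿distribˡ-* _ _)))
            }
          ; comm = ⊹-comm
          }
        ; *-cong     = ⊠-cong
        ; *-assoc    = λ x y z → cross (solve 6 (λ a b c d e f →
            (a :* c :* e) :* (b :* (d :* f)) := (a :* (c :* e)) :* (b :* d :* f))
            refl (num x) (den x) (num y) (den y) (num z) (den z))
        ; *-identity = ⊠-identityˡ , λ x → ≃-trans (⊠-comm x (embed 1#)) (⊠-identityˡ x)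
        ; distrib    = distˡ , λ x y z → ≃-trans (⊠-comm (y ⊹ z) x)
                         (≃-trans (distˡ x y z) (⊹-cong (⊠-comm x y) (⊠-comm x z)))
        }
      ; *-comm = ⊠-comm
      }
    }

  private
    invert : ∀ x → Dec (num x ≈ 0#) → Fraction
    invert x (yes _)  = embed 0#
    invert x (no n≉0) = fraction (den x) (num x) n≉0

  -- Inversion is totalised by 0 ⁻¹ = 0.
  infix 8 _⁻¹
  _⁻¹ : Fraction → Fraction
  num   (x ⁻¹) = num   (invert x (num x ≟0))
  den   (x ⁻¹) = den   (invert x (num x ≟0))
  den≉0 (x ⁻¹) = den≉0 (invert x (num x ≟0))

  infixl 7 _/_
  _/_ : Fraction → Fraction → Fraction
  x / y = x ⊠ y ⁻¹

  ⁻¹-inverse : ∀ x → ¬ x ≃ embed 0# → x ⊠ x ⁻¹ ≃ embed 1#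
  ⁻¹-inverse x x≄0 = cross (lemma (num x ≟0))
    where
    lemma : (d : Dec (num x ≈ 0#)) →
            num x * num (invert x d) * 1# ≈ 1# * (den x * den (invert x d))
    lemma (yes n≈0) = contradiction
      (cross (trans (*-congʳ n≈0) (trans (zeroˡ _) (sym (zeroˡ _))))) x≄0
    lemma (no _)    = trans (*-identityʳ _) (trans (*-comm _ _) (sym (*-identityˡ _)))

------------------------------------------------------------------------
-- Permutations and their statistics

-- All permutations of Fin n; a nonempty one is determined by its first letter
-- j and by the relative order of the remaining letters.
permutations : ∀ n → List (Permutation′ n)
permutations zero    = Perm.id ∷ []
permutations (suc n) =
  concatMap (λ j → map (Perm.insert zero j) (permutations n)) (allFin (suc n))

permutations-complete : ∀ n (π : Permutation′ n) → Any (Perm._≈ π) (permutations n)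
permutations-complete zero    π = here λ ()
permutations-complete (suc n) π =
  Any.concatMap⁺ (λ j → map (Perm.insert zero j) (permutations n))
    (Any.tabulate⁺ {f = λ j → j} (π ⟨$⟩ʳ zero)
      (Any.map⁺ (Any.map extend (permutations-complete n (Perm.remove zero π)))))
  where
  extend : ∀ {ρ} → ρ Perm.≈ Perm.remove zero π → Perm.insert zero (π ⟨$⟩ʳ zero) ρ Perm.≈ π
  extend p zero    = ≡.refl
  extend p (suc k) = ≡.trans (≡.cong (punchIn (π ⟨$⟩ʳ zero)) (p k))
                             (Perm.insert-remove zero π (suc k))

permutations-distinct : ∀ n → AllPairs (λ π ρ → ¬ π Perm.≈ ρ) (permutations n)
permutations-distinct zero    = [] ∷ []
permutations-distinct (suc n) = AllPairs.concat⁺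
  (All.map⁺ (All.tabulate⁺ {f = λ j → j} λ j →
    AllPairs.map⁺ (AllPairs.map (λ {π} {ρ} → insert-injective j π ρ) (permutations-distinct n))))
  (AllPairs.map⁺ (AllPairs.tabulate⁺ {f = λ j → j} λ {i} {j} i≢j →
    All.map⁺ (All.universal (λ π → All.map⁺ (All.universal (λ ρ p → i≢j (p zero)) _)) _)))
  where
  insert-injective : ∀ j (π ρ : Permutation′ n) → ¬ π Perm.≈ ρ →
                     ¬ Perm.insert zero j π Perm.≈ Perm.insert zero j ρ
  insert-injective j π ρ π≉ρ p = π≉ρ λ k → Fin.punchIn-injective j _ _ (p (suc k))

word : ∀ {n} → Permutation′ n → List ℕ
word π = tabulate λ i → suc (toℕ (π ⟨$⟩ʳ i))

-- Iverson bracket: the statistics count by adding brackets along the word.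
⟦_⟧ : ∀ {a} {A : Set a} → Dec A → ℕ
⟦ yes _ ⟧ = 1
⟦ no  _ ⟧ = 0

desʷ : List ℕ → ℕ
desʷ (a ∷ w@(b ∷ _)) = ⟦ b ℕ.<? a ⟧ ℕ.+ desʷ w
desʷ _               = 0

pkʷ : List ℕ → ℕ
pkʷ (a ∷ w@(b ∷ c ∷ _)) = ⟦ (a ℕ.<? b) ×-dec (c ℕ.<? b) ⟧ ℕ.+ pkʷ w
pkʷ _                   = 0

invʷ : List ℕ → ℕ
invʷ []      = 0
invʷ (a ∷ w) = ListAction.sum (map (λ b → ⟦ b ℕ.<? a ⟧) w) ℕ.+ invʷ w

des pk inv : ∀ {n} → Permutation′ n → ℕ
des = desʷ ∘ word
pk  = pkʷ ∘ word
inv = invʷ ∘ word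

------------------------------------------------------------------------
-- q-analogues

module QAnalogues (R : CommutativeRing c ℓ) (q : CommutativeRing.Carrier R) where

  open CommutativeRing R
  open Sum semiring using (sum-syntax)
  open Exp semiring using (_^_)

  [_]! : ℕ → Carrier
  [ zero  ]! = 1#
  [ suc n ]! = [ n ]! * (∑[ i < suc n ] (q ^ toℕ i))

  -- P n y t is the polynomial Pₙ^(inv,pk,des) evaluated at (q , y , t).
  P : ℕ → Carrier → Carrier → Carrier
  P n y t = foldr _+_ 0#
    (map (λ π → q ^ inv π * y ^ (pk π ℕ.+ 1) * t ^ (des π ℕ.+ 1)) (permutations n))

-- The q-exponential series need reciprocals of q-factorials, which are supplied
-- as a parameter because not every coefficient ring used below is a field.
module QExponentials (R : CommutativeRing c ℓ) (q : CommutativeRing.Carrier R)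
                     (1/[_]! : ℕ → CommutativeRing.Carrier R) where

  open CommutativeRing R
  open Exp semiring using (_^_)
  open PowerSeries R using (Series; coeff)

  -- exp-q a and Exp-q a are the series exp_q(ax) and Exp_q(ax) in x.
  exp-q Exp-q : Carrier → Series
  coeff (exp-q a) n = a ^ n * 1/[ n ]!
  coeff (Exp-q a) n = q ^ (n C 2) * (a ^ n * 1/[ n ]!)

------------------------------------------------------------------------
-- The coefficient rings

ℚ-domain : DiscreteDomain 0ℓ 0ℓ
ℚ-domain = record
  { commutativeRing = ℚ.+-*-commutativeRing
  ; _≟0      = λ p → p ℚ.≟ ℚ.0ℚ
  ; 1≉0      = λ ()
  ; integral = λ {p} {r} → int p r
  }
  where
  open ≡.≡-Reasoning
  int : ∀ p r → p ≢ ℚ.0ℚ → r ≢ ℚ.0ℚ → p ℚ.* r ≢ ℚ.0ℚ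
  int p r p≢0 r≢0 pr≡0 = r≢0 (begin
    r                       ≡⟨ ℚ.*-identityˡ r ⟨
    ℚ.1ℚ ℚ.* r              ≡⟨ ≡.cong (ℚ._* r) (ℚ.*-inverseˡ p) ⟨
    ℚ.1/ p ℚ.* p ℚ.* r      ≡⟨ ℚ.*-assoc (ℚ.1/ p) p r ⟩
    ℚ.1/ p ℚ.* (p ℚ.* r)    ≡⟨ ≡.cong (ℚ.1/ p ℚ.*_) pr≡0 ⟩
    ℚ.1/ p ℚ.* ℚ.0ℚ         ≡⟨ ℚ.*-zeroʳ (ℚ.1/ p) ⟩
    ℚ.0ℚ                    ∎)
    where instance _ = ℚ.≢-nonZero p≢0

ringOf : DiscreteDomain c ℓ → CommutativeRing c ℓ
ringOf = DiscreteDomain.commutativeRing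

ℚ[q] ℚ[q,y] ℚ[q,y,t] : DiscreteDomain 0ℓ 0ℓ
ℚ[q]     = polynomialDomain ℚ-domain
ℚ[q,y]   = polynomialDomain ℚ[q]
ℚ[q,y,t] = polynomialDomain ℚ[q,y]

-- Power series in x over ℚ(q,y,t).  Operations with subscript x act on series,
-- the others on coefficients.
module OverRationalFunctions where

  private
    module Pq = Polynomials (ringOf ℚ-domain)
    module Py = Polynomials (ringOf ℚ[q])
    module Pt = Polynomials (ringOf ℚ[q,y])

  open Fractions ℚ[q,y,t] using (_/_; _⁻¹; embed; fractionRing) public
  open CommutativeRing fractionRing public
  open Exp semiring using (_^_) public

  q y t : Carrier
  q = embed (Pt.const (Py.const Pq.X))
  y = embed (Pt.const Py.X)
  t = embed Pt.X

  open QAnalogues fractionRing q public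

  1/[_]! : ℕ → Carrier
  1/[ n ]! = [ n ]! ⁻¹

  open QExponentials fractionRing q 1/[_]! public
  open PowerSeries fractionRing public
    using (Series; coeff; ∑≥1; recip; const)
    renaming (commutativeRing to seriesRing)
  open CommutativeRing seriesRing public
    using ()
    renaming (_≈_ to _≈ₓ_; _+_ to _+ₓ_; _*_ to _*ₓ_; _-_ to _-ₓ_; 1# to 1ₓ)

  -- Only meaningful for g with nonzero constant term.
  infixl 7 _/ₓ_
  _/ₓ_ : Series → Series → Series
  f /ₓ g = f *ₓ recip (coeff g 0 ⁻¹) g

ℚ⟨q⟩ : CommutativeRing 0ℓ 0ℓ
ℚ⟨q⟩ = Fractions.fractionRing ℚ[q]

-- ℚ[y][[t]], the ring of u and v.
module ℚ[y]⟦t⟧ where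

  private
    module Py = Polynomials (ringOf ℚ-domain)
    module St = PowerSeries Py.commutativeRing
    module ℚ[y] = CommutativeRing Py.commutativeRing

  open CommutativeRing St.commutativeRing public
  open Exp semiring using (_^_) public

  y t 2# 4# : Carrier
  y  = St.const Py.X
  t  = St.X
  2# = 1# + 1#
  4# = 2# + 2#

  -- ℚ[y][[t]] is an integral domain, so for d ≠ 0 the fraction n / d is the only
  -- w with d w = n, if there is one.
  infix 4 _Is_÷_
  _Is_÷_ : Carrier → Carrier → Carrier → Set
  w Is n ÷ d = d * w ≈ n

  -- s is the square root of (1+t)² - 4yt with constant term 1, and u and v are
  -- given by their formulas in y, t and s.
  AreRootAndUV : Carrier → Carrier → Carrier → Set
  AreRootAndUV s u v =
    St.coeff s 0 ℚ[y].≈ ℚ[y].1#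
    × s ^ 2 ≈ (1# + t) ^ 2 - 4# * y * t
    × u Is 1# + t ^ 2 - 2# * y * t - (1# - t) * s ÷ 2# * (1# - y) * t
    × v Is (1# + t) ^ 2 - 2# * y * t - (1# + t) * s ÷ 2# * y * t

-- Power series in x over ℚ(q)[y][[t]].  Operations with subscript x act on
-- series in x, the others on coefficients.
module OverPowerSeries where

  private
    module Pq = Polynomials (ringOf ℚ-domain)
    module Fq = Fractions ℚ[q]
    module Qq = QAnalogues ℚ⟨q⟩ (Fq.embed Pq.X)
    module Py = Polynomials ℚ⟨q⟩
    module St = PowerSeries Py.commutativeRing

  coefficientRing : CommutativeRing 0ℓ 0ℓ
  coefficientRing = St.commutativeRing

  open CommutativeRing coefficientRing public

  -- These are only meaningful for g with constant term 1.
  inverse : Carrier → Carrier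
  inverse g = St.recip (CommutativeRing.1# Py.commutativeRing) g

  infixl 7 _/_
  _/_ : Carrier → Carrier → Carrier
  f / g = f * inverse g

  q y t : Carrier
  q = St.const (Py.const (Fq.embed Pq.X))
  y = St.const Py.X
  t = St.X

  -- the inclusion of ℚ[y][[t]]
  ι : ℚ[y]⟦t⟧.Carrier → Carrier
  ι = MapCoefficients.mapSeries Ry.commutativeRing Py.commutativeRing
        (MapCoefficients.mapPolynomial (ringOf ℚ-domain) ℚ⟨q⟩ (λ a → Fq.embed (Pq.const a)) embed-0)
    where
    module Ry = Polynomials (ringOf ℚ-domain)
    module Rq = DiscreteDomain ℚ[q]
    embed-0 : ∀ {a} → a ≡ ℚ.0ℚ → Fq.embed (Pq.const a) Fq.≃ Fq.embed Rq.0#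
    embed-0 ≡.refl = Fq.cross (Rq.*-congʳ (Pq.pointwise (Sq.pointwise λ
      { zero → ≡.refl ; (suc n) → ≡.refl })))
      where module Sq = PowerSeries (ringOf ℚ-domain)

  open QAnalogues coefficientRing q using (P) public

  1/[_]! : ℕ → Carrier
  1/[ n ]! = St.const (Py.const (Qq.[ n ]! Fq.⁻¹))

  open QExponentials coefficientRing q 1/[_]! public
  open PowerSeries coefficientRing public
    using (Series; coeff; ∑≥1; recip; const)
    renaming (commutativeRing to seriesRing)
  open CommutativeRing seriesRing public
    using ()
    renaming (_≈_ to _≈ₓ_; _+_ to _+ₓ_; _*_ to _*ₓ_; _-_ to _-ₓ_; 1# to 1ₓ)

  -- Only meaningful for g whose coefficient of t⁰x⁰ is 1.
  infixl 7 _/ₓ_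
  _/ₓ_ : Series → Series → Series
  f /ₓ g = f *ₓ recip (1# / coeff g 0) g

{-# OPTIONS --safe #-}
module Submission where

open import Defs
open import Algebra.Bundles using (CommutativeRing)
import Algebra.Morphism.Construct.Composition as Composition
open import Algebra.Morphism.Structures using (IsRingHomomorphism)
import Algebra.Properties.AbelianGroup as AbelianGroupProperties
import Algebra.Properties.CommutativeMonoid.Sum as CommutativeMonoidSum
import Algebra.Properties.CommutativeSemiring.Exp as CommutativeExp
import Algebra.Properties.Group as GroupProperties
import Algebra.Properties.Ring as RingProperties
import Algebra.Properties.Semiring.Exp as Exp
import Algebra.Properties.Semiring.Mult.TCOptimised as Mult
import Algebra.Properties.Semiring.Sum as Sum
import Algebra.Solver.Ring as RingSolver
import Algebra.Solver.Ring.AlmostCommutativeRing as ACR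
open import Data.Fin.Base using (Fin; zero; suc; toℕ; punchIn)
open import Data.Fin.Permutation as Perm using (Permutation′; _⟨$⟩ʳ_)
import Data.Fin.Properties as Fin
open import Data.Integer.Base as ℤ using (ℤ; +_; -[1+_])
import Data.Integer.Properties as ℤ
open import Data.List.Base using (List; []; _∷_; _++_; map; foldr; tabulate; concatMap)
import Data.List.Properties as List
open import Data.Maybe.Base using (Maybe; just; nothing)
open import Data.Nat.Base as ℕ using (ℕ; zero; suc; _∸_; z≤n; s≤s)
open import Data.Nat.Combinatorics using (_C_; nCk+nC[k+1]≡[n+1]C[k+1]; nC1≡n)
import Data.Nat.ListAction as ListAction
import Data.Nat.Properties as ℕ
open import Data.Product.Base using (_×_; _,_; ∃-syntax; proj₁; proj₂)
import Data.Rational.Base as ℚ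
import Data.Rational.Properties as ℚ
import Data.Sign.Base as Sign
open import Data.Sum.Base using (_⊎_; inj₁; inj₂)
open import Function.Base using (_∘_; id)
open import Relation.Binary.PropositionalEquality as ≡ using (_≡_; _≢_)
open import Relation.Nullary using (Dec; yes; no; ¬_; contradiction; _×-dec_)

-- Both identities are specialisations of one identity over a commutative ring with elements u, v
-- and d = 1/(1 + uv). Put s = (1 − v) d, c = v (1 + u) d, T = d (u + v) and Y T = v (1 + u)² d².
-- Then s + c = 1, T = s u + c and Y T = c (s + c + s u), which says that T^des Y^pk is a sum of
-- products of 2 × 2 transfer matrices along the descent word: cut the word into blocks consisting
-- of descents followed by ascents, with weight c for each cut, s for each ascent inside a block
-- and s u for each descent inside a block.
--
-- Let A(j) and B(j) be the sums of q^inv times the two state weights over the permutations in 𝔖ₙ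
-- with first letter j, and (U X)(j) = q^j Σ_{k ≥ j} X(k). Deleting the first letter shows that A and
-- B satisfy linear recurrences in U alone, because prepending a descent is a rank one operator
-- minus U. If X_{n+1} = γₙ (q^j)ⱼ + s U Xₙ, then the totals of X have the q-exponential generating
-- function s X̂ = (exp_q(s x) − 1) γ̂, as the adjoint of U produces q-binomial coefficients.
-- Diagonalising the system with eigenvalues s and − s u, and using Exp_q(z) exp_q(−z) = 1, gives
-- (1 − v E) Ĝ = 1 − v for E = Exp_q(s u x) exp_q(s x), where Ĝ = 1 + c Â and P̂ = d (1 + u) (Ĝ − 1).
--
-- The first identity is the case u = y, v = t after x ↦ x / s. For the second, t (1 + uv) = u + v
-- and v (1 + u)² = y t (1 + uv)² say precisely that (Y, T) = (y, t).

-- With integer coefficients the solver can cancel x − x although equality in R is undecidable.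
module IntegerSolver {c ℓ} (R : CommutativeRing c ℓ) where

  open CommutativeRing R
  open RingProperties ring using (-‿distribˡ-*; -‿distribʳ-*; -0#≈0#; -‿involutive)
  open AbelianGroupProperties +-abelianGroup using () renaming (⁻¹-∙-comm to -‿+-comm)
  open Mult semiring using (×-homo-+; ×1-homo-*) renaming (_×_ to _·_)
  open import Relation.Binary.Reasoning.Setoid setoid

  private
    ⟦_⟧ᶻ : ℤ → Carrier
    ⟦ + n ⟧ᶻ      = n · 1#
    ⟦ -[1+ n ] ⟧ᶻ = - (suc n · 1#)

    shift : ∀ x y z → x - y ≈ (z + x) - (z + y)
    shift x y z = sym (begin
      (z + x) + - (z + y)      ≈⟨ +-cong (+-comm z x) (-‿cong (+-comm z y)) ⟩
      (x + z) + - (y + z)      ≈⟨ +-congˡ (-‿+-comm y z) ⟨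
      (x + z) + (- y + - z)    ≈⟨ +-congˡ (+-comm (- y) (- z)) ⟩
      (x + z) + (- z + - y)    ≈⟨ +-assoc (x + z) (- z) (- y) ⟨
      (x + z) + - z + - y      ≈⟨ +-congʳ (+-assoc x z (- z)) ⟩
      x + (z + - z) + - y      ≈⟨ +-congʳ (+-congˡ (-‿inverseʳ z)) ⟩
      x + 0# + - y             ≈⟨ +-congʳ (+-identityʳ x) ⟩
      x - y                    ∎)

    ⊖-homo : ∀ m n → ⟦ m ℤ.⊖ n ⟧ᶻ ≈ m · 1# - n · 1#
    ⊖-homo zero    zero    = sym (-‿inverseʳ 0#)
    ⊖-homo zero    (suc n) = sym (+-identityˡ _)
    ⊖-homo (suc m) zero    = sym (trans (+-congˡ -0#≈0#) (+-identityʳ _))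
    ⊖-homo (suc m) (suc n) = begin
      ⟦ suc m ℤ.⊖ suc n ⟧ᶻ           ≡⟨ ≡.cong ⟦_⟧ᶻ (ℤ.[1+m]⊖[1+n]≡m⊖n m n) ⟩
      ⟦ m ℤ.⊖ n ⟧ᶻ                   ≈⟨ ⊖-homo m n ⟩
      m · 1# - n · 1#                ≈⟨ shift _ _ 1# ⟩
      (1# + m · 1#) - (1# + n · 1#)  ≈⟨ +-cong (×-homo-+ 1# 1 m) (-‿cong (×-homo-+ 1# 1 n)) ⟨
      suc m · 1# - suc n · 1#        ∎

    +-homo : ∀ i j → ⟦ i ℤ.+ j ⟧ᶻ ≈ ⟦ i ⟧ᶻ + ⟦ j ⟧ᶻ
    +-homo (+ m)    (+ n)    = ×-homo-+ 1# m n
    +-homo (+ m)    -[1+ n ] = ⊖-homo m (suc n)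
    +-homo -[1+ m ] (+ n)    = trans (⊖-homo n (suc m)) (+-comm _ _)
    +-homo -[1+ m ] -[1+ n ] = begin
      - (suc (suc (m ℕ.+ n)) · 1#)     ≡⟨ ≡.cong (λ k → - (suc k · 1#)) (ℕ.+-suc m n) ⟨
      - ((suc m ℕ.+ suc n) · 1#)       ≈⟨ -‿cong (×-homo-+ 1# (suc m) (suc n)) ⟩
      - (suc m · 1# + suc n · 1#)      ≈⟨ -‿+-comm _ _ ⟨
      - (suc m · 1#) - (suc n · 1#)    ∎

    neg-homo : ∀ i → ⟦ ℤ.- i ⟧ᶻ ≈ - ⟦ i ⟧ᶻ
    neg-homo (+ zero)  = sym -0#≈0#
    neg-homo (+ suc n) = refl
    neg-homo -[1+ n ]  = sym (-‿involutive _)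

    ◃-homo : ∀ n → ⟦ Sign.- ℤ.◃ n ⟧ᶻ ≈ - (n · 1#)
    ◃-homo zero    = sym -0#≈0#
    ◃-homo (suc n) = refl

    +◃-homo : ∀ n → ⟦ Sign.+ ℤ.◃ n ⟧ᶻ ≈ n · 1#
    +◃-homo zero    = refl
    +◃-homo (suc n) = refl

    *-homo : ∀ i j → ⟦ i ℤ.* j ⟧ᶻ ≈ ⟦ i ⟧ᶻ * ⟦ j ⟧ᶻ
    *-homo (+ m)    (+ n)    = trans (+◃-homo (m ℕ.* n)) (×1-homo-* m n)
    *-homo (+ m)    -[1+ n ] = trans (◃-homo (m ℕ.* suc n))
      (trans (-‿cong (×1-homo-* m (suc n))) (-‿distribʳ-* _ _))
    *-homo -[1+ m ] (+ n)    = trans (◃-homo (suc m ℕ.* n))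
      (trans (-‿cong (×1-homo-* (suc m) n)) (-‿distribˡ-* _ _))
    *-homo -[1+ m ] -[1+ n ] = begin
      (suc m ℕ.* suc n) · 1#             ≈⟨ ×1-homo-* (suc m) (suc n) ⟩
      suc m · 1# * suc n · 1#            ≈⟨ -‿involutive _ ⟨
      - - (suc m · 1# * suc n · 1#)      ≈⟨ -‿cong (-‿distribʳ-* _ _) ⟩
      - (suc m · 1# * - (suc n · 1#))    ≈⟨ -‿distribˡ-* _ _ ⟩
      - (suc m · 1#) * - (suc n · 1#)    ∎

    homomorphism : CommutativeRing.rawRing ℤ.+-*-commutativeRing
                   ACR.-Raw-AlmostCommutative⟶ ACR.fromCommutativeRing R
    homomorphism = record
      { ⟦_⟧    = ⟦_⟧ᶻ
      ; +-homo = +-homo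
      ; *-homo = *-homo
      ; -‿homo = neg-homo
      ; 0-homo = refl
      ; 1-homo = refl
      }

    decide : ∀ i j → Maybe (⟦ i ⟧ᶻ ≈ ⟦ j ⟧ᶻ)
    decide i j with i ℤ.≟ j
    ... | yes ≡.refl = just refl
    ... | no  _      = nothing

  open RingSolver (CommutativeRing.rawRing ℤ.+-*-commutativeRing)
                  (ACR.fromCommutativeRing R) homomorphism decide public
    using (solve; con; _:+_; _:*_; _:-_; :-_; _:=_)

  :0 :1 : ∀ {n} → RingSolver.Polynomial _ _ homomorphism decide n
  :0 = con (+ 0)
  :1 = con (+ 1)

-- Constants, rescaling of the variable and quotients in power series rings.

module Convolution {c ℓ} (R : CommutativeRing c ℓ) where

  open CommutativeRing R hiding (zero)
  open Sum semiring
  open Exp semiring using (_^_; ^-homo-*)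
  open PowerSeries R using (convolution; series; at; recip; recip-inverse; Series; coeff; const)
  open PowerSeries R using () renaming (commutativeRing to seriesRing)
  open IntegerSolver R
  private
    module S = CommutativeRing seriesRing
    module S-Solver = IntegerSolver seriesRing

  convolution-cong : ∀ {f f′ g g′ : ℕ → Carrier} → (∀ n → f n ≈ f′ n) → (∀ n → g n ≈ g′ n) →
                     ∀ n → convolution f g n ≈ convolution f′ g′ n
  convolution-cong p r n = sum-cong-≋ {suc n} λ k → *-cong (p (toℕ k)) (r (n ∸ toℕ k))

  convolution-comm : ∀ f g n → convolution f g n ≈ convolution g f n
  convolution-comm f g = at (S.*-comm (series f) (series g))

  convolution-scaleˡ : ∀ a f g n → convolution (λ k → a * f k) g n ≈ a * convolution f g n
  convolution-scaleˡ a f g n = trans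
    (sum-cong-≋ {suc n} λ k → *-assoc a (f (toℕ k)) (g (n ∸ toℕ k)))
    (sym (*-distribˡ-sum {suc n} a (λ k → f (toℕ k) * g (n ∸ toℕ k))))

  convolution-scaleʳ : ∀ a f g n → convolution f (λ k → a * g k) n ≈ a * convolution f g n
  convolution-scaleʳ a f g n = trans (convolution-comm f (λ k → a * g k) n)
    (trans (convolution-scaleˡ a g f n) (*-congˡ (convolution-comm g f n)))

  convolution-zeroˡ : ∀ f g → (∀ n → f n ≈ 0#) → ∀ n → convolution f g n ≈ 0#
  convolution-zeroˡ f g p n = trans
    (sum-cong-≋ {suc n} λ k → trans (*-congʳ (p (toℕ k))) (zeroˡ (g (n ∸ toℕ k))))
    (sum-replicate-zero (suc n))

  const-convolution : ∀ a g n → convolution (coeff (const a)) g n ≈ a * g n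
  const-convolution a g zero    = +-identityʳ _
  const-convolution a g (suc n) =
    trans (+-congˡ (convolution-zeroˡ _ g (λ _ → refl) n)) (+-identityʳ _)

  const-+ : ∀ a b → const (a + b) S.≈ const a S.+ const b
  at (const-+ a b) zero    = refl
  at (const-+ a b) (suc n) = sym (+-identityˡ 0#)

  const-* : ∀ a b → const (a * b) S.≈ const a S.* const b
  at (const-* a b) zero    = sym (const-convolution a (coeff (const b)) 0)
  at (const-* a b) (suc n) =
    sym (trans (const-convolution a (coeff (const b)) (suc n)) (zeroʳ a))

  const-cong : ∀ {a b} → a ≈ b → const a S.≈ const b
  at (const-cong p) zero    = p
  at (const-cong p) (suc n) = refl

  const-neg : ∀ a → const (- a) S.≈ S.- const a
  at (const-neg a) zero    = refl
  at (const-neg a) (suc n) = sym (RingProperties.-0#≈0# ring)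

  -- The substitution x ↦ r x; the lemmas that follow make it a ring homomorphism.
  scale : Carrier → Series → Series
  coeff (scale r f) n = r ^ n * coeff f n

  scale-cong : ∀ r {f g} → f S.≈ g → scale r f S.≈ scale r g
  at (scale-cong r p) n = *-congˡ (at p n)

  scale-+ : ∀ r f g → scale r (f S.+ g) S.≈ scale r f S.+ scale r g
  at (scale-+ r f g) n = distribˡ _ _ _

  scale-neg : ∀ r f → scale r (S.- f) S.≈ S.- scale r f
  at (scale-neg r f) n = sym (RingProperties.-‿distribʳ-* ring _ _)

  scale-const : ∀ r a → scale r (const a) S.≈ const a
  at (scale-const r a) zero    = *-identityˡ a
  at (scale-const r a) (suc n) = zeroʳ _

  scale-* : ∀ r f g → scale r (f S.* g) S.≈ scale r f S.* scale r g
  at (scale-* r f g) n = trans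
    (*-distribˡ-sum {suc n} (r ^ n) (λ k → coeff f (toℕ k) * coeff g (n ∸ toℕ k)))
    (sum-cong-≋ {suc n} λ k → trans
      (*-congʳ (trans (reflexive (≡.cong (r ^_) (≡.sym (ℕ.m+[n∸m]≡n (Fin.toℕ≤pred[n] k)))))
                      (^-homo-* r (toℕ k) (n ∸ toℕ k))))
      (solve 4 (λ a b x y → a :* b :* (x :* y) := a :* x :* (b :* y))
        refl (r ^ toℕ k) (r ^ (n ∸ toℕ k)) (coeff f (toℕ k)) (coeff g (n ∸ toℕ k))))

  -- `recip c g` inverts `g`, so a quotient is determined by the product equation it solves. Both
  -- quotients of series in x in the theorem are identified this way.
  *-recip-unique : ∀ c {f g h} → c * coeff g 0 ≈ 1# → g S.* h S.≈ f → f S.* recip c g S.≈ h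
  *-recip-unique c {f} {g} {h} p gh≈f = S.trans (S.*-congʳ (S.sym gh≈f))
    (S.trans (reorder g h (recip c g))
      (S.trans (S.*-congˡ (recip-inverse c g p)) (S.*-identityʳ h)))
    where
    open S-Solver using () renaming (solve to solveₛ; _:*_ to _⊗_; _:=_ to _⊜_)
    reorder : ∀ g h r → (g S.* h) S.* r S.≈ h S.* (g S.* r)
    reorder = solveₛ 3 (λ g h r → (g ⊗ h) ⊗ r ⊜ h ⊗ (g ⊗ r)) S.refl

-- q-calculus over a commutative ring in which the q-factorials are invertible.

InverseFactorials : ∀ {c ℓ} (R : CommutativeRing c ℓ) (q : CommutativeRing.Carrier R) →
                    (ℕ → CommutativeRing.Carrier R) → Set ℓ
InverseFactorials R q 1/[_]! = ∀ n → [ n ]! * 1/[ n ]! ≈ 1#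
  where
  open CommutativeRing R
  open QAnalogues R q

module QCalculus {c ℓ} (R : CommutativeRing c ℓ) (q : CommutativeRing.Carrier R)
  (1/[_]! : ℕ → CommutativeRing.Carrier R) ([n]!*1/[n]!≈1 : InverseFactorials R q 1/[_]!) where

  open CommutativeRing R hiding (zero)
  open QAnalogues R q

  open Sum semiring
  open Exp semiring using (_^_; ^-homo-*; ^-congˡ)
  open CommutativeExp commutativeSemiring using (^-distrib-*)
  open QExponentials R q 1/[_]!
  open PowerSeries R using (convolution; Series; coeff; at; const)
  open PowerSeries R using () renaming (commutativeRing to seriesRing)
  private module S = CommutativeRing seriesRing
  open IntegerSolver R
  open Convolution R
  open import Relation.Binary.Reasoning.Setoid setoid

  [_] : ℕ → Carrier
  [ n ] = ∑[ i < n ] (q ^ toℕ i)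

  [1+n] : ∀ n → [ suc n ] ≈ 1# + q * [ n ]
  [1+n] n = +-congˡ (sym (*-distribˡ-sum {n} q (λ i → q ^ toℕ i)))

  [m+n] : ∀ m n → [ m ℕ.+ n ] ≈ [ m ] + q ^ m * [ n ]
  [m+n] zero    n = solve 1 (λ a → a := :0 :+ :1 :* a) refl [ n ]
  [m+n] (suc m) n = begin
    [ suc (m ℕ.+ n) ]                       ≈⟨ [1+n] (m ℕ.+ n) ⟩
    1# + q * [ m ℕ.+ n ]                    ≈⟨ +-congˡ (*-congˡ ([m+n] m n)) ⟩
    1# + q * ([ m ] + q ^ m * [ n ])
      ≈⟨ solve 4 (λ q a b c → :1 :+ q :* (a :+ b :* c) := (:1 :+ q :* a) :+ q :* b :* c)
           refl q [ m ] (q ^ m) [ n ] ⟩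
    1# + q * [ m ] + q ^ suc m * [ n ]      ≈⟨ +-congʳ ([1+n] m) ⟨
    [ suc m ] + q ^ suc m * [ n ]           ∎

  [1+n]*1/[1+n]! : ∀ n → [ suc n ] * 1/[ suc n ]! ≈ 1/[ n ]!
  [1+n]*1/[1+n]! n = begin
    [ suc n ] * 1/[ suc n ]!                             ≈⟨ *-identityˡ _ ⟨
    1# * ([ suc n ] * 1/[ suc n ]!)                      ≈⟨ *-congʳ ([n]!*1/[n]!≈1 n) ⟨
    [ n ]! * 1/[ n ]! * ([ suc n ] * 1/[ suc n ]!)
      ≈⟨ solve 4 (λ a b c d → a :* b :* (c :* d) := b :* (a :* c :* d))
           refl [ n ]! 1/[ n ]! [ suc n ] 1/[ suc n ]! ⟩
    1/[ n ]! * ([ suc n ]! * 1/[ suc n ]!)               ≈⟨ *-congˡ ([n]!*1/[n]!≈1 (suc n)) ⟩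
    1/[ n ]! * 1#                                        ≈⟨ *-identityʳ _ ⟩
    1/[ n ]!                                             ∎

  1/[0]!≈1 : 1/[ 0 ]! ≈ 1#
  1/[0]!≈1 = trans (sym (*-identityˡ _)) ([n]!*1/[n]!≈1 0)

  -- `[ suc n ]` divides the unit `[ suc n ]!`. Hence a series whose q-derivative vanishes is
  -- constant, even over a ring that is not a domain.
  [1+n]-cancel : ∀ n {x} → [ suc n ] * x ≈ 0# → x ≈ 0#
  [1+n]-cancel n {x} p = begin
    x                                               ≈⟨ *-identityˡ x ⟨
    1# * x                                          ≈⟨ *-congʳ ([n]!*1/[n]!≈1 (suc n)) ⟨
    [ n ]! * [ suc n ] * 1/[ suc n ]! * x
      ≈⟨ solve 4 (λ a b c d → a :* b :* c :* d := a :* c :* (b :* d))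
           refl [ n ]! [ suc n ] 1/[ suc n ]! x ⟩
    [ n ]! * 1/[ suc n ]! * ([ suc n ] * x)         ≈⟨ *-congˡ p ⟩
    [ n ]! * 1/[ suc n ]! * 0#                      ≈⟨ zeroʳ _ ⟩
    0#                                              ∎

  -- The q-derivative (f(qx) - f(x)) / ((q - 1) x), acting on coefficient sequences.
  ∂ : (ℕ → Carrier) → ℕ → Carrier
  ∂ f n = [ suc n ] * f (suc n)

  -- The q-Leibniz rule D(fg)(x) = Df(x) g(x) + f(qx) Dg(x).
  ∂-convolution : ∀ f g n → ∂ (convolution f g) n ≈
                  convolution (∂ f) g n + convolution (λ k → q ^ k * f k) (∂ g) n
  ∂-convolution f g n = begin
    [ suc n ] * convolution f g (suc n)
      ≈⟨ *-distribˡ-sum {suc (suc n)} [ suc n ] (λ k → f (toℕ k) * g (suc n ∸ toℕ k)) ⟩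
    ∑[ k ≤ suc n ] ([ suc n ] * (f (toℕ k) * g (suc n ∸ toℕ k)))
      -- The q-number of n + 1 is that of k plus q^k times that of n + 1 - k; the two parts
      -- differentiate the two factors.
      ≈⟨ sum-cong-≋ {suc (suc n)} split ⟩
    ∑[ k ≤ suc n ] (f₁ (toℕ k) * g (suc n ∸ toℕ k) + f₂ (toℕ k) * g₁ (suc n ∸ toℕ k))
      ≈⟨ ∑-distrib-+ {suc (suc n)} (λ k → f₁ (toℕ k) * g (suc n ∸ toℕ k))
           (λ k → f₂ (toℕ k) * g₁ (suc n ∸ toℕ k)) ⟩
    convolution f₁ g (suc n) + convolution f₂ g₁ (suc n)
      -- The q-number of 0 kills one term, so the index shifts down. In the second sum the vanishing
      -- term is the last one, hence the two commutations.
      ≈⟨ +-cong (first-vanishes f g) (trans (convolution-comm f₂ g₁ (suc n))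
           (trans (first-vanishes g f₂) (convolution-comm (∂ g) f₂ n))) ⟩
    convolution (∂ f) g n + convolution f₂ (∂ g) n ∎
    where
    f₁ f₂ g₁ : ℕ → Carrier
    f₁ k = [ k ] * f k
    f₂ k = q ^ k * f k
    g₁ k = [ k ] * g k

    first-vanishes : ∀ f g → convolution (λ k → [ k ] * f k) g (suc n) ≈ convolution (∂ f) g n
    first-vanishes f g = trans (+-congʳ (trans (*-congʳ (zeroˡ _)) (zeroˡ _))) (+-identityˡ _)

    split : ∀ (k : Fin (suc (suc n))) → [ suc n ] * (f (toℕ k) * g (suc n ∸ toℕ k)) ≈
            f₁ (toℕ k) * g (suc n ∸ toℕ k) + f₂ (toℕ k) * g₁ (suc n ∸ toℕ k)
    split k = trans
      (*-congʳ (trans (reflexive (≡.cong [_] (≡.sym (ℕ.m+[n∸m]≡n (Fin.toℕ≤pred[n] k)))))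
                      ([m+n] (toℕ k) (suc n ∸ toℕ k))))
      (solve 5 (λ a b c d e → (a :+ b :* c) :* (d :* e) := a :* d :* e :+ b :* d :* (c :* e))
        refl [ toℕ k ] (q ^ toℕ k) [ suc n ∸ toℕ k ] (f (toℕ k)) (g (suc n ∸ toℕ k)))

  ∂-exp : ∀ a n → ∂ (coeff (exp-q a)) n ≈ a * coeff (exp-q a) n
  ∂-exp a n = trans
    (solve 4 (λ N a b c → N :* (a :* b :* c) := a :* (b :* (N :* c)))
      refl [ suc n ] a (a ^ n) 1/[ suc n ]!)
    (*-congˡ (*-congˡ ([1+n]*1/[1+n]! n)))

  -- Since binom(n + 1, 2) = n + binom(n, 2), a factor q^n appears: the derivative is a Exp_q(aqx),
  -- with the same dilation as in the q-Leibniz rule.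
  ∂-Exp : ∀ a n → ∂ (coeff (Exp-q a)) n ≈ a * (q ^ n * coeff (Exp-q a) n)
  ∂-Exp a n = begin
    [ suc n ] * (q ^ (suc n C 2) * (a ^ suc n * 1/[ suc n ]!))
      ≈⟨ *-congˡ (*-congʳ (trans (reflexive (≡.cong (q ^_) binomial)) (^-homo-* q n (n C 2)))) ⟩
    [ suc n ] * (q ^ n * q ^ (n C 2) * (a * a ^ n * 1/[ suc n ]!))
      ≈⟨ solve 6 (λ N e f a b c → N :* (e :* f :* (a :* b :* c)) := a :* (e :* (f :* (b :* (N :* c)))))
           refl [ suc n ] (q ^ n) (q ^ (n C 2)) a (a ^ n) 1/[ suc n ]! ⟩
    a * (q ^ n * (q ^ (n C 2) * (a ^ n * ([ suc n ] * 1/[ suc n ]!))))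
      ≈⟨ *-congˡ (*-congˡ (*-congˡ (*-congˡ ([1+n]*1/[1+n]! n)))) ⟩
    a * (q ^ n * (q ^ (n C 2) * (a ^ n * 1/[ n ]!))) ∎
    where
    binomial : suc n C 2 ≡ n ℕ.+ n C 2
    binomial = ≡.trans (≡.sym (nCk+nC[k+1]≡[n+1]C[k+1] n 1)) (≡.cong (ℕ._+ n C 2) (nC1≡n n))

  coeff-Exp*exp-zero : ∀ a b → coeff (Exp-q a S.* exp-q b) 0 ≈ 1#
  coeff-Exp*exp-zero a b = trans (+-identityʳ _)
    (trans (*-cong (trans (*-identityˡ _) (trans (*-identityˡ _) 1/[0]!≈1))
                   (trans (*-identityˡ _) 1/[0]!≈1)) (*-identityˡ _))

  Exp-cong : ∀ {a b} → a ≈ b → Exp-q a S.≈ Exp-q b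
  at (Exp-cong p) n = *-congˡ (*-congʳ (^-congˡ n p))

  exp-cong : ∀ {a b} → a ≈ b → exp-q a S.≈ exp-q b
  at (exp-cong p) n = *-congʳ (^-congˡ n p)

  scale-exp : ∀ r a → scale r (exp-q a) S.≈ exp-q (r * a)
  at (scale-exp r a) n = trans (sym (*-assoc _ _ _)) (*-congʳ (sym (^-distrib-* r a n)))

  scale-Exp : ∀ r a → scale r (Exp-q a) S.≈ Exp-q (r * a)
  at (scale-Exp r a) n = trans
    (solve 4 (λ r b a i → r :* (b :* (a :* i)) := b :* (r :* a :* i)) refl (r ^ n) (q ^ (n C 2)) (a ^ n) 1/[ n ]!)
    (*-congˡ (*-congʳ (sym (^-distrib-* r a n))))

  -- The q-derivative of the product is (a + b) Exp_q(aqx) exp_q(bx) = 0, and the constant term is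
  -- 1.
  Exp*exp≈1 : ∀ {a b} → a + b ≈ 0# → Exp-q a S.* exp-q b S.≈ S.1#
  at (Exp*exp≈1 {a} {b} p) zero = coeff-Exp*exp-zero a b
  at (Exp*exp≈1 {a} {b} p) (suc n) = [1+n]-cancel n (begin
    ∂ (convolution E e) n
      ≈⟨ ∂-convolution E e n ⟩
    convolution (∂ E) e n + convolution E₁ (∂ e) n
      ≈⟨ +-cong (convolution-cong {g = e} (∂-Exp a) (λ _ → refl) n)
                (convolution-cong {E₁} (λ _ → refl) (∂-exp b) n) ⟩
    convolution (λ k → a * E₁ k) e n + convolution E₁ (λ k → b * e k) n
      ≈⟨ +-cong (convolution-scaleˡ a E₁ e n) (convolution-scaleʳ b E₁ e n) ⟩
    a * convolution E₁ e n + b * convolution E₁ e n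
      ≈⟨ distribʳ _ a b ⟨
    (a + b) * convolution E₁ e n
      ≈⟨ trans (*-congʳ p) (zeroˡ _) ⟩
    0# ∎)
    where
    e E E₁ : ℕ → Carrier
    e = coeff (exp-q b)
    E = coeff (Exp-q a)
    E₁ k = q ^ k * E k

  -- ascend w j is the sum of qⁱ w(i) over i ≤ j.
  ascend : (ℕ → Carrier) → ℕ → Carrier
  ascend w zero    = w zero
  ascend w (suc j) = w zero + q * ascend (w ∘ suc) j

  -- (U X)(j) is qʲ times the sum of the entries of X from the j-th one on.
  U : ∀ {n} → (Fin n → Carrier) → Fin (suc n) → Carrier
  U         X zero    = sum X
  U {suc n} X (suc j) = q * U (X ∘ suc) j

  U-cong : ∀ {n} {X Y : Fin n → Carrier} → (∀ j → X j ≈ Y j) → ∀ j → U X j ≈ U Y j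
  U-cong {n}     p zero    = sum-cong-≋ {n} p
  U-cong {suc n} p (suc j) = *-congˡ (U-cong (p ∘ suc) j)

  U-linear : ∀ {n} a b (X Y : Fin n → Carrier) j →
             U (λ i → a * X i + b * Y i) j ≈ a * U X j + b * U Y j
  U-linear {n}     a b X Y zero    = trans (∑-distrib-+ {n} (λ i → a * X i) (λ i → b * Y i))
    (+-cong (sym (*-distribˡ-sum {n} a X)) (sym (*-distribˡ-sum {n} b Y)))
  U-linear {suc n} a b X Y (suc j) = trans (*-congˡ (U-linear a b (X ∘ suc) (Y ∘ suc) j))
    (solve 5 (λ q a b u v → q :* (a :* u :+ b :* v) := a :* (q :* u) :+ b :* (q :* v))
      refl q a b (U (X ∘ suc) j) (U (Y ∘ suc) j))

  ⟨_,_⟩ : ∀ {n} → (Fin n → Carrier) → (ℕ → Carrier) → Carrier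
  ⟨_,_⟩ {n} X w = ∑[ j < n ] (X j * w (toℕ j))

  -- X(k) enters (U X)(j) exactly for j ≤ k, with factor q^j; exchange the two summations. The last
  -- entry of U X is an empty sum.
  U-adjoint : ∀ {n} (X : Fin n → Carrier) w → ⟨ U X , w ⟩ ≈ ⟨ X , ascend w ⟩
  U-adjoint {zero}  X w = trans (+-identityʳ _) (zeroˡ _)
  U-adjoint {suc n} X w = begin
    sum X * w 0 + ∑[ j < suc n ] (q * U (X ∘ suc) j * w (suc (toℕ j)))
      ≈⟨ +-congˡ (trans (sum-cong-≋ {suc n} λ j → *-assoc q (U (X ∘ suc) j) (w (suc (toℕ j))))
           (sym (*-distribˡ-sum {suc n} q (λ j → U (X ∘ suc) j * w (suc (toℕ j)))))) ⟩
    sum X * w 0 + q * ⟨ U (X ∘ suc) , w ∘ suc ⟩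
      ≈⟨ +-congˡ (*-congˡ (U-adjoint (X ∘ suc) (w ∘ suc))) ⟩
    (X zero + sum (X ∘ suc)) * w 0 + q * ⟨ X ∘ suc , ascend (w ∘ suc) ⟩
      ≈⟨ solve 5 (λ x t w q p → (x :+ t) :* w :+ q :* p := x :* w :+ (t :* w :+ q :* p))
           refl (X zero) (sum (X ∘ suc)) (w 0) q ⟨ X ∘ suc , ascend (w ∘ suc) ⟩ ⟩
    X zero * w 0 + (sum (X ∘ suc) * w 0 + q * ⟨ X ∘ suc , ascend (w ∘ suc) ⟩)
      ≈⟨ +-congˡ (+-cong (*-distribʳ-sum {n} (w 0) (X ∘ suc))
           (*-distribˡ-sum {n} q (λ j → X (suc j) * ascend (w ∘ suc) (toℕ j)))) ⟩
    X zero * w 0 + (∑[ j < n ] (X (suc j) * w 0) + ∑[ j < n ] (q * (X (suc j) * ascend (w ∘ suc) (toℕ j))))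
      ≈⟨ +-congˡ (∑-distrib-+ {n} (λ j → X (suc j) * w 0)
           (λ j → q * (X (suc j) * ascend (w ∘ suc) (toℕ j)))) ⟨
    X zero * w 0 + ∑[ j < n ] (X (suc j) * w 0 + q * (X (suc j) * ascend (w ∘ suc) (toℕ j)))
      ≈⟨ +-congˡ (sum-cong-≋ {n} λ j →
           solve 4 (λ x w q p → x :* w :+ q :* (x :* p) := x :* (w :+ q :* p))
             refl (X (suc j)) (w 0) q (ascend (w ∘ suc) (toℕ j))) ⟩
    ⟨ X , ascend w ⟩ ∎

  -- Evaluates the source term of the recurrences, so that pairing with iterates of `ascend` reduces
  -- a step to values of `ascend` and a shorter pairing.
  geometric-pairing : ∀ n w → ⟨_,_⟩ {suc n} (λ j → q ^ toℕ j) w ≈ ascend w n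
  geometric-pairing zero    w = trans (+-identityʳ _) (*-identityˡ _)
  geometric-pairing (suc n) w = +-cong (*-identityˡ _) (begin
    ∑[ j < suc n ] (q * q ^ toℕ j * w (suc (toℕ j)))
      ≈⟨ sum-cong-≋ {suc n} (λ j → *-assoc q (q ^ toℕ j) (w (suc (toℕ j)))) ⟩
    ∑[ j < suc n ] (q * (q ^ toℕ j * w (suc (toℕ j))))
      ≈⟨ *-distribˡ-sum {suc n} q (λ j → q ^ toℕ j * w (suc (toℕ j))) ⟨
    q * ⟨_,_⟩ {suc n} (λ j → q ^ toℕ j) (w ∘ suc)
      ≈⟨ *-congˡ (geometric-pairing n (w ∘ suc)) ⟩
    q * ascend (w ∘ suc) n ∎)

  ascend-suc : ∀ w n → ascend w (suc n) ≈ ascend w n + q ^ suc n * w (suc n)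
  ascend-suc w zero    = +-congˡ (*-congʳ (sym (*-identityʳ q)))
  ascend-suc w (suc n) = trans (+-congˡ (*-congˡ (ascend-suc (w ∘ suc) n)))
    (solve 5 (λ a q u v x → a :+ q :* (u :+ v :* x) := a :+ q :* u :+ q :* v :* x)
      refl (w 0) q (ascend (w ∘ suc) n) (q ^ suc n) (w (suc (suc n))))

  -- weight k n is the q-binomial coefficient of n + k and k.
  weight : ℕ → ℕ → Carrier
  weight zero    n = 1#
  weight (suc k) n = ascend (weight k) n

  -- `ascend-suc` is the q-Pascal rule. Multiplied by the factorials, it reduces to the splitting of
  -- the q-number of n + k + 2 at n + 1.
  weight-factorial : ∀ k n → weight k n * [ k ]! * [ n ]! ≈ [ n ℕ.+ k ]!
  weight-factorial zero n = trans (trans (*-congʳ (*-identityˡ 1#)) (*-identityˡ _))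
    (reflexive (≡.cong [_]! (≡.sym (ℕ.+-identityʳ n))))
  weight-factorial (suc k) zero = trans
    (solve 3 (λ w f g → w :* (f :* g) :* :1 := w :* f :* :1 :* g) refl (weight k 0) [ k ]! [ suc k ])
    (*-congʳ (weight-factorial k zero))
  weight-factorial (suc k) (suc n) = begin
    ascend (weight k) (suc n) * ([ k ]! * [ suc k ]) * ([ n ]! * [ suc n ])
      ≈⟨ *-congʳ (*-congʳ (ascend-suc (weight k) n)) ⟩
    (ascend (weight k) n + q ^ suc n * weight k (suc n)) * ([ k ]! * [ suc k ]) * ([ n ]! * [ suc n ])
      ≈⟨ solve 7 (λ a e w f g h i → (a :+ e :* w) :* (f :* g) :* (h :* i) :=
           a :* (f :* g) :* h :* i :+ w :* f :* (h :* i) :* (e :* g))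
           refl (ascend (weight k) n) (q ^ suc n) (weight k (suc n)) [ k ]! [ suc k ] [ n ]! [ suc n ] ⟩
    ascend (weight k) n * [ suc k ]! * [ n ]! * [ suc n ] + weight k (suc n) * [ k ]! * [ suc n ]! * (q ^ suc n * [ suc k ])
      ≈⟨ +-cong (*-congʳ (weight-factorial (suc k) n)) (*-congʳ
           (trans (weight-factorial k (suc n)) (reflexive (≡.cong [_]! (≡.sym (ℕ.+-suc n k)))))) ⟩
    [ n ℕ.+ suc k ]! * [ suc n ] + [ n ℕ.+ suc k ]! * (q ^ suc n * [ suc k ])
      ≈⟨ distribˡ _ _ _ ⟨
    [ n ℕ.+ suc k ]! * ([ suc n ] + q ^ suc n * [ suc k ])
      ≈⟨ *-congˡ ([m+n] (suc n) (suc k)) ⟨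
    [ suc n ℕ.+ suc k ]! ∎

  weight*1/[n+k]! : ∀ k n → weight k n * 1/[ n ℕ.+ k ]! ≈ 1/[ n ]! * 1/[ k ]!
  weight*1/[n+k]! k n = begin
    weight k n * 1/[ n ℕ.+ k ]!
      ≈⟨ solve 2 (λ w x → w :* x := w :* (:1 :* :1) :* x) refl (weight k n) 1/[ n ℕ.+ k ]! ⟩
    weight k n * (1# * 1#) * 1/[ n ℕ.+ k ]!
      ≈⟨ *-congʳ (*-congˡ (*-cong ([n]!*1/[n]!≈1 k) ([n]!*1/[n]!≈1 n))) ⟨
    weight k n * ([ k ]! * 1/[ k ]! * ([ n ]! * 1/[ n ]!)) * 1/[ n ℕ.+ k ]!
      ≈⟨ solve 6 (λ w a b c d x → w :* (a :* b :* (c :* d)) :* x := (w :* a :* c) :* x :* (d :* b))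
           refl (weight k n) [ k ]! 1/[ k ]! [ n ]! 1/[ n ]! 1/[ n ℕ.+ k ]! ⟩
    weight k n * [ k ]! * [ n ]! * 1/[ n ℕ.+ k ]! * (1/[ n ]! * 1/[ k ]!)
      ≈⟨ *-congʳ (trans (*-congʳ (weight-factorial k n)) ([n]!*1/[n]!≈1 (n ℕ.+ k))) ⟩
    1# * (1/[ n ]! * 1/[ k ]!)
      ≈⟨ *-identityˡ _ ⟩
    1/[ n ]! * 1/[ k ]! ∎

  egf : (ℕ → Carrier) → Series
  coeff (egf a) n = a n * 1/[ n ]!

  total : (∀ n → Fin n → Carrier) → ℕ → Carrier
  total X n = sum (X n)

  -- Stated for arbitrary s and γ because it is applied to both eigenvectors, with eigenvalues s and
  -- - s u.
  module Transfer (s : Carrier) (γ : ℕ → Carrier) (X : ∀ n → Fin n → Carrier)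
    (X-step : ∀ n j → X (suc n) j ≈ γ n * q ^ toℕ j + s * U (X n) j) where

    pairing-step : ∀ n w → ⟨ X (suc n) , w ⟩ ≈ γ n * ascend w n + s * ⟨ X n , ascend w ⟩
    pairing-step n w = begin
      ⟨ X (suc n) , w ⟩
        ≈⟨ sum-cong-≋ {suc n} (λ j → trans (*-congʳ (X-step n j))
             (solve 5 (λ g e s u w → (g :* e :+ s :* u) :* w := g :* (e :* w) :+ s :* (u :* w))
               refl (γ n) (q ^ toℕ j) s (U (X n) j) (w (toℕ j)))) ⟩
      ∑[ j < suc n ] (γ n * (q ^ toℕ j * w (toℕ j)) + s * (U (X n) j * w (toℕ j)))
        ≈⟨ ∑-distrib-+ {suc n} (λ j → γ n * (q ^ toℕ j * w (toℕ j))) (λ j → s * (U (X n) j * w (toℕ j))) ⟩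
      ∑[ j < suc n ] (γ n * (q ^ toℕ j * w (toℕ j))) + ∑[ j < suc n ] (s * (U (X n) j * w (toℕ j)))
        ≈⟨ +-cong (sym (*-distribˡ-sum {suc n} (γ n) (λ j → q ^ toℕ j * w (toℕ j))))
                  (sym (*-distribˡ-sum {suc n} s (λ j → U (X n) j * w (toℕ j)))) ⟩
      γ n * ⟨_,_⟩ {suc n} (λ j → q ^ toℕ j) w + s * ⟨ U (X n) , w ⟩
        ≈⟨ +-cong (*-congˡ (geometric-pairing n w)) (*-congˡ (U-adjoint (X n) w)) ⟩
      γ n * ascend w n + s * ⟨ X n , ascend w ⟩ ∎

    -- The coefficients of exp_q(sx) from degree k + 1 on, with s^k taken out; for k = 0 they are
    -- those of (exp_q(sx) - 1) / x.
    tails : ℕ → ℕ → Carrier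
    tails k i = s ^ suc i * 1/[ i ℕ.+ suc k ]!

    -- One step of the recurrence trades weight k at length n + 1 for weight k + 1 at length n, so
    -- the induction on n covers all k at once. The source term gives a q-binomial coefficient over
    -- a factorial, which splits into a coefficient of γ̂ and the first tail coefficient.
    weighted-total : ∀ n k → s * (⟨ X (suc n) , weight k ⟩ * 1/[ suc n ℕ.+ k ]!) ≈
                     convolution (tails k) (coeff (egf γ)) n
    weighted-total n k = begin
      s * (⟨ X (suc n) , weight k ⟩ * 1/[ suc n ℕ.+ k ]!)
        ≈⟨ *-congˡ (*-cong (pairing-step n (weight k)) (reflexive (≡.cong 1/[_]! (≡.sym (ℕ.+-suc n k))))) ⟩
      s * ((γ n * weight (suc k) n + s * ⟨ X n , weight (suc k) ⟩) * 1/[ n ℕ.+ suc k ]!)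
        ≈⟨ solve 5 (λ s g w p i → s :* ((g :* w :+ s :* p) :* i) := s :* (g :* (w :* i)) :+ s :* (s :* (p :* i)))
             refl s (γ n) (weight (suc k) n) ⟨ X n , weight (suc k) ⟩ 1/[ n ℕ.+ suc k ]! ⟩
      s * (γ n * (weight (suc k) n * 1/[ n ℕ.+ suc k ]!)) + s * (s * (⟨ X n , weight (suc k) ⟩ * 1/[ n ℕ.+ suc k ]!))
        ≈⟨ +-congʳ (*-congˡ (*-congˡ (weight*1/[n+k]! (suc k) n))) ⟩
      s * (γ n * (1/[ n ]! * 1/[ suc k ]!)) + s * (s * (⟨ X n , weight (suc k) ⟩ * 1/[ n ℕ.+ suc k ]!))
        ≈⟨ +-congʳ (solve 4 (λ s g a b → s :* (g :* (a :* b)) := s :* :1 :* b :* (g :* a))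
             refl s (γ n) 1/[ n ]! 1/[ suc k ]!) ⟩
      tails k 0 * (γ n * 1/[ n ]!) + s * (s * (⟨ X n , weight (suc k) ⟩ * 1/[ n ℕ.+ suc k ]!))
        ≈⟨ remainder n ⟩
      convolution (tails k) (coeff (egf γ)) n ∎
      where
      remainder : ∀ n → tails k 0 * (γ n * 1/[ n ]!) + s * (s * (⟨ X n , weight (suc k) ⟩ * 1/[ n ℕ.+ suc k ]!)) ≈
                  convolution (tails k) (coeff (egf γ)) n
      -- `X 0` has no entries, so the unrolling stops with a single term of the convolution.
      remainder zero    = +-congˡ (trans (*-congˡ (trans (*-congˡ (zeroˡ _)) (zeroʳ s))) (zeroʳ s))
      remainder (suc m) = +-congˡ (begin
        s * (s * (⟨ X (suc m) , weight (suc k) ⟩ * 1/[ suc m ℕ.+ suc k ]!))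
          ≈⟨ *-congˡ (weighted-total m (suc k)) ⟩
        s * convolution (tails (suc k)) (coeff (egf γ)) m
          ≈⟨ convolution-scaleˡ s (tails (suc k)) (coeff (egf γ)) m ⟨
        convolution (λ i → s * tails (suc k) i) (coeff (egf γ)) m
          ≈⟨ convolution-cong {g = coeff (egf γ)} (λ i → trans (sym (*-assoc s (s ^ suc i) _))
               (*-congˡ (reflexive (≡.cong 1/[_]! (ℕ.+-suc i (suc k)))))) (λ _ → refl) m ⟩
        convolution (λ i → tails k (suc i)) (coeff (egf γ)) m ∎)

    -- The case k = 0 of `weighted-total`, where the weight is constantly 1 and the pairing is the
    -- total. The factor s stays on the left because s need not be invertible.
    egf-total : const s S.* egf (total X) S.≈ (exp-q s S.- S.1#) S.* egf γ
    at egf-total zero = begin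
      s * (0# * 1/[ 0 ]!) + 0#
        ≈⟨ solve 3 (λ s i g → s :* (:0 :* i) :+ :0 := (:1 :* :1 :- :1) :* g :+ :0) refl s 1/[ 0 ]! (γ 0 * 1/[ 0 ]!) ⟩
      (1# * 1# - 1#) * (γ 0 * 1/[ 0 ]!) + 0#
        ≈⟨ +-congʳ (*-congʳ (+-congʳ (*-congˡ 1/[0]!≈1))) ⟨
      (1# * 1/[ 0 ]! - 1#) * (γ 0 * 1/[ 0 ]!) + 0# ∎
    at egf-total (suc n) = begin
      coeff (const s S.* egf (total X)) (suc n)
        ≈⟨ const-convolution s (coeff (egf (total X))) (suc n) ⟩
      s * (sum (X (suc n)) * 1/[ suc n ]!)
        ≈⟨ *-congˡ (*-cong (sum-cong-≋ {suc n} λ j → sym (*-identityʳ (X (suc n) j)))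
             (reflexive (≡.cong 1/[_]! (≡.sym (ℕ.+-identityʳ (suc n)))))) ⟩
      s * (⟨ X (suc n) , weight 0 ⟩ * 1/[ suc n ℕ.+ 0 ]!)
        ≈⟨ weighted-total n 0 ⟩
      convolution (tails 0) (coeff (egf γ)) n
        ≈⟨ convolution-cong {g = coeff (egf γ)} (λ i → sym (tail-exp i)) (λ _ → refl) n ⟩
      convolution (λ i → coeff (exp-q s S.- S.1#) (suc i)) (coeff (egf γ)) n
        ≈⟨ +-identityˡ _ ⟨
      0# + convolution (λ i → coeff (exp-q s S.- S.1#) (suc i)) (coeff (egf γ)) n
        ≈⟨ +-congʳ (trans (*-congʳ head-exp) (zeroˡ _)) ⟨
      coeff ((exp-q s S.- S.1#) S.* egf γ) (suc n) ∎
      where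
      head-exp : coeff (exp-q s S.- S.1#) 0 ≈ 0#
      head-exp = trans (+-congʳ (trans (*-identityˡ _) 1/[0]!≈1)) (-‿inverseʳ 1#)

      tail-exp : ∀ i → coeff (exp-q s S.- S.1#) (suc i) ≈ tails 0 i
      tail-exp i = trans (+-congˡ (RingProperties.-0#≈0# ring)) (trans (+-identityʳ _)
        (*-congˡ (reflexive (≡.cong 1/[_]! (≡.sym (ℕ.+-comm i 1))))))

-- Descents, peaks and inversions when the first letter is split off.

module Statistics where

  open CommutativeMonoidSum ℕ.+-0-commutativeMonoid using (sum; sum-permute; sum-cong-≗)

  ⟦⟧-yes : ∀ {a} {A : Set a} (A? : Dec A) → A → ⟦ A? ⟧ ≡ 1
  ⟦⟧-yes (yes _) _ = ≡.refl
  ⟦⟧-yes (no ¬a) a = contradiction a ¬a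

  ⟦⟧-no : ∀ {a} {A : Set a} (A? : Dec A) → ¬ A → ⟦ A? ⟧ ≡ 0
  ⟦⟧-no (yes a) ¬a = contradiction a ¬a
  ⟦⟧-no (no _)  _  = ≡.refl

  ⟦⟧-cong : ∀ {a b} {A : Set a} {B : Set b} (A? : Dec A) (B? : Dec B) →
            (A → B) → (B → A) → ⟦ A? ⟧ ≡ ⟦ B? ⟧
  ⟦⟧-cong (yes a) B? f g = ≡.sym (⟦⟧-yes B? (f a))
  ⟦⟧-cong (no ¬a) B? f g = ≡.sym (⟦⟧-no B? (¬a ∘ g))

  letters : ∀ {m n} → (Fin m → Fin n) → List ℕ
  letters g = tabulate λ i → suc (toℕ (g i))

  module _ {n} (j : Fin (suc n)) where

    punchIn-mono-< : ∀ {a b} → suc (toℕ a) ℕ.< suc (toℕ b) →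
                     suc (toℕ (punchIn j a)) ℕ.< suc (toℕ (punchIn j b))
    punchIn-mono-< {a} {b} (s≤s a<b) =
      s≤s (ℕ.≰⇒> λ p → ℕ.<⇒≱ a<b (Fin.punchIn-cancel-≤ j b a p))

    punchIn-cancel-< : ∀ {a b} → suc (toℕ (punchIn j a)) ℕ.< suc (toℕ (punchIn j b)) →
                       suc (toℕ a) ℕ.< suc (toℕ b)
    punchIn-cancel-< {a} {b} (s≤s p) =
      s≤s (ℕ.≰⇒> λ b≤a → ℕ.<⇒≱ p (Fin.punchIn-mono-≤ j b a b≤a))

    -- All three statistics depend on comparisons of letters only, so this is what makes them
    -- invariant under the relabelling by `punchIn j`.
    ⟦⟧-punchIn : ∀ a b → ⟦ suc (toℕ (punchIn j a)) ℕ.<? suc (toℕ (punchIn j b)) ⟧ ≡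
                         ⟦ suc (toℕ a) ℕ.<? suc (toℕ b) ⟧
    ⟦⟧-punchIn a b = ⟦⟧-cong (_ ℕ.<? _) (_ ℕ.<? _) punchIn-cancel-< punchIn-mono-<

    des-punchIn : ∀ {m} (g : Fin m → Fin n) → desʷ (letters (punchIn j ∘ g)) ≡ desʷ (letters g)
    des-punchIn {zero}        g = ≡.refl
    des-punchIn {suc zero}    g = ≡.refl
    des-punchIn {suc (suc m)} g = ≡.cong₂ ℕ._+_ (⟦⟧-punchIn _ _) (des-punchIn (g ∘ suc))

    pk-punchIn : ∀ {m} (g : Fin m → Fin n) → pkʷ (letters (punchIn j ∘ g)) ≡ pkʷ (letters g)
    pk-punchIn {zero}              g = ≡.refl
    pk-punchIn {suc zero}          g = ≡.refl
    pk-punchIn {suc (suc zero)}    g = ≡.refl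
    pk-punchIn {suc (suc (suc m))} g = ≡.cong₂ ℕ._+_
      (⟦⟧-cong ((_ ℕ.<? _) ×-dec (_ ℕ.<? _)) ((_ ℕ.<? _) ×-dec (_ ℕ.<? _))
        (λ (p , r) → punchIn-cancel-< p , punchIn-cancel-< r)
        (λ (p , r) → punchIn-mono-< p , punchIn-mono-< r))
      (pk-punchIn (g ∘ suc))

    sum-letters : ∀ {m k} (f : ℕ → ℕ) (g : Fin m → Fin k) →
                  ListAction.sum (map f (letters g)) ≡ sum (λ i → f (suc (toℕ (g i))))
    sum-letters {zero}  f g = ≡.refl
    sum-letters {suc m} f g = ≡.cong (f (suc (toℕ (g zero))) ℕ.+_) (sum-letters f (g ∘ suc))

    inv-punchIn : ∀ {m} (g : Fin m → Fin n) → invʷ (letters (punchIn j ∘ g)) ≡ invʷ (letters g)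
    inv-punchIn {zero}  g = ≡.refl
    inv-punchIn {suc m} g = ≡.cong₂ ℕ._+_
      (≡.trans (sum-letters _ (punchIn j ∘ g ∘ suc))
        (≡.trans (sum-cong-≗ {m} λ i → ⟦⟧-punchIn (g (suc i)) (g zero))
          (≡.sym (sum-letters _ (g ∘ suc)))))
      (inv-punchIn (g ∘ suc))

  sum-zero : ∀ n {f : Fin n → ℕ} → (∀ i → f i ≡ 0) → sum f ≡ 0
  sum-zero zero    p = ≡.refl
  sum-zero (suc n) p = ≡.cong₂ ℕ._+_ (p zero) (sum-zero n (p ∘ suc))

  -- `punchIn j` runs through all values except j, and toℕ j of these lie below it.
  count-below : ∀ {n} (j : Fin (suc n)) →
                sum (λ k → ⟦ suc (toℕ (punchIn j k)) ℕ.<? suc (toℕ j) ⟧) ≡ toℕ j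
  count-below {n}     zero    = sum-zero n λ k → ⟦⟧-no (suc (suc (toℕ k)) ℕ.<? 1) λ { (s≤s ()) }
  count-below {suc n} (suc j) = ≡.cong suc (≡.trans
    (sum-cong-≗ {n} λ k → ⟦⟧-cong (_ ℕ.<? _) (_ ℕ.<? _) ℕ.≤-pred s≤s)
    (count-below j))

  -- The first letter forms an inversion with every smaller value wherever it stands, so the sum
  -- over positions may be reindexed along `ρ`.
  inv-insert : ∀ {n} (j : Fin (suc n)) (ρ : Permutation′ n) →
               inv (Perm.insert zero j ρ) ≡ toℕ j ℕ.+ inv ρ
  inv-insert j ρ = ≡.cong₂ ℕ._+_
    (≡.trans (sum-letters j _ (punchIn j ∘ (ρ ⟨$⟩ʳ_)))
      (≡.trans (≡.sym (sum-permute (λ k → ⟦ suc (toℕ (punchIn j k)) ℕ.<? suc (toℕ j) ⟧) ρ))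
        (count-below j)))
    (inv-punchIn j (ρ ⟨$⟩ʳ_))

  -- A letter preceded by a larger one is not a peak, and peaks further right do not see the first
  -- letter.
  pk-descent : ∀ {a b} w → b ℕ.< a → pkʷ (a ∷ b ∷ w) ≡ pkʷ (b ∷ w)
  pk-descent []      b<a = ≡.refl
  pk-descent (_ ∷ _) b<a =
    ≡.cong (ℕ._+ _) (⟦⟧-no ((_ ℕ.<? _) ×-dec (_ ℕ.<? _)) λ (a<b , _) → ℕ.<-asym a<b b<a)

-- Sums over lists and over all permutations.

module PermutationSums {c ℓ} (R : CommutativeRing c ℓ) where

  open CommutativeRing R hiding (zero)
  open Sum semiring
  open IntegerSolver R

  -- Has the shape of the definition of `P`, so that `P` unfolds to it.
  ∑ᴸ : ∀ {a} {A : Set a} → (A → Carrier) → List A → Carrier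
  ∑ᴸ f xs = foldr _+_ 0# (map f xs)

  module _ {a} {A : Set a} where

    ∑ᴸ-cong : {f g : A → Carrier} → (∀ x → f x ≈ g x) → ∀ xs → ∑ᴸ f xs ≈ ∑ᴸ g xs
    ∑ᴸ-cong p []       = refl
    ∑ᴸ-cong p (x ∷ xs) = +-cong (p x) (∑ᴸ-cong p xs)

    ∑ᴸ-linear : ∀ a b (f g : A → Carrier) xs →
                ∑ᴸ (λ x → a * f x + b * g x) xs ≈ a * ∑ᴸ f xs + b * ∑ᴸ g xs
    ∑ᴸ-linear a b f g []       = solve 2 (λ a b → :0 := a :* :0 :+ b :* :0) refl a b
    ∑ᴸ-linear a b f g (x ∷ xs) = trans (+-congˡ (∑ᴸ-linear a b f g xs))
      (solve 6 (λ a b x y s t → a :* x :+ b :* y :+ (a :* s :+ b :* t) := a :* (x :+ s) :+ b :* (y :+ t))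
        refl a b (f x) (g x) (∑ᴸ f xs) (∑ᴸ g xs))

    ∑ᴸ-scale : ∀ a (f : A → Carrier) xs → ∑ᴸ (λ x → a * f x) xs ≈ a * ∑ᴸ f xs
    ∑ᴸ-scale a f []       = sym (zeroʳ a)
    ∑ᴸ-scale a f (x ∷ xs) = trans (+-congˡ (∑ᴸ-scale a f xs)) (sym (distribˡ a (f x) (∑ᴸ f xs)))

    ∑ᴸ-++ : ∀ (f : A → Carrier) xs ys → ∑ᴸ f (xs ++ ys) ≈ ∑ᴸ f xs + ∑ᴸ f ys
    ∑ᴸ-++ f []       ys = sym (+-identityˡ _)
    ∑ᴸ-++ f (x ∷ xs) ys = trans (+-congˡ (∑ᴸ-++ f xs ys)) (sym (+-assoc _ _ _))

    ∑ᴸ-concatMap-tabulate : ∀ {b} {B : Set b} {n} (f : A → Carrier) (g : B → List A) (h : Fin n → B) →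
      ∑ᴸ f (concatMap g (tabulate h)) ≈ ∑[ i < n ] ∑ᴸ f (g (h i))
    ∑ᴸ-concatMap-tabulate {n = zero}  f g h = refl
    ∑ᴸ-concatMap-tabulate {n = suc n} f g h =
      trans (∑ᴸ-++ f (g (h zero)) _) (+-congˡ (∑ᴸ-concatMap-tabulate f g (h ∘ suc)))

  ∑ᴸ-permutations : ∀ n (f : Permutation′ (suc n) → Carrier) → ∑ᴸ f (permutations (suc n)) ≈
                    ∑[ j < suc n ] ∑ᴸ (f ∘ Perm.insert zero j) (permutations n)
  ∑ᴸ-permutations n f = trans
    (∑ᴸ-concatMap-tabulate f (λ j → map (Perm.insert zero j) (permutations n)) id)
    (sum-cong-≋ {suc n} λ j → reflexive (≡.cong (foldr _+_ 0#)
      (≡.sym (List.map-∘ {g = f} {f = Perm.insert zero j} (permutations n)))))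

-- Transfer-matrix weights and their recurrence on the first letter.

module FirstLetterRecursion {c ℓ} (R : CommutativeRing c ℓ) (q : CommutativeRing.Carrier R) where

  open CommutativeRing R hiding (zero)
  open Sum semiring
  open Exp semiring using (_^_; ^-homo-*)
  open QAnalogues R q using (P)
  open IntegerSolver R
  open PermutationSums R
  open Statistics
  open import Relation.Binary.Reasoning.Setoid setoid

  module Weights (s c u T Y : Carrier)
    (s+c≈1 : s + c ≈ 1#) (T≈su+c : T ≈ s * u + c) (YT≈c[1+su] : Y * T ≈ c * (1# + s * u)) where

    -- Leaves out the factor Y T that the exponents pk + 1 and des + 1 contribute; `P-total`
    -- restores it.
    wt : List ℕ → Carrier
    wt w = T ^ desʷ w * Y ^ pkʷ w

    -- Branches on the value of the Iverson bracket instead of the decision, so that equalities such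
    -- as `⟦⟧-punchIn` can be applied inside `wt⁺`.
    pick : ℕ → Carrier → Carrier → Carrier
    pick zero    x y = y
    pick (suc _) x y = x

    -- Prepending a letter a below the first letter of w multiplies wt w by Y if w begins with a
    -- descent, and by 1 otherwise. Since Y T = c (s + c + s u), both cases read
    -- wt (a ∷ w) = s wt⁺ w + c wt w.
    wt⁺ : List ℕ → Carrier
    wt⁺ (a ∷ b ∷ w) = pick ⟦ b ℕ.<? a ⟧ (c * wt (b ∷ w)) (wt (a ∷ b ∷ w))
    wt⁺ _           = 1#

    wt-descent : ∀ {a b} w → b ℕ.< a → wt (a ∷ b ∷ w) ≈ T * wt (b ∷ w)
    wt-descent {a} {b} w b<a = trans
      (*-cong (reflexive (≡.cong (λ k → T ^ (k ℕ.+ desʷ (b ∷ w))) (⟦⟧-yes (b ℕ.<? a) b<a)))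
              (reflexive (≡.cong (Y ^_) (pk-descent w b<a))))
      (*-assoc T _ _)

    wt⁺-descent : ∀ {a b} w → b ℕ.< a → wt⁺ (a ∷ b ∷ w) ≈ c * wt (b ∷ w)
    wt⁺-descent {a} {b} w b<a =
      reflexive (≡.cong (λ k → pick k (c * wt (b ∷ w)) (wt (a ∷ b ∷ w))) (⟦⟧-yes (b ℕ.<? a) b<a))

    wt⁺-nondescent : ∀ {a b} w → ¬ b ℕ.< a → wt⁺ (a ∷ b ∷ w) ≈ wt (a ∷ b ∷ w)
    wt⁺-nondescent {a} {b} w b≮a =
      reflexive (≡.cong (λ k → pick k (c * wt (b ∷ w)) (wt (a ∷ b ∷ w))) (⟦⟧-no (b ℕ.<? a) b≮a))

    wt-ascent : ∀ {a b} w → a ℕ.< b → wt (a ∷ b ∷ w) ≈ s * wt⁺ (b ∷ w) + c * wt (b ∷ w)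
    -- Before a single letter all weights are 1 and the claim is s + c = 1.
    wt-ascent {a} {b} [] a<b = begin
      T ^ (⟦ b ℕ.<? a ⟧ ℕ.+ 0) * 1#
        ≈⟨ *-congʳ (reflexive (≡.cong (λ k → T ^ (k ℕ.+ 0)) (⟦⟧-no (b ℕ.<? a) (ℕ.<-asym a<b)))) ⟩
      1# * 1#                       ≈⟨ *-identityʳ 1# ⟩
      1#                            ≈⟨ s+c≈1 ⟨
      s + c                         ≈⟨ solve 2 (λ s c → s :+ c := s :* :1 :+ c :* (:1 :* :1)) refl s c ⟩
      s * 1# + c * (1# * 1#)        ∎
    wt-ascent {a} {b} (e ∷ w) a<b = byNextStep (e ℕ.<? b)
      where
      byNextStep : Dec (e ℕ.< b) → wt (a ∷ b ∷ e ∷ w) ≈ s * wt⁺ (b ∷ e ∷ w) + c * wt (b ∷ e ∷ w)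
      -- Prepending `a` turns `b` into a peak, which accounts for the factor Y.
      byNextStep (yes e<b) = begin
        T ^ (⟦ b ℕ.<? a ⟧ ℕ.+ desʷ (b ∷ e ∷ w)) * Y ^ pkʷ (a ∷ b ∷ e ∷ w)
          ≡⟨ ≡.cong₂ (λ i k → T ^ (i ℕ.+ desʷ (b ∷ e ∷ w)) * Y ^ (k ℕ.+ pkʷ (b ∷ e ∷ w)))
               (⟦⟧-no (b ℕ.<? a) (ℕ.<-asym a<b)) (⟦⟧-yes ((a ℕ.<? b) ×-dec (e ℕ.<? b)) (a<b , e<b)) ⟩
        T ^ desʷ (b ∷ e ∷ w) * (Y * Y ^ pkʷ (b ∷ e ∷ w))
          ≈⟨ solve 3 (λ t y p → t :* (y :* p) := y :* (t :* p)) refl _ Y _ ⟩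
        Y * wt (b ∷ e ∷ w)
          ≈⟨ *-congˡ (wt-descent w e<b) ⟩
        Y * (T * wt (e ∷ w))
          ≈⟨ *-assoc Y T _ ⟨
        Y * T * wt (e ∷ w)
          ≈⟨ *-congʳ YT≈c[1+su] ⟩
        c * (1# + s * u) * wt (e ∷ w)
          -- Writing 1 as s + c splits the coefficient into s c and c (s u + c) = c T, which belong
          -- to `wt⁺` and `wt` of a word beginning with a descent.
          ≈⟨ *-congʳ (*-congˡ (+-congʳ s+c≈1)) ⟨
        c * (s + c + s * u) * wt (e ∷ w)
          ≈⟨ solve 4 (λ s c u w → c :* (s :+ c :+ s :* u) :* w := s :* (c :* w) :+ c :* ((s :* u :+ c) :* w))
               refl s c u (wt (e ∷ w)) ⟩
        s * (c * wt (e ∷ w)) + c * ((s * u + c) * wt (e ∷ w))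
          ≈⟨ +-cong (*-congˡ (sym (wt⁺-descent w e<b)))
               (*-congˡ (trans (*-congʳ (sym T≈su+c)) (sym (wt-descent w e<b)))) ⟩
        s * wt⁺ (b ∷ e ∷ w) + c * wt (b ∷ e ∷ w) ∎
      byNextStep (no e≮b) = begin
        T ^ (⟦ b ℕ.<? a ⟧ ℕ.+ desʷ (b ∷ e ∷ w)) * Y ^ pkʷ (a ∷ b ∷ e ∷ w)
          ≡⟨ ≡.cong₂ (λ i k → T ^ (i ℕ.+ desʷ (b ∷ e ∷ w)) * Y ^ (k ℕ.+ pkʷ (b ∷ e ∷ w)))
               (⟦⟧-no (b ℕ.<? a) (ℕ.<-asym a<b)) (⟦⟧-no ((a ℕ.<? b) ×-dec (e ℕ.<? b)) λ (_ , e<b) → e≮b e<b) ⟩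
        wt (b ∷ e ∷ w)
          ≈⟨ *-identityˡ _ ⟨
        1# * wt (b ∷ e ∷ w)
          ≈⟨ *-congʳ s+c≈1 ⟨
        (s + c) * wt (b ∷ e ∷ w)
          ≈⟨ distribʳ _ s c ⟩
        s * wt (b ∷ e ∷ w) + c * wt (b ∷ e ∷ w)
          ≈⟨ +-congʳ (*-congˡ (wt⁺-nondescent w e≮b)) ⟨
        s * wt⁺ (b ∷ e ∷ w) + c * wt (b ∷ e ∷ w) ∎

    wt⁺-ascent : ∀ {a b} w → a ℕ.< b → wt⁺ (a ∷ b ∷ w) ≈ s * wt⁺ (b ∷ w) + c * wt (b ∷ w)
    wt⁺-ascent w a<b = trans (wt⁺-nondescent w (ℕ.<-asym a<b)) (wt-ascent w a<b)

    wt-punchIn : ∀ {m n} j (g : Fin m → Fin n) → wt (letters (punchIn j ∘ g)) ≡ wt (letters g)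
    wt-punchIn j g = ≡.cong₂ (λ d p → T ^ d * Y ^ p) (des-punchIn j g) (pk-punchIn j g)

    wt⁺-punchIn : ∀ {m n} j (g : Fin m → Fin n) → wt⁺ (letters (punchIn j ∘ g)) ≡ wt⁺ (letters g)
    wt⁺-punchIn {zero}        j g = ≡.refl
    wt⁺-punchIn {suc zero}    j g = ≡.refl
    wt⁺-punchIn {suc (suc m)} j g = ≡.trans
      (≡.cong (λ k → pick k (c * wt (letters (punchIn j ∘ g ∘ suc))) (wt (letters (punchIn j ∘ g))))
        (⟦⟧-punchIn j (g (suc zero)) (g zero)))
      (≡.cong₂ (pick _) (≡.cong (c *_) (wt-punchIn j (g ∘ suc))) (wt-punchIn j g))

    -- The indicator of j ≤ k, that is, of an ascent from j to `punchIn j k`; its recursion is that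
    -- of `U`.
    χ : ∀ {n} → Fin (suc n) → Fin n → Carrier
    χ zero    k       = 1#
    χ (suc j) zero    = 0#
    χ (suc j) (suc k) = χ j k

    χ-spec : ∀ {n} (j : Fin (suc n)) k →
             (toℕ j ℕ.< toℕ (punchIn j k) × χ j k ≡ 1#) ⊎ (toℕ (punchIn j k) ℕ.< toℕ j × χ j k ≡ 0#)
    χ-spec zero    k       = inj₁ (s≤s z≤n , ≡.refl)
    χ-spec (suc j) zero    = inj₂ (s≤s z≤n , ≡.refl)
    χ-spec (suc j) (suc k) with χ-spec j k
    ... | inj₁ (p , e) = inj₁ (s≤s p , e)
    ... | inj₂ (p , e) = inj₂ (s≤s p , e)

    module _ {n} (j : Fin (suc (suc n))) (k : Fin (suc n)) (σ : Permutation′ n) where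

      private
        ρ = Perm.insert zero k σ
        π = Perm.insert zero j ρ

        w : List ℕ
        w = letters (λ i → punchIn j (ρ ⟨$⟩ʳ suc i))

        a b : ℕ
        a = suc (toℕ j)
        b = suc (toℕ (punchIn j k))

        wt-tail : wt (b ∷ w) ≡ wt (word ρ)
        wt-tail = wt-punchIn j (ρ ⟨$⟩ʳ_)

        wt⁺-tail : wt⁺ (b ∷ w) ≡ wt⁺ (word ρ)
        wt⁺-tail = wt⁺-punchIn j (ρ ⟨$⟩ʳ_)

      -- A descent gives T wt and an ascent c wt + s wt⁺. Since c = T - s u, both cases share the
      -- term T wt, and the rest is carried by the ascent indicator alone.
      wt-insert : wt (word π) ≈ (T + χ j k * - (s * u)) * wt (word ρ) + χ j k * s * wt⁺ (word ρ)
      wt-insert with χ-spec j k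
      ... | inj₁ (a<b , e) rewrite e = begin
        wt (a ∷ b ∷ w)                          ≈⟨ wt-ascent w (s≤s a<b) ⟩
        s * wt⁺ (b ∷ w) + c * wt (b ∷ w)        ≡⟨ ≡.cong₂ (λ x y → s * x + c * y) wt⁺-tail wt-tail ⟩
        s * wt⁺ (word ρ) + c * wt (word ρ)
          ≈⟨ solve 5 (λ s c u x y → s :* x :+ c :* y := (s :* u :+ c :+ :1 :* :- (s :* u)) :* y :+ :1 :* s :* x)
               refl s c u (wt⁺ (word ρ)) (wt (word ρ)) ⟩
        (s * u + c + 1# * - (s * u)) * wt (word ρ) + 1# * s * wt⁺ (word ρ)
          ≈⟨ +-congʳ (*-congʳ (+-congʳ T≈su+c)) ⟨
        (T + 1# * - (s * u)) * wt (word ρ) + 1# * s * wt⁺ (word ρ) ∎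
      ... | inj₂ (b<a , e) rewrite e = begin
        wt (a ∷ b ∷ w)           ≈⟨ wt-descent w (s≤s b<a) ⟩
        T * wt (b ∷ w)           ≡⟨ ≡.cong (T *_) wt-tail ⟩
        T * wt (word ρ)
          ≈⟨ solve 5 (λ t s u x y → t :* y := (t :+ :0 :* :- (s :* u)) :* y :+ :0 :* s :* x)
               refl T s u (wt⁺ (word ρ)) (wt (word ρ)) ⟩
        (T + 0# * - (s * u)) * wt (word ρ) + 0# * s * wt⁺ (word ρ) ∎

      -- The term c wt is common to ascents and descents; only s wt⁺ depends on the comparison.
      wt⁺-insert : wt⁺ (word π) ≈ c * wt (word ρ) + χ j k * s * wt⁺ (word ρ)
      wt⁺-insert with χ-spec j k
      ... | inj₁ (a<b , e) rewrite e = begin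
        wt⁺ (a ∷ b ∷ w)                         ≈⟨ wt⁺-ascent w (s≤s a<b) ⟩
        s * wt⁺ (b ∷ w) + c * wt (b ∷ w)        ≡⟨ ≡.cong₂ (λ x y → s * x + c * y) wt⁺-tail wt-tail ⟩
        s * wt⁺ (word ρ) + c * wt (word ρ)
          ≈⟨ solve 4 (λ s c x y → s :* x :+ c :* y := c :* y :+ :1 :* s :* x)
               refl s c (wt⁺ (word ρ)) (wt (word ρ)) ⟩
        c * wt (word ρ) + 1# * s * wt⁺ (word ρ) ∎
      ... | inj₂ (b<a , e) rewrite e = begin
        wt⁺ (a ∷ b ∷ w)          ≈⟨ wt⁺-descent w (s≤s b<a) ⟩
        c * wt (b ∷ w)           ≡⟨ ≡.cong (c *_) wt-tail ⟩
        c * wt (word ρ)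
          ≈⟨ solve 4 (λ c s x y → c :* y := c :* y :+ :0 :* s :* x) refl c s (wt⁺ (word ρ)) (wt (word ρ)) ⟩
        c * wt (word ρ) + 0# * s * wt⁺ (word ρ) ∎

    byFirst : (List ℕ → Carrier) → ∀ n → Fin n → Carrier
    byFirst f (suc n) j =
      ∑ᴸ (λ ρ → q ^ inv (Perm.insert zero j ρ) * f (word (Perm.insert zero j ρ))) (permutations n)

    -- Removing the first letter j removes toℕ j inversions and leaves a permutation with first
    -- letter k. The coefficients α and β may depend on j and k, which covers `wt` and `wt⁺`
    -- together.
    byFirst-step : ∀ f (α β : ∀ {n} → Fin (suc (suc n)) → Fin (suc n) → Carrier) →
      (∀ {n} j k (σ : Permutation′ n) → f (word (Perm.insert zero j (Perm.insert zero k σ))) ≈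
        α j k * wt (word (Perm.insert zero k σ)) + β j k * wt⁺ (word (Perm.insert zero k σ))) →
      ∀ n j → byFirst f (suc (suc n)) j ≈
              q ^ toℕ j * ∑[ k < suc n ] (α j k * byFirst wt (suc n) k + β j k * byFirst wt⁺ (suc n) k)
    byFirst-step f α β f-insert n j = begin
      byFirst f (suc (suc n)) j
        ≈⟨ ∑ᴸ-permutations n _ ⟩
      ∑[ k < suc n ] ∑ᴸ (λ σ → q ^ inv (ins² k σ) * f (word (ins² k σ))) (permutations n)
        ≈⟨ sum-cong-≋ {suc n} (λ k → trans (∑ᴸ-cong (term k) (permutations n)) (trans
             (∑ᴸ-scale (q ^ toℕ j) (λ σ → α j k * g wt k σ + β j k * g wt⁺ k σ) (permutations n))
             (*-congˡ (∑ᴸ-linear (α j k) (β j k) (g wt k) (g wt⁺ k) (permutations n))))) ⟩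
      ∑[ k < suc n ] (q ^ toℕ j * (α j k * byFirst wt (suc n) k + β j k * byFirst wt⁺ (suc n) k))
        ≈⟨ *-distribˡ-sum {suc n} (q ^ toℕ j)
             (λ k → α j k * byFirst wt (suc n) k + β j k * byFirst wt⁺ (suc n) k) ⟨
      q ^ toℕ j * ∑[ k < suc n ] (α j k * byFirst wt (suc n) k + β j k * byFirst wt⁺ (suc n) k) ∎
      where
      ins² : Fin (suc n) → Permutation′ n → Permutation′ (suc (suc n))
      ins² k σ = Perm.insert zero j (Perm.insert zero k σ)

      g : (List ℕ → Carrier) → Fin (suc n) → Permutation′ n → Carrier
      g h k σ = q ^ inv (Perm.insert zero k σ) * h (word (Perm.insert zero k σ))

      term : ∀ k σ → q ^ inv (ins² k σ) * f (word (ins² k σ)) ≈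
                     q ^ toℕ j * (α j k * g wt k σ + β j k * g wt⁺ k σ)
      term k σ = trans
        (*-cong (trans (reflexive (≡.cong (q ^_) (inv-insert j (Perm.insert zero k σ))))
                       (^-homo-* q (toℕ j) (inv (Perm.insert zero k σ))))
                (f-insert j k σ))
        (solve 6 (λ e i α x β y → e :* i :* (α :* x :+ β :* y) := e :* (α :* (i :* x) :+ β :* (i :* y)))
          refl (q ^ toℕ j) (q ^ inv (Perm.insert zero k σ)) (α j k) (wt (word (Perm.insert zero k σ)))
          (β j k) (wt⁺ (word (Perm.insert zero k σ))))

    P-total : ∀ n → P (suc n) Y T ≈ c * (1# + s * u) * sum (byFirst wt (suc n))
    P-total n = begin
      P (suc n) Y T
        ≈⟨ ∑ᴸ-cong term (permutations (suc n)) ⟩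
      ∑ᴸ (λ π → Y * T * (q ^ inv π * wt (word π))) (permutations (suc n))
        ≈⟨ ∑ᴸ-scale (Y * T) (λ π → q ^ inv π * wt (word π)) (permutations (suc n)) ⟩
      Y * T * ∑ᴸ (λ π → q ^ inv π * wt (word π)) (permutations (suc n))
        ≈⟨ *-cong YT≈c[1+su] (∑ᴸ-permutations n _) ⟩
      c * (1# + s * u) * sum (byFirst wt (suc n)) ∎
      where
      term : ∀ (π : Permutation′ (suc n)) →
             q ^ inv π * Y ^ (pk π ℕ.+ 1) * T ^ (des π ℕ.+ 1) ≈ Y * T * (q ^ inv π * wt (word π))
      term π = trans (*-cong (*-congˡ (^-homo-* Y (pk π) 1)) (^-homo-* T (des π) 1))
        (solve 5 (λ i a y b t → i :* (a :* (y :* :1)) :* (b :* (t :* :1)) := y :* t :* (i :* (b :* a)))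
          refl (q ^ inv π) (Y ^ pk π) Y (T ^ des π) T)

-- The generating function in terms of u, v and d.

module GeneratingFunction {c ℓ} (R : CommutativeRing c ℓ) (q : CommutativeRing.Carrier R)
  (1/[_]! : ℕ → CommutativeRing.Carrier R) ([n]!*1/[n]!≈1 : InverseFactorials R q 1/[_]!) where

  open CommutativeRing R hiding (zero)
  open QAnalogues R q
  open Exp semiring using (_^_)
  open Sum semiring
  open QExponentials R q 1/[_]!
  open PowerSeries R using (Series; coeff; at; const)
  open PowerSeries R using () renaming (commutativeRing to seriesRing)
  private module S = CommutativeRing seriesRing
  open IntegerSolver R
  open Convolution R
  open QCalculus R q 1/[_]! [n]!*1/[n]!≈1
  private
    module ≈-Reasoning where
      open import Relation.Binary.Reasoning.Setoid setoid public
    module ≈ₛ-Reasoning where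
      open import Relation.Binary.Reasoning.Setoid S.setoid public

  module Parameters (u v d T Y : Carrier) (d[1+uv]≈1 : d * (1# + u * v) ≈ 1#)
    (T≈d[u+v] : T ≈ d * (u + v)) (YT≈v[1+u]²d² : Y * T ≈ v * (1# + u) ^ 2 * d ^ 2) where

    s c′ : Carrier
    s  = (1# - v) * d
    c′ = v * (1# + u) * d

    private
      s+c≈1 : s + c′ ≈ 1#
      s+c≈1 = trans (solve 3 (λ u v d → (:1 :- v) :* d :+ v :* (:1 :+ u) :* d := d :* (:1 :+ u :* v)) refl u v d)
        d[1+uv]≈1

      T≈su+c : T ≈ s * u + c′
      T≈su+c = trans T≈d[u+v]
        (solve 3 (λ u v d → d :* (u :+ v) := (:1 :- v) :* d :* u :+ v :* (:1 :+ u) :* d) refl u v d)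

      1+su≈d[1+u] : 1# + s * u ≈ d * (1# + u)
      1+su≈d[1+u] = trans (+-congʳ (sym d[1+uv]≈1))
        (solve 3 (λ u v d → d :* (:1 :+ u :* v) :+ (:1 :- v) :* d :* u := d :* (:1 :+ u)) refl u v d)

      YT≈c[1+su] : Y * T ≈ c′ * (1# + s * u)
      YT≈c[1+su] = trans YT≈v[1+u]²d² (trans
        (solve 3 (λ u v d → v :* ((:1 :+ u) :* ((:1 :+ u) :* :1)) :* (d :* (d :* :1)) :=
          v :* (:1 :+ u) :* d :* (d :* (:1 :+ u))) refl u v d)
        (*-congˡ (sym 1+su≈d[1+u])))

    open FirstLetterRecursion R q using (module Weights)
    open Weights s c′ u T Y s+c≈1 T≈su+c YT≈c[1+su]

    A B : ∀ n → Fin n → Carrier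
    A = byFirst wt
    B = byFirst wt⁺

    -- The ascent indicator is the kernel of `U`, up to the factor q^j from the inversions of the
    -- first letter.
    U-χ : ∀ {n} (X : Fin n → Carrier) j → U X j ≈ q ^ toℕ j * ∑[ k < n ] (χ j k * X k)
    U-χ {n}     X zero    = sym (trans (*-identityˡ _) (sum-cong-≋ {n} λ k → *-identityˡ (X k)))
    U-χ {suc n} X (suc j) = trans (*-congˡ (U-χ (X ∘ suc) j))
      (solve 4 (λ q e x t → q :* (e :* t) := q :* e :* (:0 :* x :+ t)) refl
        q (q ^ toℕ j) (X zero) (∑[ k < n ] (χ j k * X (suc k))))

    -- The part of the coefficients that is independent of the comparison yields the rank one term,
    -- a multiple of (q^j)ⱼ; the parts with `χ` become applications of `U`.
    byFirst-U : ∀ f a₀ a₁ b →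
      (∀ {n} j k (σ : Permutation′ n) → f (word (Perm.insert zero j (Perm.insert zero k σ))) ≈
        (a₀ + χ j k * a₁) * wt (word (Perm.insert zero k σ)) + χ j k * b * wt⁺ (word (Perm.insert zero k σ))) →
      ∀ n j → byFirst f (suc (suc n)) j ≈
        a₀ * sum (A (suc n)) * q ^ toℕ j + (b * U (B (suc n)) j + a₁ * U (A (suc n)) j)
    byFirst-U f a₀ a₁ b f-insert n j = begin
      byFirst f (suc (suc n)) j
        ≈⟨ byFirst-step f (λ j k → a₀ + χ j k * a₁) (λ j k → χ j k * b) f-insert n j ⟩
      q ^ toℕ j * ∑[ k < suc n ] ((a₀ + χ j k * a₁) * A′ k + χ j k * b * B′ k)
        ≈⟨ *-congˡ (sum-cong-≋ {suc n} λ k →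
             solve 6 (λ a₀ a₁ b x y z → (a₀ :+ x :* a₁) :* y :+ x :* b :* z := a₀ :* y :+ (b :* (x :* z) :+ a₁ :* (x :* y)))
               refl a₀ a₁ b (χ j k) (A′ k) (B′ k)) ⟩
      q ^ toℕ j * ∑[ k < suc n ] (a₀ * A′ k + (b * (χ j k * B′ k) + a₁ * (χ j k * A′ k)))
        ≈⟨ *-congˡ (trans (∑-distrib-+ {suc n} (λ k → a₀ * A′ k) (λ k → b * (χ j k * B′ k) + a₁ * (χ j k * A′ k)))
             (+-cong (sym (*-distribˡ-sum {suc n} a₀ A′))
               (trans (∑-distrib-+ {suc n} (λ k → b * (χ j k * B′ k)) (λ k → a₁ * (χ j k * A′ k)))
                 (+-cong (sym (*-distribˡ-sum {suc n} b (λ k → χ j k * B′ k)))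
                         (sym (*-distribˡ-sum {suc n} a₁ (λ k → χ j k * A′ k))))))) ⟩
      q ^ toℕ j * (a₀ * sum A′ + (b * ∑[ k < suc n ] (χ j k * B′ k) + a₁ * ∑[ k < suc n ] (χ j k * A′ k)))
        ≈⟨ solve 7 (λ e a₀ t b x a₁ y → e :* (a₀ :* t :+ (b :* x :+ a₁ :* y)) :=
             a₀ :* t :* e :+ (b :* (e :* x) :+ a₁ :* (e :* y)))
             refl (q ^ toℕ j) a₀ (sum A′) b (∑[ k < suc n ] (χ j k * B′ k)) a₁ (∑[ k < suc n ] (χ j k * A′ k)) ⟩
      a₀ * sum A′ * q ^ toℕ j + (b * (q ^ toℕ j * ∑[ k < suc n ] (χ j k * B′ k)) +
                                 a₁ * (q ^ toℕ j * ∑[ k < suc n ] (χ j k * A′ k)))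
        ≈⟨ +-congˡ (+-cong (*-congˡ (U-χ B′ j)) (*-congˡ (U-χ A′ j))) ⟨
      a₀ * sum A′ * q ^ toℕ j + (b * U B′ j + a₁ * U A′ j) ∎
      where
      open ≈-Reasoning
      A′ B′ : Fin (suc n) → Carrier
      A′ = A (suc n)
      B′ = B (suc n)

    -- The coefficients of 1 + c Â. The value 1 at 0 makes both recurrences below start correctly
    -- from the empty word, where the totals vanish.
    G : ℕ → Carrier
    G zero    = 1#
    G (suc n) = c′ * sum (A (suc n))

    -- T = s u + c splits the rank one term, and c times the total of A is the value of `G`.
    A-step : ∀ n j → A (suc n) j ≈
             (G n + s * u * sum (A n)) * q ^ toℕ j + (s * U (B n) j + - (s * u) * U (A n) j)
    A-step zero zero = solve 2 (λ s u → :1 :* (:1 :* :1) :+ :0 :=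
      (:1 :+ s :* u :* :0) :* :1 :+ (s :* :0 :+ (:- (s :* u)) :* :0)) refl s u
    A-step (suc n) j = trans (byFirst-U wt T (- (s * u)) s wt-insert n j)
      (+-congʳ (*-congʳ (trans (*-congʳ T≈su+c)
        (solve 4 (λ s u c t → (s :* u :+ c) :* t := c :* t :+ s :* u :* t) refl s u c′ (sum (A (suc n)))))))

    B-step : ∀ n j → B (suc n) j ≈ G n * q ^ toℕ j + s * U (B n) j
    B-step zero zero = solve 1 (λ s → :1 :* :1 :+ :0 := :1 :* :1 :+ s :* :0) refl s
    B-step (suc n) j = trans
      -- The coefficient of `wt` in `wt⁺-insert` is c for ascents and descents alike, so no U A
      -- occurs.
      (byFirst-U wt⁺ c′ 0# s (λ j k σ → trans (wt⁺-insert j k σ)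
        (+-congʳ (*-congʳ (solve 2 (λ c x → c := c :+ x :* :0) refl c′ (χ j k))))) n j)
      (solve 3 (λ a b x → a :+ (b :+ :0 :* x) := a :+ b) refl
        (G (suc n) * q ^ toℕ j) (s * U (B (suc n)) j) (U (A (suc n)) j))

    -- A and B form a triangular system under U, with second eigenvector (1 + u) A − B
    -- of eigenvalue − s u; K is that eigenvector divided by u.
    K : ∀ n → Fin n → Carrier
    κ : ℕ → Carrier
    K (suc n) j = κ n * q ^ toℕ j + - (s * u) * U (K n) j
    κ n = s * sum (B n) + G n + s * u * sum (K n)

    -- Since u need not be invertible, `K` is introduced by its recurrence, and induction on n
    -- identifies u K with (1 + u) A - B.
    [1+u]A≈B+uK : ∀ n j → (1# + u) * A n j ≈ B n j + u * K n j
    [1+u]A≈B+uK (suc n) j = begin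
      (1# + u) * A (suc n) j
        ≈⟨ *-congˡ (A-step n j) ⟩
      (1# + u) * ((G n + s * u * sum (A n)) * e + (s * U (B n) j + - (s * u) * U (A n) j))
        ≈⟨ solve 7 (λ s u g t e x y →
             (:1 :+ u) :* ((g :+ s :* u :* t) :* e :+ (s :* x :+ (:- (s :* u)) :* y)) :=
             (:1 :+ u) :* g :* e :+ s :* u :* e :* ((:1 :+ u) :* t) :+ ((:1 :+ u) :* s :* x :- s :* u :* ((:1 :+ u) :* y)))
             refl s u (G n) (sum (A n)) e (U (B n) j) (U (A n) j) ⟩
      (1# + u) * G n * e + s * u * e * ((1# + u) * sum (A n)) +
      ((1# + u) * s * U (B n) j - s * u * ((1# + u) * U (A n) j))
        -- `U X zero` is by definition the total of X, so the relation between the totals is an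
        -- instance of `U-relation`.
        ≈⟨ +-cong (+-congˡ (*-congˡ (U-relation zero))) (+-congˡ (-‿cong (*-congˡ (U-relation j)))) ⟩
      (1# + u) * G n * e + s * u * e * (sum (B n) + u * sum (K n)) +
      ((1# + u) * s * U (B n) j - s * u * (U (B n) j + u * U (K n) j))
        ≈⟨ solve 8 (λ s u g e b k x y →
             (:1 :+ u) :* g :* e :+ s :* u :* e :* (b :+ u :* k) :+ ((:1 :+ u) :* s :* x :- s :* u :* (x :+ u :* y)) :=
             g :* e :+ s :* x :+ u :* ((s :* b :+ g :+ s :* u :* k) :* e :+ (:- (s :* u)) :* y))
             refl s u (G n) e (sum (B n)) (sum (K n)) (U (B n) j) (U (K n) j) ⟩
      G n * e + s * U (B n) j + u * K (suc n) j
        ≈⟨ +-congʳ (B-step n j) ⟨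
      B (suc n) j + u * K (suc n) j ∎
      where
      open ≈-Reasoning
      e = q ^ toℕ j

      U-relation : ∀ j → (1# + u) * U (A n) j ≈ U (B n) j + u * U (K n) j
      U-relation j = begin
        (1# + u) * U (A n) j
          ≈⟨ solve 2 (λ a x → a :* x := a :* x :+ :0 :* x) refl (1# + u) (U (A n) j) ⟩
        (1# + u) * U (A n) j + 0# * U (A n) j
          ≈⟨ U-linear (1# + u) 0# (A n) (A n) j ⟨
        U (λ k → (1# + u) * A n k + 0# * A n k) j
          ≈⟨ U-cong (λ k → trans (+-cong ([1+u]A≈B+uK n k) (zeroˡ _))
               (solve 3 (λ b u k → b :+ u :* k :+ :0 := :1 :* b :+ u :* k) refl (B n k) u (K n k))) j ⟩
        U (λ k → 1# * B n k + u * K n k) j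
          ≈⟨ U-linear 1# u (B n) (K n) j ⟩
        1# * U (B n) j + u * U (K n) j
          ≈⟨ +-congʳ (*-identityˡ _) ⟩
        U (B n) j + u * U (K n) j ∎

    private
      Ĝ Â B̂ K̂ e f E : Series
      Ĝ = egf G
      Â = egf (total A)
      B̂ = egf (total B)
      K̂ = egf (total K)
      e = exp-q s
      f = exp-q (- (s * u))
      E = Exp-q (s * u)

      module T-B = Transfer s G B B-step
      module T-K = Transfer (- (s * u)) κ K (λ n j → refl)

      Ĝ≈1+cÂ : Ĝ S.≈ S.1# S.+ const c′ S.* Â
      at Ĝ≈1+cÂ zero = trans (trans (*-congˡ 1/[0]!≈1) (*-identityˡ 1#))
        (solve 2 (λ c i → :1 := :1 :+ (c :* (:0 :* i) :+ :0)) refl c′ 1/[ 0 ]!)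
      at Ĝ≈1+cÂ (suc n) = trans (*-assoc _ _ _) (trans
        (sym (const-convolution c′ (coeff Â) (suc n))) (sym (+-identityˡ _)))

      κ̂≈ : egf κ S.≈ const s S.* B̂ S.+ Ĝ S.+ const (s * u) S.* K̂
      at κ̂≈ n = trans
        (solve 5 (λ s b g r i → (s :* b :+ g :+ r) :* i := s :* (b :* i) :+ g :* i :+ r :* i)
          refl s (sum (B n)) (G n) (s * u * sum (K n)) 1/[ n ]!)
        (+-cong (+-congʳ (sym (const-convolution s (coeff B̂) n)))
          (trans (*-assoc _ _ _) (sym (const-convolution (s * u) (coeff K̂) n))))

      [1+u]Â≈B̂+uK̂ : const (1# + u) S.* Â S.≈ B̂ S.+ const u S.* K̂
      at [1+u]Â≈B̂+uK̂ n = begin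
        coeff (const (1# + u) S.* Â) n              ≈⟨ const-convolution (1# + u) (coeff Â) n ⟩
        (1# + u) * (sum (A n) * 1/[ n ]!)           ≈⟨ *-assoc _ _ _ ⟨
        (1# + u) * sum (A n) * 1/[ n ]!
          ≈⟨ *-congʳ (trans (*-distribˡ-sum {n} (1# + u) (A n)) (trans (sum-cong-≋ {n} ([1+u]A≈B+uK n))
               (trans (∑-distrib-+ {n} (B n) (λ j → u * K n j)) (+-congˡ (sym (*-distribˡ-sum {n} u (K n))))))) ⟩
        (sum (B n) + u * sum (K n)) * 1/[ n ]!
          ≈⟨ solve 4 (λ b u k i → (b :+ u :* k) :* i := b :* i :+ u :* (k :* i)) refl (sum (B n)) u (sum (K n)) 1/[ n ]! ⟩
        sum (B n) * 1/[ n ]! + u * (sum (K n) * 1/[ n ]!)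
          ≈⟨ +-congˡ (const-convolution u (coeff K̂) n) ⟨
        coeff (B̂ S.+ const u S.* K̂) n ∎
        where open ≈-Reasoning

      open IntegerSolver seriesRing using () renaming
        (solve to solveₛ; _:*_ to _⊗_; _:=_ to _⊜_; _:+_ to _⊕_; _:-_ to _⊖_; :1 to ⊤; :-_ to ⊝_)
      N : Series
      N = const (s * u) S.* K̂

      -- The transfer identity for B is s B̂ = (e - 1) Ĝ, so s B̂ + Ĝ = e Ĝ.
      κ̂≈eĜ+N : egf κ S.≈ e S.* Ĝ S.+ N
      κ̂≈eĜ+N = S.trans κ̂≈ (S.+-congʳ (S.trans (S.+-congʳ T-B.egf-total)
        (solveₛ 2 (λ e g → (e ⊖ ⊤) ⊗ g ⊕ g ⊜ e ⊗ g) S.refl e Ĝ)))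

      -- The transfer identity for K is - N = (f - 1) κ̂; subtracting N from κ̂ = e Ĝ + N thus
      -- amounts to multiplying κ̂ by f.
      f[eĜ+N]≈eĜ : f S.* (e S.* Ĝ S.+ N) S.≈ e S.* Ĝ
      f[eĜ+N]≈eĜ = begin
        f S.* (e S.* Ĝ S.+ N)
          ≈⟨ solveₛ 3 (λ f x n → f ⊗ (x ⊕ n) ⊜ (f ⊖ ⊤) ⊗ (x ⊕ n) ⊕ (x ⊕ n)) S.refl f (e S.* Ĝ) N ⟩
        (f S.- S.1#) S.* (e S.* Ĝ S.+ N) S.+ (e S.* Ĝ S.+ N)
          ≈⟨ S.+-congʳ (S.*-congˡ κ̂≈eĜ+N) ⟨
        (f S.- S.1#) S.* egf κ S.+ (e S.* Ĝ S.+ N)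
          ≈⟨ S.+-congʳ T-K.egf-total ⟨
        const (- (s * u)) S.* K̂ S.+ (e S.* Ĝ S.+ N)
          ≈⟨ S.+-congʳ (S.*-congʳ (const-neg (s * u))) ⟩
        (S.- const (s * u)) S.* K̂ S.+ (e S.* Ĝ S.+ N)
          ≈⟨ solveₛ 3 (λ a k x → (⊝ a) ⊗ k ⊕ (x ⊕ a ⊗ k) ⊜ x) S.refl (const (s * u)) K̂ (e S.* Ĝ) ⟩
        e S.* Ĝ ∎
        where open ≈ₛ-Reasoning

      -- E is the inverse of f, so multiplying the previous relation by E solves it for e Ĝ + N.
      EeĜ≈eĜ+N : E S.* e S.* Ĝ S.≈ e S.* Ĝ S.+ N
      EeĜ≈eĜ+N = begin
        E S.* e S.* Ĝ                          ≈⟨ S.*-assoc E e Ĝ ⟩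
        E S.* (e S.* Ĝ)                        ≈⟨ S.*-congˡ f[eĜ+N]≈eĜ ⟨
        E S.* (f S.* (e S.* Ĝ S.+ N))          ≈⟨ S.*-assoc E f _ ⟨
        E S.* f S.* (e S.* Ĝ S.+ N)            ≈⟨ S.*-congʳ (Exp*exp≈1 (-‿inverseʳ (s * u))) ⟩
        S.1# S.* (e S.* Ĝ S.+ N)               ≈⟨ S.*-identityˡ _ ⟩
        e S.* Ĝ S.+ N                          ∎
        where open ≈ₛ-Reasoning

      -- Both transfer series are traded back for Â: (e - 1) Ĝ is s B̂, and B̂ + u K̂ is (1 + u) Â.
      eĜ+N≈Ĝ+s[1+u]Â : e S.* Ĝ S.+ N S.≈ Ĝ S.+ const s S.* (const (1# + u) S.* Â)
      eĜ+N≈Ĝ+s[1+u]Â = begin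
        e S.* Ĝ S.+ N
          ≈⟨ S.+-congˡ (S.*-congʳ (const-* s u)) ⟩
        e S.* Ĝ S.+ const s S.* const u S.* K̂
          ≈⟨ solveₛ 5 (λ e g s u k → e ⊗ g ⊕ s ⊗ u ⊗ k ⊜ g ⊕ ((e ⊖ ⊤) ⊗ g ⊕ s ⊗ (u ⊗ k))) S.refl e Ĝ (const s) (const u) K̂ ⟩
        Ĝ S.+ ((e S.- S.1#) S.* Ĝ S.+ const s S.* (const u S.* K̂))
          ≈⟨ S.+-congˡ (S.+-congʳ T-B.egf-total) ⟨
        Ĝ S.+ (const s S.* B̂ S.+ const s S.* (const u S.* K̂))
          ≈⟨ S.+-congˡ (S.distribˡ (const s) B̂ (const u S.* K̂)) ⟨
        Ĝ S.+ const s S.* (B̂ S.+ const u S.* K̂)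
          ≈⟨ S.+-congˡ (S.*-congˡ [1+u]Â≈B̂+uK̂) ⟨
        Ĝ S.+ const s S.* (const (1# + u) S.* Â) ∎
        where open ≈ₛ-Reasoning

      const-1-v : const (1# - v) S.≈ S.1# S.- const v
      const-1-v = S.trans (const-+ 1# (- v)) (S.+-congˡ (const-neg v))

      -- Both sides are v (1 - v)(1 + u) d. This makes Â cancel in `egf-G`.
      vs[1+u]≈c[1-v] : const v S.* (const s S.* (const (1# + u))) S.≈ const c′ S.* const (1# - v)
      vs[1+u]≈c[1-v] = begin
        const v S.* (const s S.* (const (1# + u)))   ≈⟨ S.*-congˡ (const-* s (1# + u)) ⟨
        const v S.* const (s * (1# + u))             ≈⟨ const-* v (s * (1# + u)) ⟨
        const (v * (s * (1# + u)))
          ≈⟨ const-cong (solve 3 (λ u v d →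
               v :* ((:1 :- v) :* d :* (:1 :+ u)) := v :* (:1 :+ u) :* d :* (:1 :- v)) refl u v d) ⟩
        const (c′ * (1# - v))                        ≈⟨ const-* c′ (1# - v) ⟩
        const c′ S.* const (1# - v)                  ∎
        where open ≈ₛ-Reasoning

    -- The left side becomes (1 - v) Ĝ - v s (1 + u) Â = (1 - v)(Ĝ - c Â), and Ĝ - c Â = 1.
    egf-G : (S.1# S.- const v S.* (Exp-q (s * u) S.* exp-q s)) S.* egf G S.≈ const (1# - v)
    egf-G = begin
      (S.1# S.- const v S.* (E S.* e)) S.* Ĝ
        ≈⟨ solveₛ 4 (λ v E e g → (⊤ ⊖ v ⊗ (E ⊗ e)) ⊗ g ⊜ g ⊖ v ⊗ (E ⊗ e ⊗ g)) S.refl (const v) E e Ĝ ⟩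
      Ĝ S.- const v S.* (E S.* e S.* Ĝ)
        ≈⟨ S.+-congˡ (S.-‿cong (S.*-congˡ (S.trans EeĜ≈eĜ+N eĜ+N≈Ĝ+s[1+u]Â))) ⟩
      Ĝ S.- const v S.* (Ĝ S.+ const s S.* (const (1# + u) S.* Â))
        ≈⟨ solveₛ 5 (λ v g s w a → g ⊖ v ⊗ (g ⊕ s ⊗ (w ⊗ a)) ⊜ (⊤ ⊖ v) ⊗ g ⊖ v ⊗ (s ⊗ w) ⊗ a)
             S.refl (const v) Ĝ (const s) (const (1# + u)) Â ⟩
      (S.1# S.- const v) S.* Ĝ S.- const v S.* (const s S.* const (1# + u)) S.* Â
        ≈⟨ S.+-cong (S.*-cong (S.sym const-1-v) Ĝ≈1+cÂ) (S.-‿cong (S.*-congʳ vs[1+u]≈c[1-v])) ⟩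
      const (1# - v) S.* (S.1# S.+ const c′ S.* Â) S.- const c′ S.* const (1# - v) S.* Â
        ≈⟨ solveₛ 3 (λ w c a → w ⊗ (⊤ ⊕ c ⊗ a) ⊖ c ⊗ w ⊗ a ⊜ w) S.refl (const (1# - v)) (const c′) Â ⟩
      const (1# - v) ∎
      where open ≈ₛ-Reasoning

    P-G : ∀ n → P (suc n) Y T ≈ d * (1# + u) * G (suc n)
    P-G n = trans (P-total n) (trans (*-congʳ (*-congˡ 1+su≈d[1+u]))
      (solve 3 (λ c w t → c :* w :* t := w :* (c :* t)) refl c′ (d * (1# + u)) (sum (A (suc n)))))

    ∑P≈d[1+u][G-1] : PowerSeries.∑≥1 R (λ n → P n Y T * 1/[ n ]!) S.≈ const (d * (1# + u)) S.* (egf G S.- S.1#)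
    at ∑P≈d[1+u][G-1] zero = sym (trans (const-convolution _ (coeff (egf G S.- S.1#)) 0)
      (trans (*-congˡ (trans (+-congʳ (trans (*-identityˡ _) 1/[0]!≈1)) (-‿inverseʳ 1#))) (zeroʳ _)))
    at ∑P≈d[1+u][G-1] (suc n) = trans (*-congʳ (P-G n))
      (trans (solve 3 (λ w g i → w :* g :* i := w :* (g :* i :- :0)) refl (d * (1# + u)) (G (suc n)) 1/[ suc n ]!)
        (sym (const-convolution _ (coeff (egf G S.- S.1#)) (suc n))))

-- Fixed points of quadratic operators on power series.

module QuadraticFixedPoint {c ℓ} (R : CommutativeRing c ℓ) where

  open CommutativeRing R hiding (zero)
  open Sum semiring
  open PowerSeries R using (Series; coeff; at; const; X)
  open PowerSeries R using () renaming (commutativeRing to seriesRing)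
  private module S = CommutativeRing seriesRing
  open Convolution R

  coeff-X*-zero : ∀ f → coeff (X S.* f) 0 ≈ 0#
  coeff-X*-zero f = trans (+-identityʳ _) (zeroˡ _)

  coeff-X*-suc : ∀ f n → coeff (X S.* f) (suc n) ≈ coeff f n
  coeff-X*-suc f n = trans (+-cong (zeroˡ _) (trans
    (convolution-cong {g = coeff f} tail-X (λ _ → refl) n)
    (const-convolution 1# (coeff f) n))) (trans (+-identityˡ _) (*-identityˡ _))
    where
    tail-X : ∀ n → coeff X (suc n) ≈ coeff (const 1#) n
    tail-X zero    = refl
    tail-X (suc n) = refl

  -- Congruence modulo X^n.
  _≈[_]_ : Series → ℕ → Series → Set ℓ
  f ≈[ n ] g = ∀ m → m ℕ.< n → coeff f m ≈ coeff g m

  +-cong-mod : ∀ {n f f′ g g′} → f ≈[ n ] f′ → g ≈[ n ] g′ → (f S.+ g) ≈[ n ] (f′ S.+ g′)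
  +-cong-mod p r m m<n = +-cong (p m m<n) (r m m<n)

  *-cong-mod : ∀ {n f f′ g g′} → f ≈[ n ] f′ → g ≈[ n ] g′ → (f S.* g) ≈[ n ] (f′ S.* g′)
  *-cong-mod {n} p r m m<n = sum-cong-≋ {suc m} λ k →
    *-cong (p (toℕ k) (ℕ.≤-<-trans (ℕ.≤-pred (toℕ<n k)) m<n)) (r (m ∸ toℕ k) (ℕ.≤-<-trans (ℕ.m∸n≤m m (toℕ k)) m<n))
    where open import Data.Fin.Properties using (toℕ<n)

  X*-cong-mod : ∀ {n f g} → f ≈[ n ] g → (X S.* f) ≈[ suc n ] (X S.* g)
  X*-cong-mod {f = f} {g} p zero    _         = trans (coeff-X*-zero f) (sym (coeff-X*-zero g))
  X*-cong-mod {f = f} {g} p (suc m) (s≤s m<n) =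
    trans (coeff-X*-suc f m) (trans (p m m<n) (sym (coeff-X*-suc g m)))

  module _ (α β γ : Series) where

    Φ : Series → Series
    Φ f = X S.* (α S.+ β S.* f S.+ γ S.* (f S.* f))

    -- The leading factor X gains one order of precision; the remaining operations preserve
    -- congruences.
    Φ-contractive : ∀ {n f g} → f ≈[ n ] g → Φ f ≈[ suc n ] Φ g
    Φ-contractive {n} {f} {g} p = X*-cong-mod {n} {α S.+ β S.* f S.+ γ S.* (f S.* f)} {α S.+ β S.* g S.+ γ S.* (g S.* g)}
      (+-cong-mod {n} {α S.+ β S.* f} {α S.+ β S.* g} {γ S.* (f S.* f)} {γ S.* (g S.* g)}
        (+-cong-mod {n} {α} {α} {β S.* f} {β S.* g} (λ _ _ → refl) (*-cong-mod {n} {β} {β} {f} {g} (λ _ _ → refl) p))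
        (*-cong-mod {n} {γ} {γ} {f S.* f} {g S.* g} (λ _ _ → refl) (*-cong-mod {n} {f} {g} {f} {g} p p)))

    iterate : ℕ → Series
    iterate zero    = S.0#
    iterate (suc k) = Φ (iterate k)

    iterate-stable : ∀ n a b → n ℕ.≤ a → n ℕ.≤ b → iterate a ≈[ n ] iterate b
    iterate-stable (suc n) (suc a) (suc b) (s≤s p) (s≤s r) =
      Φ-contractive {n} {iterate a} {iterate b} (iterate-stable n a b p r)

    -- The limit of the iterates: the coefficient of X^n no longer changes from iterate n + 1 on.
    fixedPoint : Series
    coeff fixedPoint n = coeff (iterate (suc n)) n

    fixedPoint-Φ : fixedPoint S.≈ Φ fixedPoint
    -- Iterate n agrees with the limit modulo X^n, so after one application of `Φ` they agree at X^n
    -- too.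
    at fixedPoint-Φ n = Φ-contractive {n} {iterate n} {fixedPoint}
      (λ m m<n → iterate-stable (suc m) n (suc m) m<n ℕ.≤-refl m ℕ.≤-refl) n ℕ.≤-refl

-- The square root and the series u and v: existence, relations and uniqueness.

module RootAndUV {c ℓ} (R : CommutativeRing c ℓ) (x : CommutativeRing.Carrier R) where

  open CommutativeRing R using () renaming (_≈_ to _≈ᶜ_; _+_ to _+ᶜ_; _*_ to _*ᶜ_; _-_ to _-ᶜ_; 0# to 0ᶜ; 1# to 1ᶜ)
  private module C = CommutativeRing R
  open PowerSeries R using (Series; coeff; at; const; X; recip; recip-inverse)
  open PowerSeries R using () renaming (commutativeRing to seriesRing)
  open CommutativeRing seriesRing hiding (zero)
  open Exp semiring using (_^_)
  open IntegerSolver seriesRing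
  open Convolution R
  open QuadraticFixedPoint R
  open GroupProperties +-group using () renaming (x∙y⁻¹≈ε⇒x≈y to x-y≈0⇒x≈y)
  open import Relation.Binary.Reasoning.Setoid setoid

  y t 2# 4# : Series
  y  = const x
  t  = X
  2# = 1# + 1#
  4# = 2# + 2#

  IsRoot IsU IsV : Series → Series → Set ℓ
  IsRoot r s = coeff s 0 ≈ᶜ 1ᶜ × s ^ 2 ≈ r
  IsU s u = 2# * (1# - y) * t * u ≈ 1# + t ^ 2 - 2# * y * t - (1# - t) * s
  IsV s v = 2# * y * t * v ≈ (1# + t) ^ 2 - 2# * y * t - (1# + t) * s

  radicand : Series
  radicand = (1# + t) ^ 2 - 4# * y * t

  -- For the root s this is (s - 1 - (1 - 2y) t) / (2 y (1 - y) t). As a fixed point it is obtained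
  -- without dividing by y, 1 - y or t.
  n : Series
  n = fixedPoint 1# (2# * y - 1#) (- (y * (1# - y)))

  -- n is a root of the quadratic ε, and s, u and v are affine in n. Each relation below is a
  -- polynomial identity in y, t and n up to an explicit multiple of ε.
  ε : Series
  ε = n - t * (1# + (2# * y - 1#) * n + - (y * (1# - y)) * (n * n))

  ε≈0 : ε ≈ 0#
  ε≈0 = trans (+-congʳ (fixedPoint-Φ 1# (2# * y - 1#) (- (y * (1# - y))))) (-‿inverseʳ _)

  drop-ε : ∀ {a} b c → a ≈ b + c * ε → a ≈ b
  drop-ε b c p = trans p (trans (+-congˡ (trans (*-congˡ ε≈0) (zeroʳ c))) (+-identityʳ b))

  s u v : Series
  s = 1# + t * (1# - 2# * y * (1# - (1# - y) * n))
  u = t - (1# - t) * y * n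
  v = t - (1# + t) * (1# - y) * n

  s-root : IsRoot radicand s
  s-root = C.trans (C.+-congˡ (coeff-X*-zero (1# - 2# * y * (1# - (1# - y) * n)))) (C.+-identityʳ 1ᶜ)
         , drop-ε radicand (4# * t * y * (1# - y))
    (solve 3 (λ y t n →
      let s = :1 :+ t :* (:1 :- (:1 :+ :1) :* y :* (:1 :- (:1 :- y) :* n))
          ε = n :- t :* (:1 :+ ((:1 :+ :1) :* y :- :1) :* n :+ (:- (y :* (:1 :- y))) :* (n :* n))
          :4 = :1 :+ :1 :+ (:1 :+ :1)
      in s :* (s :* :1) := (:1 :+ t) :* ((:1 :+ t) :* :1) :- :4 :* y :* t :+ :4 :* t :* y :* (:1 :- y) :* ε)
      refl y t n)

  -- Already a polynomial identity in y, t and n: with s affine in n, the numerator factors as 2 (1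
  -- - y) t times u.
  u-spec : IsU s u
  u-spec = solve 3 (λ y t n →
      let s = :1 :+ t :* (:1 :- (:1 :+ :1) :* y :* (:1 :- (:1 :- y) :* n))
      in (:1 :+ :1) :* (:1 :- y) :* t :* (t :- (:1 :- t) :* y :* n) :=
         :1 :+ t :* (t :* :1) :- (:1 :+ :1) :* y :* t :- (:1 :- t) :* s)
      refl y t n

  v-spec : IsV s v
  v-spec = solve 3 (λ y t n →
      let s = :1 :+ t :* (:1 :- (:1 :+ :1) :* y :* (:1 :- (:1 :- y) :* n))
      in (:1 :+ :1) :* y :* t :* (t :- (:1 :+ t) :* (:1 :- y) :* n) :=
         (:1 :+ t) :* ((:1 :+ t) :* :1) :- (:1 :+ :1) :* y :* t :- (:1 :+ t) :* s)
      refl y t n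

  -- The fixed point equation makes n, and with it v, divisible by t. Hence 1 + uv and 1 - v have
  -- constant term 1.
  coeff-v-zero : coeff v 0 ≈ᶜ 0ᶜ
  coeff-v-zero = C.trans (at v≈t* 0) (coeff-X*-zero (1# - (1# + t) * (1# - y) * w))
    where
    w = 1# + (2# * y - 1#) * n + - (y * (1# - y)) * (n * n)
    v≈t* : v ≈ t * (1# - (1# + t) * (1# - y) * w)
    v≈t* = trans (+-congˡ (-‿cong (*-congˡ (fixedPoint-Φ 1# (2# * y - 1#) (- (y * (1# - y)))))))
      (solve 3 (λ y t w → t :- (:1 :+ t) :* (:1 :- y) :* (t :* w) := t :* (:1 :- (:1 :+ t) :* (:1 :- y) :* w))
        refl y t w)

  t[1+uv]≈u+v : t * (1# + u * v) ≈ u + v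
  t[1+uv]≈u+v = drop-ε (u + v) (1# - t * t) (solve 3 (λ y t n →
      let u = t :- (:1 :- t) :* y :* n
          v = t :- (:1 :+ t) :* (:1 :- y) :* n
          ε = n :- t :* (:1 :+ ((:1 :+ :1) :* y :- :1) :* n :+ (:- (y :* (:1 :- y))) :* (n :* n))
      in t :* (:1 :+ u :* v) := u :+ v :+ (:1 :- t :* t) :* ε)
      refl y t n)

  v[1+u]²≈yt[1+uv]² : v * (1# + u) ^ 2 ≈ y * t * (1# + u * v) ^ 2
  v[1+u]²≈yt[1+uv]² = drop-ε (y * t * (1# + u * v) ^ 2)
    (2# * y * (1# - y) * n - (1# - 2# * y) - t * (2# + (1# - y) * u - y * v) - y * (1# + u * v) * (1# - t * t))
    (solve 3 (λ y t n →
      let u = t :- (:1 :- t) :* y :* n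
          v = t :- (:1 :+ t) :* (:1 :- y) :* n
          :2 = :1 :+ :1
          ε = n :- t :* (:1 :+ (:2 :* y :- :1) :* n :+ (:- (y :* (:1 :- y))) :* (n :* n))
      in v :* ((:1 :+ u) :* ((:1 :+ u) :* :1)) :=
         y :* t :* ((:1 :+ u :* v) :* ((:1 :+ u :* v) :* :1)) :+
         (:2 :* y :* (:1 :- y) :* n :- (:1 :- :2 :* y) :- t :* (:2 :+ (:1 :- y) :* u :- y :* v) :-
           y :* (:1 :+ u :* v) :* (:1 :- t :* t)) :* ε)
      refl y t n)

  -- The denominators 2 (1 - y) t and 2 y t are cancelled factor by factor: 2 is a unit, t shifts
  -- coefficients, and y and 1 - y cancel coefficientwise.
  module Uniqueness (½ : C.Carrier) (½*2≈1 : ½ *ᶜ (1ᶜ +ᶜ 1ᶜ) ≈ᶜ 1ᶜ)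
    (x-cancel : ∀ {a} → x *ᶜ a ≈ᶜ 0ᶜ → a ≈ᶜ 0ᶜ)
    (1-x-cancel : ∀ {a} → (1ᶜ -ᶜ x) *ᶜ a ≈ᶜ 0ᶜ → a ≈ᶜ 0ᶜ) where

    unit-cancel : ∀ c f {g} → c *ᶜ coeff f 0 ≈ᶜ 1ᶜ → f * g ≈ 0# → g ≈ 0#
    unit-cancel c f {g} p fg≈0 = begin
      g                    ≈⟨ *-identityˡ g ⟨
      1# * g               ≈⟨ *-congʳ (recip-inverse c f p) ⟨
      f * recip c f * g    ≈⟨ solve 3 (λ f r g → f :* r :* g := r :* (f :* g)) refl f (recip c f) g ⟩
      recip c f * (f * g)  ≈⟨ trans (*-congˡ fg≈0) (zeroʳ _) ⟩
      0#                   ∎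

    const-cancel : ∀ {a f} → (∀ {b} → a *ᶜ b ≈ᶜ 0ᶜ → b ≈ᶜ 0ᶜ) → const a * f ≈ 0# → f ≈ 0#
    at (const-cancel {a} {f} p af≈0) m = p (C.trans (C.sym (const-convolution a (coeff f) m)) (at af≈0 m))

    t-cancel : ∀ {f} → t * f ≈ 0# → f ≈ 0#
    at (t-cancel {f} p) m = C.trans (C.sym (coeff-X*-suc f m)) (at p (suc m))

    2-cancel : ∀ {f} → 2# * f ≈ 0# → f ≈ 0#
    2-cancel = unit-cancel ½ 2# ½*2≈1

    -- The product (s₁ + s₂)(s₁ - s₂) vanishes, and s₁ + s₂ is invertible because its constant term
    -- is 2.
    root-unique : ∀ {r s₁ s₂} → IsRoot r s₁ → IsRoot r s₂ → s₁ ≈ s₂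
    root-unique {r} {s₁} {s₂} (p₁ , q₁) (p₂ , q₂) = x-y≈0⇒x≈y s₁ s₂
      (unit-cancel ½ (s₁ + s₂) (C.trans (C.*-congˡ (C.+-cong p₁ p₂)) ½*2≈1) (begin
        (s₁ + s₂) * (s₁ - s₂)
          ≈⟨ solve 2 (λ a b → (a :+ b) :* (a :- b) := a :* (a :* :1) :- b :* (b :* :1)) refl s₁ s₂ ⟩
        s₁ ^ 2 - s₂ ^ 2
          ≈⟨ +-cong q₁ (-‿cong q₂) ⟩
        r - r
          ≈⟨ -‿inverseʳ r ⟩
        0# ∎))

    quotient-unique : ∀ {z a b w} → (∀ {f} → z * f ≈ 0# → f ≈ 0#) →
                      2# * z * t * a ≈ w → 2# * z * t * b ≈ w → a ≈ b
    quotient-unique {z} {a} {b} {w} z-cancel p r = x-y≈0⇒x≈y a b (t-cancel (z-cancel (2-cancel (begin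
      2# * (z * (t * (a - b)))
        ≈⟨ solve 5 (λ d z t a b → d :* (z :* (t :* (a :- b))) := d :* z :* t :* a :- d :* z :* t :* b) refl 2# z t a b ⟩
      2# * z * t * a - 2# * z * t * b
        ≈⟨ +-cong p (-‿cong r) ⟩
      w - w
        ≈⟨ -‿inverseʳ w ⟩
      0# ∎))))

    1-y≈const : 1# - y ≈ const (1ᶜ -ᶜ x)
    1-y≈const = sym (trans (const-+ 1ᶜ (C.- x)) (+-congˡ (const-neg x)))

    u-unique : ∀ {s₁ u₁} → s₁ ≈ s → IsU s₁ u₁ → u₁ ≈ u
    u-unique s₁≈s p = quotient-unique
      (λ eq → const-cancel 1-x-cancel (trans (*-congʳ (sym 1-y≈const)) eq))
      (trans p (+-congˡ (-‿cong (*-congˡ s₁≈s)))) u-spec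

    v-unique : ∀ {s₁ v₁} → s₁ ≈ s → IsV s₁ v₁ → v₁ ≈ v
    v-unique s₁≈s p = quotient-unique (const-cancel x-cancel)
      (trans p (+-congˡ (-‿cong (*-congˡ s₁≈s)))) v-spec

-- Ring homomorphisms, coefficientwise maps and embeddings of coefficient rings.

module Homomorphisms {c ℓ c′ ℓ′} (R : CommutativeRing c ℓ) (S : CommutativeRing c′ ℓ′) where

  private
    module R = CommutativeRing R
    module S = CommutativeRing S

  IsHomomorphism : (R.Carrier → S.Carrier) → Set _
  IsHomomorphism = IsRingHomomorphism R.rawRing S.rawRing

  -- In an additive group, preservation of 0 and of negatives follows from additivity.
  isHomomorphism : ∀ {h} → (∀ {a b} → a R.≈ b → h a S.≈ h b) →
                   (∀ a b → h (a R.+ b) S.≈ h a S.+ h b) → (∀ a b → h (a R.* b) S.≈ h a S.* h b) →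
                   h R.1# S.≈ S.1# → IsHomomorphism h
  isHomomorphism {h} h-cong h-+ h-* h-1 = record
    { isSemiringHomomorphism = record
      { isNearSemiringHomomorphism = record
        { +-isMonoidHomomorphism = record
          { isMagmaHomomorphism = record
            { isRelHomomorphism = record { cong = h-cong }
            ; homo = h-+
            }
          ; ε-homo = h-0
          }
        ; *-homo = h-*
        }
      ; 1#-homo = h-1
      }
    ; -‿homo = λ a → inverseˡ-unique (h (R.- a)) (h a)
        (S.trans (S.sym (h-+ (R.- a) a)) (S.trans (h-cong (R.-‿inverseˡ a)) h-0))
    }
    where
    open GroupProperties S.+-group using (identityˡ-unique; inverseˡ-unique)
    h-0 : h R.0# S.≈ S.0#
    h-0 = identityˡ-unique (h R.0#) (h R.0#)
      (S.trans (S.sym (h-+ R.0# R.0#)) (h-cong (R.+-identityʳ R.0#)))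

  module HomomorphismProperties {h : R.Carrier → S.Carrier} (h-hom : IsHomomorphism h) where

    open IsRingHomomorphism h-hom public
    private
      module Rs where
        open Sum R.semiring public
        open Exp R.semiring public
      module Ss where
        open Sum S.semiring public
        open Exp S.semiring public

    sum-homo : ∀ {n} (f : Fin n → R.Carrier) → h (Rs.sum f) S.≈ Ss.sum (h ∘ f)
    sum-homo {zero}  f = 0#-homo
    sum-homo {suc n} f = S.trans (+-homo _ _) (S.+-congˡ (sum-homo (f ∘ suc)))

    ^-homo : ∀ a n → h (a Rs.^ n) S.≈ h a Ss.^ n
    ^-homo a zero    = 1#-homo
    ^-homo a (suc n) = S.trans (*-homo _ _) (S.*-congˡ (^-homo a n))

    [n]!-homo : ∀ q n → h (QAnalogues.[_]! R q n) S.≈ QAnalogues.[_]! S (h q) n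
    [n]!-homo q zero    = 1#-homo
    [n]!-homo q (suc n) = S.trans (*-homo _ _) (S.*-cong ([n]!-homo q n)
      (S.trans (sum-homo {suc n} (λ i → q Rs.^ toℕ i)) (Ss.sum-cong-≋ {suc n} λ i → ^-homo q (toℕ i))))

  module _ {h : R.Carrier → S.Carrier} (h-hom : IsHomomorphism h) where

    open HomomorphismProperties h-hom
    open MapCoefficients R S h
    private
      module RS = PowerSeries R
      module SS = PowerSeries S

    convolution-homo : ∀ f g n → h (RS.convolution f g n) S.≈ SS.convolution (h ∘ f) (h ∘ g) n
    convolution-homo f g n = S.trans (sum-homo {suc n} (λ k → f (toℕ k) R.* g (n ∸ toℕ k)))
      (Sum.sum-cong-≋ S.semiring {suc n} λ k → *-homo (f (toℕ k)) (g (n ∸ toℕ k)))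

    mapSeries-const : ∀ a → mapSeries (RS.const a) SS.≋ SS.const (h a)
    SS.at (mapSeries-const a) zero    = S.refl
    SS.at (mapSeries-const a) (suc n) = 0#-homo

    mapSeries-X : mapSeries RS.X SS.≋ SS.X
    SS.at mapSeries-X zero          = 0#-homo
    SS.at mapSeries-X (suc zero)    = 1#-homo
    SS.at mapSeries-X (suc (suc n)) = 0#-homo

    mapSeries-1 : mapSeries (RS.const R.1#) SS.≋ SS.const S.1#
    SS.at mapSeries-1 zero    = 1#-homo
    SS.at mapSeries-1 (suc n) = 0#-homo

module MapHomomorphisms {c ℓ c′ ℓ′} (R : CommutativeRing c ℓ) (S : CommutativeRing c′ ℓ′)
  {h : CommutativeRing.Carrier R → CommutativeRing.Carrier S} (h-hom : Homomorphisms.IsHomomorphism R S h) where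

  private
    module R = CommutativeRing R
    module S = CommutativeRing S
    module RS = PowerSeries R
    module SS = PowerSeries S
    module RP = Polynomials R
    module SP = Polynomials S
    module Series = Homomorphisms RS.commutativeRing SS.commutativeRing
    module Polynomial = Homomorphisms RP.commutativeRing SP.commutativeRing
    open Homomorphisms R S
    open HomomorphismProperties h-hom
  open MapCoefficients R S h

  mapSeries-isHomomorphism : Series.IsHomomorphism mapSeries
  mapSeries-isHomomorphism = Series.isHomomorphism
    (λ p → SS.pointwise λ n → ⟦⟧-cong (RS.at p n))
    (λ f g → SS.pointwise λ n → +-homo (RS.coeff f n) (RS.coeff g n))
    (λ f g → SS.pointwise (convolution-homo h-hom (RS.coeff f) (RS.coeff g)))
    (mapSeries-1 h-hom)

  mapPolynomial-isHomomorphism : (h-0 : ∀ {a} → a R.≈ R.0# → h a S.≈ S.0#) →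
    Polynomial.IsHomomorphism (mapPolynomial h-0)
  mapPolynomial-isHomomorphism h-0 = Polynomial.isHomomorphism
    (λ p → SP.pointwise (SM.⟦⟧-cong (RP.toSeries-≈ p)))
    (λ f g → SP.pointwise (SM.+-homo (RP.toSeries f) (RP.toSeries g)))
    (λ f g → SP.pointwise (SM.*-homo (RP.toSeries f) (RP.toSeries g)))
    (SP.pointwise (mapSeries-1 h-hom))
    where module SM = IsRingHomomorphism mapSeries-isHomomorphism

module Embeddings where

  seriesConst : ∀ {c ℓ} (R : CommutativeRing c ℓ) →
    Homomorphisms.IsHomomorphism R (PowerSeries.commutativeRing R) (PowerSeries.const R)
  seriesConst R = Homomorphisms.isHomomorphism R (PowerSeries.commutativeRing R)
    const-cong const-+ const-* (CommutativeRing.refl (PowerSeries.commutativeRing R))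
    where open Convolution R

  polynomialConst : ∀ {c ℓ} (R : CommutativeRing c ℓ) →
    Homomorphisms.IsHomomorphism R (Polynomials.commutativeRing R) (Polynomials.const R)
  polynomialConst R = Homomorphisms.isHomomorphism R (Polynomials.commutativeRing R)
    (λ p → pointwise (const-cong p)) (λ a b → pointwise (const-+ a b)) (λ a b → pointwise (const-* a b))
    (CommutativeRing.refl (Polynomials.commutativeRing R))
    where
    open Convolution R
    open Polynomials R using (pointwise)

  fractionEmbed : ∀ {c ℓ} (D : DiscreteDomain c ℓ) →
    Homomorphisms.IsHomomorphism (ringOf D) (Fractions.fractionRing D) (Fractions.embed D)
  fractionEmbed D = Homomorphisms.isHomomorphism (ringOf D) (Fractions.fractionRing D)
    (λ p → cross (*-congʳ p))
    (λ a b → cross (solve 2 (λ a b → (a :+ b) :* (:1 :* :1) := (a :* :1 :+ b :* :1) :* :1) refl a b))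
    (λ a b → cross (solve 2 (λ a b → a :* b :* (:1 :* :1) := a :* b :* :1) refl a b))
    (CommutativeRing.refl (Fractions.fractionRing D))
    where
    open DiscreteDomain D
    open Fractions D using (cross)
    open IntegerSolver (ringOf D)

-- Nonzero elements are detected by a homomorphism: below, the constant term in q, y and t.
module ConstantTerm {c ℓ c′ ℓ′} (D : DiscreteDomain c ℓ) (S : CommutativeRing c′ ℓ′)
  (1≉0 : ¬ CommutativeRing._≈_ S (CommutativeRing.1# S) (CommutativeRing.0# S))
  {h : DiscreteDomain.Carrier D → CommutativeRing.Carrier S}
  (h-hom : Homomorphisms.IsHomomorphism (ringOf D) S h) where

  private
    module D = DiscreteDomain D
    module S = CommutativeRing S
    module F = Fractions D
  open Homomorphisms.HomomorphismProperties (ringOf D) S h-hom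

  ≈1⇒≉0 : ∀ {a} → h a S.≈ S.1# → ¬ a D.≈ D.0#
  ≈1⇒≉0 ha≈1 a≈0 = 1≉0 (S.trans (S.sym ha≈1) (S.trans (⟦⟧-cong a≈0) 0#-homo))

  embed≉0 : ∀ {a} → ¬ a D.≈ D.0# → ¬ F.embed a F.≃ F.embed D.0#
  embed≉0 a≉0 p = a≉0 (D.trans (D.sym (D.*-identityʳ _)) (D.trans (F.uncross p) (D.*-identityʳ D.0#)))

  -- At q = 0 every factor 1 + q + ⋯ of the q-factorial becomes 1.
  [n]!≈1 : ∀ q → h q S.≈ S.0# → ∀ n → h (QAnalogues.[_]! (ringOf D) q n) S.≈ S.1#
  [n]!≈1 q hq≈0 n = S.trans ([n]!-homo q n) (lemma n)
    where
    open Sum S.semiring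
    lemma : ∀ n → QAnalogues.[_]! S (h q) n S.≈ S.1#
    lemma zero    = S.refl
    lemma (suc n) = S.trans (S.*-cong (lemma n) (S.trans (S.+-congˡ (S.trans
      (sum-cong-≋ {n} λ i → S.trans (S.*-congʳ hq≈0) (S.zeroˡ _)) (sum-replicate-zero n))) (S.+-identityʳ S.1#)))
      (S.*-identityˡ S.1#)

module Cancellation {c ℓ} (D : DiscreteDomain c ℓ) where

  open DiscreteDomain D

  -- `integral` only refutes; the decision whether b is zero turns it into a positive conclusion.
  cancel : ∀ {a b} → ¬ a ≈ 0# → a * b ≈ 0# → b ≈ 0#
  cancel {a} {b} a≉0 ab≈0 with b ≟0
  ... | yes b≈0 = b≈0
  ... | no  b≉0 = contradiction ab≈0 (integral a≉0 b≉0)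

-- The second identity over a general ring.

module ClosedForm {c ℓ} (R : CommutativeRing c ℓ) (q : CommutativeRing.Carrier R)
  (1/[_]! : ℕ → CommutativeRing.Carrier R) ([n]!*1/[n]!≈1 : InverseFactorials R q 1/[_]!) where

  open CommutativeRing R hiding (zero)
  open QAnalogues R q
  open Exp semiring using (_^_)
  open QExponentials R q 1/[_]!
  open PowerSeries R using (Series; coeff; const; recip; ∑≥1)
  open PowerSeries R using () renaming (commutativeRing to seriesRing)
  private
    module S = CommutativeRing seriesRing
    open import Relation.Binary.Reasoning.Setoid S.setoid
  open IntegerSolver R
  open IntegerSolver seriesRing using () renaming
    (solve to solveₛ; _:*_ to _⊗_; _:=_ to _⊜_; _:-_ to _⊖_; :1 to ⊤)
  open Convolution R
  open QCalculus R q 1/[_]! [n]!*1/[n]!≈1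

  module Parameters (u v d y t : Carrier) (d[1+uv]≈1 : d * (1# + u * v) ≈ 1#)
    (t[1+uv]≈u+v : t * (1# + u * v) ≈ u + v)
    (v[1+u]²≈yt[1+uv]² : v * (1# + u) ^ 2 ≈ y * t * (1# + u * v) ^ 2) where

    private
      t≈d[u+v] : t ≈ d * (u + v)
      t≈d[u+v] = trans (sym (*-identityʳ t)) (trans (*-congˡ (sym d[1+uv]≈1))
        (trans (solve 3 (λ t d g → t :* (d :* g) := d :* (t :* g)) refl t d (1# + u * v)) (*-congˡ t[1+uv]≈u+v)))

      yt≈v[1+u]²d² : y * t ≈ v * (1# + u) ^ 2 * d ^ 2
      yt≈v[1+u]²d² = trans
        (solve 1 (λ z → z := z :* (:1 :* :1)) refl (y * t))
        (trans (*-congˡ (*-cong (sym d[1+uv]≈1) (sym d[1+uv]≈1)))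
        (trans (solve 3 (λ z d g → z :* (d :* g :* (d :* g)) := z :* (g :* (g :* :1)) :* (d :* (d :* :1)))
                 refl (y * t) d (1# + u * v))
          (*-congʳ (sym v[1+u]²≈yt[1+uv]²))))

    open GeneratingFunction.Parameters R q 1/[_]! [n]!*1/[n]!≈1 u v d t y d[1+uv]≈1 t≈d[u+v] yt≈v[1+u]²d²

    E : Series
    E = Exp-q (u * (1# - v) * d) S.* exp-q ((1# - v) * d)

    coeff-denominator : coeff (S.1# S.- const v S.* E) 0 ≈ 1# - v
    coeff-denominator = +-congˡ (-‿cong (trans (+-identityʳ _)
      (trans (*-congˡ (coeff-Exp*exp-zero (u * (1# - v) * d) ((1# - v) * d))) (*-identityʳ v))))

    -- By `egf-G` the left side is (1 - v) - (1 - v E).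
    [1-vE][G-1]≈v[E-1] : (S.1# S.- const v S.* E) S.* (egf G S.- S.1#) S.≈ const v S.* (E S.- S.1#)
    [1-vE][G-1]≈v[E-1] = begin
      (S.1# S.- const v S.* E) S.* (egf G S.- S.1#)
        ≈⟨ solveₛ 2 (λ w g → w ⊗ (g ⊖ ⊤) ⊜ w ⊗ g ⊖ w) S.refl (S.1# S.- const v S.* E) (egf G) ⟩
      (S.1# S.- const v S.* E) S.* egf G S.- (S.1# S.- const v S.* E)
        ≈⟨ S.+-congʳ (S.trans (S.*-congʳ (S.+-congˡ (S.-‿cong (S.*-congˡ (S.*-congʳ
             (Exp-cong (solve 3 (λ u v d → u :* (:1 :- v) :* d := (:1 :- v) :* d :* u) refl u v d))))))) egf-G) ⟩
      const (1# - v) S.- (S.1# S.- const v S.* E)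
        ≈⟨ S.+-congʳ (S.trans (const-+ 1# (- v)) (S.+-congˡ (const-neg v))) ⟩
      (S.1# S.- const v) S.- (S.1# S.- const v S.* E)
        ≈⟨ solveₛ 2 (λ v e → (⊤ ⊖ v) ⊖ (⊤ ⊖ v ⊗ e) ⊜ v ⊗ (e ⊖ ⊤)) S.refl (const v) E ⟩
      const v S.* (E S.- S.1#) ∎

    ∑P-closedForm : ∀ r → r * coeff (S.1# S.- const v S.* E) 0 ≈ 1# →
      ∑≥1 (λ n → P n y t * 1/[ n ]!) S.≈
      const (v * (1# + u) * d) S.* ((E S.- S.1#) S.* recip r (S.1# S.- const v S.* E))
    ∑P-closedForm r r*g₀≈1 = begin
      ∑≥1 (λ n → P n y t * 1/[ n ]!)
        ≈⟨ ∑P≈d[1+u][G-1] ⟩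
      const (d * (1# + u)) S.* (egf G S.- S.1#)
        ≈⟨ S.*-congˡ (*-recip-unique r r*g₀≈1 [1-vE][G-1]≈v[E-1]) ⟨
      const (d * (1# + u)) S.* (const v S.* (E S.- S.1#) S.* recip r g)
        ≈⟨ solveₛ 4 (λ w v e r → w ⊗ (v ⊗ e ⊗ r) ⊜ w ⊗ v ⊗ (e ⊗ r))
             S.refl (const (d * (1# + u))) (const v) (E S.- S.1#) (recip r g) ⟩
      const (d * (1# + u)) S.* const v S.* ((E S.- S.1#) S.* recip r g)
        ≈⟨ S.*-congʳ (S.trans (S.sym (const-* (d * (1# + u)) v))
             (const-cong (solve 3 (λ u v d → d :* (:1 :+ u) :* v := v :* (:1 :+ u) :* d) refl u v d))) ⟩
      const (v * (1# + u) * d) S.* ((E S.- S.1#) S.* recip r g) ∎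
      where g = S.1# S.- const v S.* E

-- The series u and v over ℚ[y].

module RationalUV where

  ℚ[y] : CommutativeRing _ _
  ℚ[y] = Polynomials.commutativeRing (ringOf ℚ-domain)

  open Polynomials (ringOf ℚ-domain) using (X; const; toSeries-≈)
  open RootAndUV ℚ[y] X public
  open PowerSeries (ringOf ℚ-domain) using (at)
  open Cancellation (polynomialDomain ℚ-domain) using (cancel)

  private
    module C = CommutativeRing ℚ[y]
    module const = IsRingHomomorphism (Embeddings.polynomialConst (ringOf ℚ-domain))

  1≢0 : ℚ.1ℚ ≢ ℚ.0ℚ
  1≢0 ()

  ½*2≈1 : const ℚ.½ C.* (C.1# C.+ C.1#) C.≈ C.1#
  ½*2≈1 = C.trans (C.*-congˡ {const ℚ.½} (C.sym (const.+-homo ℚ.1ℚ ℚ.1ℚ)))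
    (C.sym (const.*-homo ℚ.½ (ℚ.1ℚ ℚ.+ ℚ.1ℚ)))

  open Uniqueness (const ℚ.½) ½*2≈1
    -- The coefficient of y shows that y is nonzero, the constant term that 1 - y is.
    (λ {a} → cancel {X} {a} λ p → 1≢0 (at (toSeries-≈ p) 1))
    (λ {a} → cancel {C.1# C.- X} {a} λ p → 1≢0 (at (toSeries-≈ p) 0)) public

  exists : ∃[ s ] ∃[ u ] ∃[ v ] ℚ[y]⟦t⟧.AreRootAndUV s u v
  exists = s , u , v , (let (p , r) = s-root in p , r , u-spec , v-spec)

  unique : ∀ {s′ u′ v′} → ℚ[y]⟦t⟧.AreRootAndUV s′ u′ v′ → u′ ℚ[y]⟦t⟧.≈ u × v′ ℚ[y]⟦t⟧.≈ v
  unique (p , r , u-eq , v-eq) = u-unique s′≈s u-eq , v-unique s′≈s v-eq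
    where s′≈s = root-unique (p , r) s-root

-- The second identity over ℚ(q)[y][[t]].

module SecondIdentity where

  open OverPowerSeries

  private
    module Pq = Polynomials (ringOf ℚ-domain)
    module Fq = Fractions ℚ[q]
    module Py = Polynomials ℚ⟨q⟩
    module St = PowerSeries Py.commutativeRing
    module C  = CommutativeRing Py.commutativeRing
    module Ry = Polynomials (ringOf ℚ-domain)
    module Q  = CommutativeRing ℚ⟨q⟩
    module Qq = QAnalogues ℚ⟨q⟩ (Fq.embed Pq.X)
    module Qt = QAnalogues coefficientRing q
    open Exp semiring using (_^_)

  coefficient-embedding : Homomorphisms.IsHomomorphism (ringOf ℚ-domain) ℚ⟨q⟩ (λ a → Fq.embed (Pq.const a))
  coefficient-embedding = Composition.isRingHomomorphism Q.trans
    (Embeddings.polynomialConst (ringOf ℚ-domain)) (Embeddings.fractionEmbed ℚ[q])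

  ι-isHomomorphism : Homomorphisms.IsHomomorphism (PowerSeries.commutativeRing Ry.commutativeRing) coefficientRing ι
  ι-isHomomorphism = MapHomomorphisms.mapSeries-isHomomorphism Ry.commutativeRing Py.commutativeRing
    (MapHomomorphisms.mapPolynomial-isHomomorphism (ringOf ℚ-domain) ℚ⟨q⟩ coefficient-embedding _)

  private
    module ι = Homomorphisms.HomomorphismProperties (PowerSeries.commutativeRing Ry.commutativeRing)
                 coefficientRing ι-isHomomorphism
    module ConstP = Homomorphisms.HomomorphismProperties ℚ⟨q⟩ Py.commutativeRing (Embeddings.polynomialConst ℚ⟨q⟩)
    module ConstS = Homomorphisms.HomomorphismProperties Py.commutativeRing coefficientRing
                      (Embeddings.seriesConst Py.commutativeRing)

  constantTerm : Homomorphisms.IsHomomorphism (ringOf ℚ[q]) (ringOf ℚ-domain) (λ f → Pq.coeff f 0)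
  constantTerm = Homomorphisms.isHomomorphism (ringOf ℚ[q]) (ringOf ℚ-domain)
    (λ p → PowerSeries.at (Pq.toSeries-≈ p) 0) (λ _ _ → ≡.refl) (λ _ _ → ℚ.+-identityʳ _) ≡.refl

  -- The q-factorial is the image of a polynomial in q with constant term 1.
  [n]!≉0 : ∀ n → ¬ Qq.[ n ]! Fq.≃ Fq.embed (DiscreteDomain.0# ℚ[q])
  [n]!≉0 n p = CT.embed≉0 {QAnalogues.[_]! (ringOf ℚ[q]) Pq.X n} (CT.≈1⇒≉0 (CT.[n]!≈1 Pq.X ≡.refl n))
    (Q.trans (Embed.[n]!-homo Pq.X n) p)
    where
    module CT = ConstantTerm ℚ[q] (ringOf ℚ-domain) (λ ()) {λ f → Pq.coeff f 0} constantTerm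
    module Embed = Homomorphisms.HomomorphismProperties (ringOf ℚ[q]) ℚ⟨q⟩ (Embeddings.fractionEmbed ℚ[q])

  -- The inverse is taken in the field ℚ(q); the relation is carried along the two inclusions of
  -- constants.
  [n]!*1/[n]!≈1 : ∀ n → Qt.[ n ]! * 1/[ n ]! ≈ 1#
  [n]!*1/[n]!≈1 n = trans (*-congʳ (sym [n]!-const)) (trans
    (sym (ConstS.*-homo (Py.const Qq.[ n ]!) (Py.const (Qq.[ n ]! Fq.⁻¹))))
    (trans (ConstS.⟦⟧-cong (C.trans (C.sym (ConstP.*-homo Qq.[ n ]! (Qq.[ n ]! Fq.⁻¹)))
      (C.trans (ConstP.⟦⟧-cong (Fq.⁻¹-inverse Qq.[ n ]! ([n]!≉0 n))) ConstP.1#-homo))) ConstS.1#-homo))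
    where
    [n]!-const : St.const (Py.const Qq.[ n ]!) ≈ Qt.[ n ]!
    [n]!-const = trans (ConstS.⟦⟧-cong (ConstP.[n]!-homo (Fq.embed Pq.X) n))
      (ConstS.[n]!-homo (Py.const (Fq.embed Pq.X)) n)

  inverse-cancel : ∀ g → St.coeff g 0 C.≈ C.1# → inverse g * g ≈ 1#
  inverse-cancel g p = trans (*-comm _ _) (St.recip-inverse C.1# g (C.trans (C.*-identityˡ _) p))

  ι-y : ι ℚ[y]⟦t⟧.y ≈ y
  ι-y = trans (Homomorphisms.mapSeries-const Ry.commutativeRing Py.commutativeRing polynomial-hom Ry.X)
    (ConstS.⟦⟧-cong (Py.pointwise (Homomorphisms.mapSeries-X (ringOf ℚ-domain) ℚ⟨q⟩ coefficient-embedding)))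
    where
    polynomial-hom = MapHomomorphisms.mapPolynomial-isHomomorphism (ringOf ℚ-domain) ℚ⟨q⟩ coefficient-embedding _

  ι-t : ι ℚ[y]⟦t⟧.t ≈ t
  ι-t = Homomorphisms.mapSeries-X Ry.commutativeRing Py.commutativeRing polynomial-hom
    where
    polynomial-hom = MapHomomorphisms.mapPolynomial-isHomomorphism (ringOf ℚ-domain) ℚ⟨q⟩ coefficient-embedding _

  private
    module L = ℚ[y]⟦t⟧
    module RUV = RationalUV
    open Exp L.semiring using () renaming (_^_ to _^ᴸ_)

  u v : Carrier
  u = ι RUV.u
  v = ι RUV.v

  ι-1+ : ∀ a → ι (L.1# L.+ a) ≈ 1# + ι a
  ι-1+ a = trans (ι.+-homo L.1# a) (+-congʳ ι.1#-homo)

  ι-1+uv : ι (L.1# L.+ RUV.u L.* RUV.v) ≈ 1# + u * v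
  ι-1+uv = trans (ι-1+ (RUV.u L.* RUV.v)) (+-congˡ (ι.*-homo RUV.u RUV.v))

  t[1+uv]≈u+v : t * (1# + u * v) ≈ u + v
  t[1+uv]≈u+v = trans (sym (trans (ι.*-homo L.t (L.1# L.+ RUV.u L.* RUV.v)) (*-cong ι-t ι-1+uv)))
    (trans (ι.⟦⟧-cong RUV.t[1+uv]≈u+v) (ι.+-homo RUV.u RUV.v))

  v[1+u]²≈yt[1+uv]² : v * (1# + u) ^ 2 ≈ y * t * (1# + u * v) ^ 2
  v[1+u]²≈yt[1+uv]² = begin
    v * (1# + u) ^ 2
      ≈⟨ trans (ι.*-homo RUV.v ((L.1# L.+ RUV.u) ^ᴸ 2))
           (*-congˡ (trans (ι.^-homo (L.1# L.+ RUV.u) 2) (^-congˡ 2 (ι-1+ RUV.u)))) ⟨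
    ι (RUV.v L.* (L.1# L.+ RUV.u) ^ᴸ 2)
      ≈⟨ ι.⟦⟧-cong RUV.v[1+u]²≈yt[1+uv]² ⟩
    ι (L.y L.* L.t L.* (L.1# L.+ RUV.u L.* RUV.v) ^ᴸ 2)
      ≈⟨ trans (ι.*-homo (L.y L.* L.t) ((L.1# L.+ RUV.u L.* RUV.v) ^ᴸ 2))
           (*-cong (trans (ι.*-homo L.y L.t) (*-cong ι-y ι-t))
             (trans (ι.^-homo (L.1# L.+ RUV.u L.* RUV.v) 2) (^-congˡ 2 ι-1+uv))) ⟩
    y * t * (1# + u * v) ^ 2 ∎
    where
    open Exp semiring using (^-congˡ)
    open import Relation.Binary.Reasoning.Setoid setoid

  coeff-v-zero : St.coeff v 0 C.≈ C.0#
  coeff-v-zero = C.trans (P.⟦⟧-cong RUV.coeff-v-zero) P.0#-homo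
    where
    module P = IsRingHomomorphism (MapHomomorphisms.mapPolynomial-isHomomorphism
                 (ringOf ℚ-domain) ℚ⟨q⟩ coefficient-embedding _)

  coeff-1+av-zero : ∀ a {v′} → v′ ≈ v → St.coeff (1# + a * v′) 0 C.≈ C.1#
  coeff-1+av-zero a v′≈v = C.trans (C.+-congˡ (C.trans (C.+-identityʳ _)
    (C.trans (C.*-congˡ (C.trans (St.at v′≈v 0) coeff-v-zero)) (C.zeroʳ _)))) (C.+-identityʳ _)

  coeff-1-v-zero : ∀ {v′} → v′ ≈ v → St.coeff (1# - v′) 0 C.≈ C.1#
  coeff-1-v-zero v′≈v = C.trans (C.+-congˡ (C.trans (C.-‿cong (C.trans (St.at v′≈v 0) coeff-v-zero))
    (RingProperties.-0#≈0# C.ring))) (C.+-identityʳ _)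

  -- Any representatives of u and v are allowed, since the theorem quantifies over all triples
  -- satisfying the defining equations.
  module _ (u′ v′ : Carrier) (u′≈u : u′ ≈ u) (v′≈v : v′ ≈ v) where

    private
      1+uv-cong : 1# + u′ * v′ ≈ 1# + u * v
      1+uv-cong = +-congˡ (*-cong u′≈u v′≈v)

      open Exp semiring using (^-congˡ)

      module CF = ClosedForm.Parameters coefficientRing q 1/[_]! [n]!*1/[n]!≈1 u′ v′ (inverse (1# + u′ * v′)) y t
        (inverse-cancel (1# + u′ * v′) (coeff-1+av-zero u′ v′≈v))
        (trans (*-congˡ 1+uv-cong) (trans t[1+uv]≈u+v (sym (+-cong u′≈u v′≈v))))
        (trans (*-cong v′≈v (^-congˡ 2 (+-congˡ u′≈u)))
          (trans v[1+u]²≈yt[1+uv]² (*-congˡ (^-congˡ 2 (sym 1+uv-cong)))))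

      E : Series
      E = Exp-q (u′ * (1# - v′) / (1# + u′ * v′)) *ₓ exp-q ((1# - v′) / (1# + u′ * v′))

    identity : ∑≥1 (λ n → P n y t * 1/[ n ]!) ≈ₓ
               const (v′ * (1# + u′) / (1# + u′ * v′)) *ₓ ((E -ₓ 1ₓ) /ₓ (1ₓ -ₓ const v′ *ₓ E))
    identity = CF.∑P-closedForm (1# / coeff (1ₓ -ₓ const v′ *ₓ E) 0)
      -- The denominator has x⁰-coefficient 1 - v, whose constant term in t is 1, so `inverse` is a
      -- true inverse here.
      (trans (*-congʳ (*-identityˡ _)) (inverse-cancel (coeff (1ₓ -ₓ const v′ *ₓ E) 0)
        (C.trans (St.at CF.coeff-denominator 0) (coeff-1-v-zero v′≈v))))

  secondIdentity : ∀ s u′ v′ → ℚ[y]⟦t⟧.AreRootAndUV s u′ v′ →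
      let u = ι u′
          v = ι v′
          E = Exp-q (u * (1# - v) / (1# + u * v)) *ₓ exp-q ((1# - v) / (1# + u * v))
      in
      ∑≥1 (λ n → P n y t * 1/[ n ]!)
        ≈ₓ
      const (v * (1# + u) / (1# + u * v)) *ₓ ((E -ₓ 1ₓ) /ₓ (1ₓ -ₓ const v *ₓ E))
  secondIdentity s u′ v′ h = identity (ι u′) (ι v′)
    (ι.⟦⟧-cong (proj₁ (RUV.unique h))) (ι.⟦⟧-cong (proj₂ (RUV.unique h)))

-- The first identity, obtained from the generating function by x ↦ x / s.
module RescaledForm {c ℓ} (R : CommutativeRing c ℓ) (q : CommutativeRing.Carrier R)
  (1/[_]! : ℕ → CommutativeRing.Carrier R) ([n]!*1/[n]!≈1 : InverseFactorials R q 1/[_]!) where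

  open CommutativeRing R hiding (zero)
  open QAnalogues R q
  open Exp semiring using (_^_)
  open QExponentials R q 1/[_]!
  open PowerSeries R using (Series; coeff; at; const; recip; ∑≥1)
  open PowerSeries R using () renaming (commutativeRing to seriesRing)
  open CommutativeExp commutativeSemiring using (^-distrib-*)
  open Exp semiring using (^-congˡ)
  private
    module S = CommutativeRing seriesRing
    module ≈ₛ-Reasoning where
      open import Relation.Binary.Reasoning.Setoid S.setoid public
    module ≈-Reasoning where
      open import Relation.Binary.Reasoning.Setoid setoid public
  open IntegerSolver R
  open Convolution R
  open QCalculus R q 1/[_]! [n]!*1/[n]!≈1

  module Parameters (y t : Carrier) (_⁻¹ : Carrier → Carrier)
    (1+yt-inverse : (1# + y * t) * (1# + y * t) ⁻¹ ≈ 1#)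
    (1-t-inverse : (1# - t) * (1# - t) ⁻¹ ≈ 1#)
    (coefficient-inverse : ∀ n → ((1# + y) * (1# - t) ^ n) * ((1# + y) * (1# - t) ^ n) ⁻¹ ≈ 1#)
    (Y-inverse : ((y + t) * (1# + y * t)) * ((y + t) * (1# + y * t)) ⁻¹ ≈ 1#) where

    infixl 7 _/_
    _/_ : Carrier → Carrier → Carrier
    a / b = a * b ⁻¹

    -- The case u = y, v = t; ρ is 1/s, the factor by which x is rescaled.
    Y T d ρ : Carrier
    Y = (1# + y) ^ 2 * t / ((y + t) * (1# + y * t))
    T = (y + t) / (1# + y * t)
    d = (1# + y * t) ⁻¹
    ρ = (1# + y * t) / (1# - t)

    private
      d[1+yt]≈1 : d * (1# + y * t) ≈ 1#
      d[1+yt]≈1 = trans (*-comm _ _) 1+yt-inverse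

      YT≈t[1+y]²d² : Y * T ≈ t * (1# + y) ^ 2 * d ^ 2
      YT≈t[1+y]²d² = begin
        z * t * e * (w * d)                   ≈⟨ solve 1 (λ a → a := a :* :1) refl _ ⟩
        -- Only the product `w * p` has the inverse `e`, so a factor p is first supplied by p d = 1.
        z * t * e * (w * d) * 1#              ≈⟨ *-congˡ 1+yt-inverse ⟨
        z * t * e * (w * d) * (p * d)
          ≈⟨ solve 6 (λ z t e w d p → z :* t :* e :* (w :* d) :* (p :* d) := t :* z :* (d :* (d :* :1)) :* (w :* p :* e))
               refl z t e w d p ⟩
        t * z * d ^ 2 * (w * p * e)           ≈⟨ trans (*-congˡ Y-inverse) (*-identityʳ _) ⟩
        t * z * d ^ 2                         ∎
        where
        open ≈-Reasoning
        z = (1# + y) ^ 2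
        w = y + t
        p = 1# + y * t
        e = (w * p) ⁻¹

    open GeneratingFunction.Parameters R q 1/[_]! [n]!*1/[n]!≈1 y t d T Y d[1+yt]≈1 (*-comm (y + t) d) YT≈t[1+y]²d²

    ρs≈1 : ρ * s ≈ 1#
    ρs≈1 = trans
      (solve 4 (λ p j w d → p :* j :* (w :* d) := (p :* d) :* (w :* j)) refl (1# + y * t) ((1# - t) ⁻¹) (1# - t) d)
      (trans (*-cong 1+yt-inverse 1-t-inverse) (*-identityˡ 1#))

    g : Series
    g = S.1# S.- const t S.* (Exp-q y S.* exp-q 1#)

    coeff-g : coeff g 0 ≈ 1# - t
    coeff-g = +-congˡ (-‿cong (trans (+-identityʳ _) (trans (*-congˡ (coeff-Exp*exp-zero y 1#)) (*-identityʳ t))))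

    h : Series
    h = S.1# S.+ ∑≥1 (λ n → (1# + y * t) ^ suc n / ((1# + y) * (1# - t) ^ n) * P n Y T * 1/[ n ]!)

    -- The substitution x ↦ ρ x multiplies the arguments s y x and s x by ρ, and ρ s = 1.
    scale-denominator : scale ρ (S.1# S.- const t S.* (Exp-q (s * y) S.* exp-q s)) S.≈ g
    scale-denominator = begin
      scale ρ (S.1# S.- const t S.* (Exp-q (s * y) S.* exp-q s))
        ≈⟨ S.trans (scale-+ ρ _ _) (S.+-cong (scale-const ρ 1#) (scale-neg ρ _)) ⟩
      S.1# S.- scale ρ (const t S.* (Exp-q (s * y) S.* exp-q s))
        ≈⟨ S.+-congˡ (S.-‿cong (S.trans (scale-* ρ (const t) _)
             (S.*-cong (scale-const ρ t) (scale-* ρ (Exp-q (s * y)) (exp-q s))))) ⟩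
      S.1# S.- const t S.* (scale ρ (Exp-q (s * y)) S.* scale ρ (exp-q s))
        ≈⟨ S.+-congˡ (S.-‿cong (S.*-congˡ (S.*-cong
             (S.trans (scale-Exp ρ (s * y)) (Exp-cong (trans (sym (*-assoc ρ s y)) (trans (*-congʳ ρs≈1) (*-identityˡ y)))))
             (S.trans (scale-exp ρ s) (exp-cong ρs≈1))))) ⟩
      g ∎
      where open ≈ₛ-Reasoning

    -- By `P-G`, the coefficient P is d (1 + y) G; solving for G brings in the extra factor (1 + yt)
    -- / (1 + y).
    coefficient : ∀ n → ρ ^ suc n * G (suc n) ≈
                  (1# + y * t) ^ suc (suc n) / ((1# + y) * (1# - t) ^ suc n) * P (suc n) Y T
    coefficient n = begin
      (p * j) ^ m * x
        ≈⟨ *-congʳ (^-distrib-* p j m) ⟩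
      p ^ m * j ^ m * x
        ≈⟨ solve 3 (λ a b x → a :* b :* x := a :* b :* x :* (:1 :* :1)) refl (p ^ m) (j ^ m) x ⟩
      p ^ m * j ^ m * x * (1# * 1#)
        -- `e` inverts the product `z * w ^ m` as a whole, so its factors are supplied together,
        -- along with d p = 1.
        ≈⟨ *-congˡ (*-cong d[1+yt]≈1 (coefficient-inverse m)) ⟨
      p ^ m * j ^ m * x * (d * p * (z * w ^ m * e))
        ≈⟨ solve 8 (λ a b x d p z c e → a :* b :* x :* (d :* p :* (z :* c :* e)) :=
             c :* b :* (p :* a :* e :* (d :* z :* x))) refl (p ^ m) (j ^ m) x d p z (w ^ m) e ⟩
      w ^ m * j ^ m * (p ^ suc m * e * (d * z * x))
        ≈⟨ *-cong (trans (sym (^-distrib-* w j m)) (trans (^-congˡ m 1-t-inverse) (1^m m))) (*-congˡ (sym (P-G n))) ⟩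
      1# * (p ^ suc m * e * P m Y T)
        ≈⟨ *-identityˡ _ ⟩
      p ^ suc m * e * P m Y T ∎
      where
      open ≈-Reasoning
      m = suc n
      p = 1# + y * t
      w = 1# - t
      z = 1# + y
      j = w ⁻¹
      x = G m
      e = (z * w ^ m) ⁻¹
      1^m : ∀ m → 1# ^ m ≈ 1#
      1^m zero    = refl
      1^m (suc m) = trans (*-identityˡ _) (1^m m)

    scale-egf-G : scale ρ (egf G) S.≈ h
    at scale-egf-G zero    = trans (*-identityˡ _) (trans (*-identityˡ _) (trans 1/[0]!≈1 (sym (+-identityʳ 1#))))
    at scale-egf-G (suc n) = trans (sym (*-assoc _ _ _)) (trans (*-congʳ (coefficient n)) (sym (+-identityˡ _)))

    quotient : ∀ r → r * coeff g 0 ≈ 1# → const (1# - t) S.* recip r g S.≈ h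
    quotient r r*g₀≈1 = *-recip-unique r r*g₀≈1 (begin
      g S.* h
        ≈⟨ S.*-cong scale-denominator scale-egf-G ⟨
      scale ρ (S.1# S.- const t S.* (Exp-q (s * y) S.* exp-q s)) S.* scale ρ (egf G)
        ≈⟨ scale-* ρ _ (egf G) ⟨
      scale ρ ((S.1# S.- const t S.* (Exp-q (s * y) S.* exp-q s)) S.* egf G)
        ≈⟨ scale-cong ρ egf-G ⟩
      scale ρ (const (1# - t))
        ≈⟨ scale-const ρ (1# - t) ⟩
      const (1# - t) ∎)
      where open ≈ₛ-Reasoning

-- The first identity over ℚ(q,y,t).

module FirstIdentity where

  open OverRationalFunctions

  private
    module D  = DiscreteDomain ℚ[q,y,t]
    module Pq = Polynomials (ringOf ℚ-domain)
    module Py = Polynomials (ringOf ℚ[q])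
    module Pt = Polynomials (ringOf ℚ[q,y])
    module Embed = Homomorphisms.HomomorphismProperties (ringOf ℚ[q,y,t]) fractionRing
                     (Embeddings.fractionEmbed ℚ[q,y,t])
    module Dᴱ = Exp D.semiring
    module F = Fractions ℚ[q,y,t]

  constantTerm : Pt.Polynomial → ℚ.ℚ
  constantTerm f = Pq.coeff (Py.coeff (Pt.coeff f 0) 0) 0

  constantTerm-isHomomorphism : Homomorphisms.IsHomomorphism (ringOf ℚ[q,y,t]) (ringOf ℚ-domain) constantTerm
  constantTerm-isHomomorphism = Composition.isRingHomomorphism ≡.trans
    (Homomorphisms.isHomomorphism (ringOf ℚ[q,y,t]) (ringOf ℚ[q,y]) {λ f → Pt.coeff f 0}
      (λ p → PowerSeries.at (Pt.toSeries-≈ p) 0) (λ _ _ → Dy.refl) (λ _ _ → Dy.+-identityʳ _) Dy.refl)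
    (Composition.isRingHomomorphism ≡.trans
      (Homomorphisms.isHomomorphism (ringOf ℚ[q,y]) (ringOf ℚ[q]) {λ f → Py.coeff f 0}
        (λ p → PowerSeries.at (Py.toSeries-≈ p) 0) (λ _ _ → Dq.refl) (λ _ _ → Dq.+-identityʳ _) Dq.refl)
      (Homomorphisms.isHomomorphism (ringOf ℚ[q]) (ringOf ℚ-domain) {λ f → Pq.coeff f 0}
        (λ p → PowerSeries.at (Pq.toSeries-≈ p) 0) (λ _ _ → ≡.refl) (λ _ _ → ℚ.+-identityʳ _) ≡.refl))
    where
    module Dy = CommutativeRing (ringOf ℚ[q,y])
    module Dq = CommutativeRing (ringOf ℚ[q])

  private
    module ε = Homomorphisms.HomomorphismProperties (ringOf ℚ[q,y,t]) (ringOf ℚ-domain) constantTerm-isHomomorphism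
    module CT = ConstantTerm ℚ[q,y,t] (ringOf ℚ-domain) (λ ()) {constantTerm} constantTerm-isHomomorphism

  Y T : Pt.Polynomial
  Y = Pt.const Py.X
  T = Pt.X

  1+yt≉0 : ¬ 1# + y * t ≈ 0#
  1+yt≉0 p = CT.embed≉0 {D.1# D.+ Y D.* T} (CT.≈1⇒≉0 ≡.refl)
    (trans (trans (Embed.+-homo D.1# (Y D.* T)) (+-congˡ (Embed.*-homo Y T))) p)

  1-t≉0 : ¬ 1# - t ≈ 0#
  1-t≉0 p = CT.embed≉0 {D.1# D.- T} (CT.≈1⇒≉0 ≡.refl)
    (trans (trans (Embed.+-homo D.1# (D.- T)) (+-congˡ (Embed.-‿homo T))) p)

  [1+y][1-t]^n≉0 : ∀ n → ¬ (1# + y) * (1# - t) ^ n ≈ 0#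
  [1+y][1-t]^n≉0 n p = CT.embed≉0 {(D.1# D.+ Y) D.* (D.1# D.- T) Dᴱ.^ n} (CT.≈1⇒≉0 constantTerm≡1)
    (trans (trans (Embed.*-homo (D.1# D.+ Y) ((D.1# D.- T) Dᴱ.^ n)) (*-cong (Embed.+-homo D.1# Y)
      (trans (Embed.^-homo (D.1# D.- T) n)
        (^-congˡ n (trans (Embed.+-homo D.1# (D.- T)) (+-congˡ (Embed.-‿homo T))))))) p)
    where
    open Exp semiring using (^-congˡ)
    constantTerm≡1 : constantTerm ((D.1# D.+ Y) D.* (D.1# D.- T) Dᴱ.^ n) ≡ ℚ.1ℚ
    constantTerm≡1 = ≡.trans (ε.*-homo (D.1# D.+ Y) ((D.1# D.- T) Dᴱ.^ n))
      (≡.trans (ℚ.*-identityˡ _) (≡.trans (ε.^-homo (D.1# D.- T) n) (1^n n)))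
      where
      open Exp (CommutativeRing.semiring (ringOf ℚ-domain)) using () renaming (_^_ to _^ℚ_)
      1^n : ∀ n → ℚ.1ℚ ^ℚ n ≡ ℚ.1ℚ
      1^n zero    = ≡.refl
      1^n (suc n) = ≡.trans (ℚ.*-identityˡ _) (1^n n)

  [y+t][1+yt]≉0 : ¬ (y + t) * (1# + y * t) ≈ 0#
  [y+t][1+yt]≉0 p = CT.embed≉0 {(Y D.+ T) D.* (D.1# D.+ Y D.* T)}
    (D.integral {Y D.+ T} {D.1# D.+ Y D.* T} y+t≉0 (CT.≈1⇒≉0 ≡.refl))
    (trans (trans (Embed.*-homo (Y D.+ T) (D.1# D.+ Y D.* T)) (*-cong (Embed.+-homo Y T)
      (trans (Embed.+-homo D.1# (Y D.* T)) (+-congˡ (Embed.*-homo Y T))))) p)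
    where
    1≢0 : ¬ ℚ.1ℚ ≡ ℚ.0ℚ
    1≢0 ()
    -- The constant term of y + t is zero; its coefficient of y is 1 and shows that it does not
    -- vanish.
    y+t≉0 : ¬ (Y D.+ T) D.≈ D.0#
    y+t≉0 p = 1≢0 (PowerSeries.at (Pq.toSeries-≈ (PowerSeries.at (Py.toSeries-≈ (PowerSeries.at (Pt.toSeries-≈ p) 0)) 1)) 0)

  [n]!*1/[n]!≈1 : ∀ n → [ n ]! * 1/[ n ]! ≈ 1#
  [n]!*1/[n]!≈1 n = F.⁻¹-inverse [ n ]! λ p →
    CT.embed≉0 {QAnalogues.[_]! (ringOf ℚ[q,y,t]) Q n} (CT.≈1⇒≉0 (CT.[n]!≈1 Q ≡.refl n)) (trans (Embed.[n]!-homo Q n) p)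
    where
    Q : Pt.Polynomial
    Q = Pt.const (Py.const Pq.X)

  private
    module RF = RescaledForm.Parameters fractionRing q 1/[_]! [n]!*1/[n]!≈1 y t _⁻¹
      (F.⁻¹-inverse (1# + y * t) 1+yt≉0)
      (F.⁻¹-inverse (1# - t) 1-t≉0)
      (λ n → F.⁻¹-inverse ((1# + y) * (1# - t) ^ n) ([1+y][1-t]^n≉0 n))
      (F.⁻¹-inverse ((y + t) * (1# + y * t)) [y+t][1+yt]≉0)

  firstIdentity : const (1# - t) /ₓ (1ₓ -ₓ const t *ₓ (Exp-q y *ₓ exp-q 1#))
      ≈ₓ
    1ₓ +ₓ ∑≥1 (λ n →
      (1# + y * t) ^ suc n / ((1# + y) * (1# - t) ^ n)
        * P n ((1# + y) ^ 2 * t / ((y + t) * (1# + y * t))) ((y + t) / (1# + y * t))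
        * 1/[ n ]!)
  firstIdentity = RF.quotient (coeff RF.g 0 ⁻¹) (trans (*-comm (coeff RF.g 0 ⁻¹) (coeff RF.g 0))
    (F.⁻¹-inverse (coeff RF.g 0) λ p → 1-t≉0 (trans (sym RF.coeff-g) p)))

theorem4p3 :
  (let open OverRationalFunctions in
    const (1# - t) /ₓ (1ₓ -ₓ const t *ₓ (Exp-q y *ₓ exp-q 1#))
      ≈ₓ
    1ₓ +ₓ ∑≥1 (λ n →
      (1# + y * t) ^ suc n / ((1# + y) * (1# - t) ^ n)
        * P n ((1# + y) ^ 2 * t / ((y + t) * (1# + y * t))) ((y + t) / (1# + y * t))
        * 1/[ n ]!))
  ×
  (∃[ s ] ∃[ u ] ∃[ v ] ℚ[y]⟦t⟧.AreRootAndUV s u v)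
  ×
  (∀ s u′ v′ → ℚ[y]⟦t⟧.AreRootAndUV s u′ v′ →
    let open OverPowerSeries
        u = ι u′
        v = ι v′
        E = Exp-q (u * (1# - v) / (1# + u * v)) *ₓ exp-q ((1# - v) / (1# + u * v))
    in
    ∑≥1 (λ n → P n y t * 1/[ n ]!)
      ≈ₓ
    const (v * (1# + u) / (1# + u * v)) *ₓ ((E -ₓ 1ₓ) /ₓ (1ₓ -ₓ const v *ₓ E)))
theorem4p3 = FirstIdentity.firstIdentity , RationalUV.exists , SecondIdentity.secondIdentity
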